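{- Let $\lambda:\mathbb N\to\mathbb N$ be any function with $\lambda(n)\to\infty$. For every $\rho>0$ there exists $\gamma>0$ such that for every $\lambda$-well-behaved feasible degree sequence $\mathcal D$ of length $n$, the probability that $G(\mathcal D)$ has no component of order at least $\gamma n$ and $H(\mathcal D)$ has a component of size at least $\rho M_{\mathcal D}$ is $o(1)$ (as $n\to\infty$, uniformly in such $\mathcal D$).
   Context: A degree sequence $\mathcal D=(d_1,\dots,d_n)$ consists of positive integers (no zero entries) and is feasible if some simple graph on $\{1,\dots,n\}$ has vertex $i$ of degree $d_i$; $G(\mathcal D)$ is a uniformly random simple graph on $\{1,\dots,n\}$ with vertex $i$ of degree $d_i$. $M_{\mathcal D}=\sum_{i:d_i\ne 2}d_i$, and $\mathcal D$ is $\lambda$-well-behaved if $M_{\mathcal D}\ge\lambda(n)$. A component is cyclic if it is a cycle. $H(\mathcal D)$ is the multigraph obtained from $G(\mathcal D)$ by deleting all cyclic components and then suppressing every vertex of degree 2 (deleting it and joining its two neighbours by an edge, possibly creating loops and multiple edges). Order = number of vertices; size = number of edges. -}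

module Defs where

open import Data.Nat as ℕ using (ℕ; zero; suc; _+_; _*_; _≡ᵇ_)
open import Data.Bool using (Bool; true; false; _∧_; _∨_; not; if_then_else_; T)
open import Data.Fin using (Fin; zero; suc; _≟_; _<?_)
open import Data.List using (List; []; _∷_; [_]; map; concatMap; foldl; allFin; replicate; length)
import Data.List as L
open import Data.Nat.ListAction using (sum)
open import Data.Bool.ListAction using (all; any)
open import Data.Integer using (+_)
open import Data.Rational using (ℚ; _/_; _≤ᵇ_) renaming (_*_ to _*ℚ_)
open import Data.Product using (Σ)
open import Relation.Nullary.Decidable using (⌊_⌋)

allFuns : {A : Set} (k : ℕ) → List A → List (Fin k → A)
allFuns zero xs = [ (λ ()) ]
allFuns (suc k) xs =
  concatMap (λ a → map (λ f → λ { zero → a ; (suc i) → f i }) (allFuns k xs)) xs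

allB : {n : ℕ} → (Fin n → Bool) → Bool
allB {n} p = all p (allFin n)

anyB : {n : ℕ} → (Fin n → Bool) → Bool
anyB {n} p = any p (allFin n)

countB : {n : ℕ} → (Fin n → Bool) → ℕ
countB {n} p = sum (map (λ i → if p i then 1 else 0) (allFin n))

sumF : {n : ℕ} → (Fin n → ℕ) → ℕ
sumF {n} f = sum (map f (allFin n))

eqF : {n : ℕ} → Fin n → Fin n → Bool
eqF i j = ⌊ i ≟ j ⌋

ltF : {n : ℕ} → Fin n → Fin n → Bool
ltF i j = ⌊ i <? j ⌋

toℚ : ℕ → ℚ
toℚ n = + n / 1

Adj : ℕ → Set
Adj n = Fin n → Fin n → Bool

isSimple : {n : ℕ} → Adj n → Bool
isSimple G = allB (λ i → allB (λ j → ⌊ Data.Bool._≟_ (G i j) (G j i) ⌋) ∧ not (G i i))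

deg : {n : ℕ} → Adj n → Fin n → ℕ
deg G i = countB (G i)

realises : {n : ℕ} → (Fin n → ℕ) → Adj n → Bool
realises D G = isSimple G ∧ allB (λ i → deg G i ≡ᵇ D i)

-- all graphs in the (uniform) probability space of G(D)
graphsOf : {n : ℕ} → (Fin n → ℕ) → List (Adj n)
graphsOf {n} D = L.filterᵇ (realises D) (allFuns n (allFuns n (true ∷ false ∷ [])))

IsDegreeSequence : {n : ℕ} → (Fin n → ℕ) → Set
IsDegreeSequence D = ∀ i → 1 ℕ.≤ D i

Feasible : {n : ℕ} → (Fin n → ℕ) → Set
Feasible {n} D = Σ (Adj n) (λ G → T (realises D G))

M : {n : ℕ} → (Fin n → ℕ) → ℕ
M D = sumF (λ i → if D i ≡ᵇ 2 then 0 else D i)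

WellBehaved : {n : ℕ} → (ℕ → ℕ) → (Fin n → ℕ) → Set
WellBehaved {n} lam D = lam n ℕ.≤ M D

reachIn : {n : ℕ} → ℕ → Adj n → Fin n → Fin n → Bool
reachIn zero G i j = eqF i j
reachIn (suc k) G i j = reachIn k G i j ∨ anyB (λ l → reachIn k G i l ∧ G l j)

-- same component (walks of length ≤ n suffice)
conn : {n : ℕ} → Adj n → Fin n → Fin n → Bool
conn {n} G = reachIn n G

compOrder : {n : ℕ} → Adj n → Fin n → ℕ
compOrder G v = countB (conn G v)

-- the component of v is cyclic (a cycle): connected and every vertex has
-- degree exactly 2 (in a simple graph this forces ≥ 3 vertices)
inCyclicComp : {n : ℕ} → Adj n → Fin n → Bool
inCyclicComp G v = allB (λ w → if conn G v w then deg G w ≡ᵇ 2 else true)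

-- Multigraphs on (a subset of) Fin n: alive vertices and edge multiplicities
-- (mult i i = number of loops at i; mult symmetric)

record MG (n : ℕ) : Set where
  constructor mg
  field
    alive : Fin n → Bool
    mult  : Fin n → Fin n → ℕ
open MG public

mdeg : {n : ℕ} → MG n → Fin n → ℕ
mdeg H v = sumF (λ j → if eqF v j then 0 else mult H v j) + 2 * mult H v v

nbrs : {n : ℕ} → MG n → Fin n → List (Fin n)
nbrs {n} H v = concatMap (λ j → if eqF v j then [] else replicate (mult H v j) j) (allFin n)

replaceBy : {n : ℕ} → MG n → Fin n → Fin n → Fin n → MG n
replaceBy H v a b = mg
  (λ i → alive H i ∧ not (eqF i v))
  (λ i j → if eqF i v ∨ eqF j v then 0
           else mult H i j + (if (eqF i a ∧ eqF j b) ∨ (eqF i b ∧ eqF j a) then 1 else 0))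

replaceNbrs : {n : ℕ} → MG n → Fin n → List (Fin n) → MG n
replaceNbrs H v (a ∷ b ∷ []) = replaceBy H v a b
replaceNbrs H v _ = H

suppress : {n : ℕ} → MG n → Fin n → MG n
suppress H v =
  if alive H v ∧ (mdeg H v ≡ᵇ 2) ∧ (mult H v v ≡ᵇ 0)
  then replaceNbrs H v (nbrs H v) else H

deleteCyclic : {n : ℕ} → Adj n → MG n
deleteCyclic G = mg
  (λ i → not (inCyclicComp G i))
  (λ i j → if not (inCyclicComp G i) ∧ not (inCyclicComp G j) ∧ G i j then 1 else 0)

-- H(D) for the realisation G: delete cyclic components, then suppress every
-- vertex of degree 2 (one at a time; suppression leaves other degrees intact)
Hof : {n : ℕ} → Adj n → MG n
Hof {n} G = foldl suppress (deleteCyclic G) (allFin n)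

mAdj : {n : ℕ} → MG n → Adj n
mAdj H i j = alive H i ∧ alive H j ∧ not (mult H i j ≡ᵇ 0)

mconn : {n : ℕ} → MG n → Fin n → Fin n → Bool
mconn H = conn (mAdj H)

mCompSize : {n : ℕ} → MG n → Fin n → ℕ
mCompSize H v =
  sumF (λ i → if alive H i ∧ mconn H v i
              then mult H i i + sumF (λ j → if alive H j ∧ mconn H v j ∧ ltF i j
                                            then mult H i j else 0)
              else 0)

badEvent : {n : ℕ} → ℚ → ℚ → (Fin n → ℕ) → Adj n → Bool
badEvent {n} γ ρ D G =
  not (anyB (λ v → (γ *ℚ toℚ n) ≤ᵇ toℚ (compOrder G v)))
  ∧ anyB (λ v → alive (Hof G) v ∧ ((ρ *ℚ toℚ (M D)) ≤ᵇ toℚ (mCompSize (Hof G) v)))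

-- number of realisations of D in the bad event; the probability is
-- badCount / length (graphsOf D)
badCount : {n : ℕ} → ℚ → ℚ → (Fin n → ℕ) → ℕ
badCount γ ρ D = length (L.filterᵇ (badEvent γ ρ D) (graphsOf D))

{-# OPTIONS --safe #-}
module Submission where

-- Write 1/Q ≤ ρ, give every vertex of degree d ≠ 2 the weight d, so that M is the total weight,
-- and let γ = 1/(384 Q). In the bad event a component of small order carries weight at least
-- M/Q (a component of H has at most as many edges as its weight). Choosing a root r with
-- probability proportional to its weight hits this component with probability at least 1/Q, so
-- it suffices to show, for each fixed r, that the component of r is rarely so small and so heavy.
-- This is done by t rounds of 2-switches, each gaining a factor at least 2.
--
-- If M ≥ n/48, the component K of r has far more edges than vertices. Switching non-tree edges
-- of K with edges outside keeps K connected and gives it 2t boundary edges. With s = n/(384 Q)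
-- each step has at least 382 s² choices. To undo all steps one has to pick K among the at most
-- binomial(s + 2t, 2t) connected sets that contain r and have at most 2t boundary edges, and then
-- two boundary edges per step: at most (16 s²)^t choices altogether.
--
-- If M ≤ n/48, most vertices have degree 2. A segment of at most about n/(8M) consecutive
-- degree-2 vertices outside the component of r is closed up into a cycle, and this cycle (or a
-- short cyclic component that is already there) is inserted into an edge xy at a vertex x of
-- degree ≠ 2 of the component of r. Both operations are 2-switches.

open import Defs
open import Data.Nat using (ℕ; suc; _≤_; _*_)
open import Data.Fin using (Fin)
open import Data.List using (length)
open import Data.Rational using (ℚ; 0ℚ) renaming (_<_ to _<ℚ_)
open import Data.Product using (_×_; ∃-syntax)
open import Data.Nat using (zero; _+_; _<_; z≤n; s≤s; _^_; _≡ᵇ_; _/_; _!; NonZero; >-nonZero)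
import Data.Nat as ℕ
open import Data.Nat.Properties hiding (_≟_)
open import Data.Nat.DivMod using (m/n*n≤m; m*n/n≡m; /-monoˡ-≤; m≡m%n+[m/n]*n; m%n<n)
open import Data.Nat.Coprimality using (Coprime; 1-coprimeTo)
open import Data.Nat.ListAction using (sum)
open import Data.Nat.Tactic.RingSolver using (solve-∀)
import Data.Integer as ℤ
import Data.Integer.Properties as ℤₚ
open import Data.Rational using (mkℚ) renaming (_*_ to _*ℚ_; _≤_ to _≤ℚ_; _≤ᵇ_ to _≤ᵇℚ_)
import Data.Rational as ℚ
import Data.Rational.Properties as ℚₚ
open import Data.Rational.Unnormalised using (mkℚᵘ) renaming (_*_ to _*ᵘ_; _≃_ to _≃ᵘ_)
import Data.Rational.Unnormalised as ℚᵘ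
import Data.Rational.Unnormalised.Properties as ℚᵘₚ
open import Data.Bool using (Bool; true; false; _∧_; _∨_; not; if_then_else_; T; _xor_)
open import Data.Bool.ListAction using (all; any)
import Data.Bool.Properties as Boolₚ
open import Data.Fin using (zero; suc; _≟_; toℕ)
open import Data.Fin.Properties using (any?; all?; toℕ<n; toℕ-injective)
  renaming (_<?_ to _<F?_; <-cmp to <F-cmp)
open import Data.List using (List; []; _∷_; map; allFin; cartesianProduct; cartesianProductWith;
  filterᵇ; _++_; concatMap; foldl; replicate)
open import Data.List.Properties using (length-tabulate)
open import Data.List.Membership.Propositional using (_∈_)
open import Data.List.Membership.Propositional.Properties
  using (∈-allFin; ∈-cartesianProduct⁺; ∈-cartesianProductWith⁺)
open import Data.List.Relation.Binary.Pointwise using (Pointwise; []; _∷_; ++⁺; map⁺)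
open import Data.List.Relation.Unary.All using (All; []; _∷_)
open import Data.List.Relation.Unary.AllPairs using ([]; _∷_)
open import Data.List.Relation.Unary.Any using (here; there)
open import Data.List.Relation.Unary.Unique.Propositional using (Unique)
open import Data.List.Relation.Unary.Unique.Propositional.Properties
  using (allFin⁺; cartesianProduct⁺; cartesianProductWith⁺)
open import Data.Vec using (Vec; []; _∷_; lookup; tabulate)
open import Data.Vec.Properties
  using (lookup∘tabulate; tabulate∘lookup; tabulate-cong; ≡-dec; ∷-injective)
open import Data.Product using (_,_; proj₁; proj₂)
open import Data.Product.Properties using () renaming (≡-dec to ×-≡-dec)
open import Data.Sum using (_⊎_; inj₁; inj₂; [_,_]′)
open import Data.Empty using (⊥; ⊥-elim)
open import Data.Unit using (tt)
open import Function using (_∘_; id)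
open import Relation.Binary.Definitions using (DecidableEquality; tri<; tri≈; tri>)
open import Relation.Binary.PropositionalEquality
  using (_≡_; _≢_; refl; sym; trans; cong; cong₂; subst; module ≡-Reasoning)
open import Relation.Nullary using (¬_; Dec; yes; no; does; contradiction)
open import Relation.Nullary.Decidable using (T?; _×-dec_; _⊎-dec_; _→-dec_; ¬?; isYes≗does;
  map′; fromWitness; toWitness)

-- Finite sums and indicators

-- A union bound over roots would cost a factor of order n. Averaging over roots by weight costs
-- only Q, which the rounds repay: to get the bound 1/(k + 1) one takes t = Q (k + 1), and 2 ^ t is
-- at least t. Since t does not depend on n, any polynomial in t is eventually below both s and M.
--
-- Every gain is a double count of pairs of a graph and a quadruple. Toggling a 4-cycle is an
-- involution on all graphs, so the pairs may be counted at either end, and only choices and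
-- reversals have to be compared.
--
-- The two cases are forced by the surplus of edges. If M is at least n/48, the weight M/Q is at
-- least 8 s, while a tree on at most s vertices uses up fewer than 2 s oriented edges. The set K
-- stops being a component after the first switch, so it has to be carried along with the graph and
-- is forgotten only at the end. If M is smaller, the component may be little more than a tree. It
-- then stays a component, and its order is allowed to grow by a fixed h in each round; this costs
-- little, because t h is small compared with n.

∑ᴸ : {A : Set} → List A → (A → ℕ) → ℕ
∑ᴸ xs f = sum (map f xs)

-- Only `does` is inspected, and `does (T? b)` reduces to `b`. Hence `countB p` is by definition the
-- sum of `ι (T? (p i))`, and the lemmas on `ι` apply to it without conversion.
ι : {P : Set} → Dec P → ℕ
ι d = if does d then 1 else 0

ι-yes : {P : Set} (d : Dec P) → P → ι d ≡ 1
ι-yes (yes _) _ = refl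
ι-yes (no ¬p) p = ⊥-elim (¬p p)

ι-no : {P : Set} (d : Dec P) → ¬ P → ι d ≡ 0
ι-no (yes p) ¬p = ⊥-elim (¬p p)
ι-no (no _) _ = refl

ι≤1 : {P : Set} (d : Dec P) → ι d ≤ 1
ι≤1 (yes _) = ≤-refl
ι≤1 (no _) = z≤n

ι-≤ : {P : Set} {a : ℕ} (d : Dec P) → (P → 1 ≤ a) → ι d ≤ a
ι-≤ (yes p) h = h p
ι-≤ (no _) _ = z≤n

ι-mono : {P R : Set} (d : Dec P) (e : Dec R) → (P → R) → ι d ≤ ι e
ι-mono d e h = ι-≤ d (λ p → ≤-reflexive (sym (ι-yes e (h p))))

ι-cong : {P R : Set} (d : Dec P) (e : Dec R) → (P → R) → (R → P) → ι d ≡ ι e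
ι-cong d e h k = ≤-antisym (ι-mono d e h) (ι-mono e d k)

ι*-≤ : {P : Set} {a b : ℕ} (d : Dec P) → (P → a ≤ b) → ι d * a ≤ b
ι*-≤ {a = a} (yes p) h = ≤-trans (≤-reflexive (*-identityˡ a)) (h p)
ι*-≤ (no _) _ = z≤n

ι*-≤* : {P : Set} {a b : ℕ} (d : Dec P) → (P → a ≤ b) → ι d * a ≤ ι d * b
ι*-≤* (yes p) h = *-monoʳ-≤ 1 (h p)
ι*-≤* (no _) _ = z≤n

ι-× : {P R : Set} (d : Dec P) (e : Dec R) → ι (d ×-dec e) ≡ ι d * ι e
ι-× (yes _) (yes _) = refl
ι-× (yes _) (no _) = refl
ι-× (no _) _ = refl

ι-≤-+ : {P R S : Set} (d : Dec P) (e : Dec R) (f : Dec S) → (P → R ⊎ S) → ι d ≤ ι e + ι f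
ι-≤-+ d e f h = ι-≤ d λ p → case⊎ (h p)
  where
  case⊎ : _ ⊎ _ → 1 ≤ ι e + ι f
  case⊎ (inj₁ r) = ≤-trans (≤-reflexive (sym (ι-yes e r))) (m≤m+n (ι e) (ι f))
  case⊎ (inj₂ s) = ≤-trans (≤-reflexive (sym (ι-yes f s))) (m≤n+m (ι f) (ι e))

∑ᴸ-mono : {A : Set} (xs : List A) {f g : A → ℕ} → (∀ x → f x ≤ g x) → ∑ᴸ xs f ≤ ∑ᴸ xs g
∑ᴸ-mono [] h = z≤n
∑ᴸ-mono (x ∷ xs) h = +-mono-≤ (h x) (∑ᴸ-mono xs h)

∑ᴸ-cong : {A : Set} (xs : List A) {f g : A → ℕ} → (∀ x → f x ≡ g x) → ∑ᴸ xs f ≡ ∑ᴸ xs g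
∑ᴸ-cong [] h = refl
∑ᴸ-cong (x ∷ xs) h = cong₂ _+_ (h x) (∑ᴸ-cong xs h)

∑ᴸ-+ : {A : Set} (xs : List A) (f g : A → ℕ) → ∑ᴸ xs (λ x → f x + g x) ≡ ∑ᴸ xs f + ∑ᴸ xs g
∑ᴸ-+ [] f g = refl
∑ᴸ-+ (x ∷ xs) f g rewrite ∑ᴸ-+ xs f g = interchange (f x) (g x) (∑ᴸ xs f) (∑ᴸ xs g)
  where
  interchange : ∀ a b c d → a + b + (c + d) ≡ a + c + (b + d)
  interchange = solve-∀

∑ᴸ-*ˡ : {A : Set} (c : ℕ) (xs : List A) (f : A → ℕ) → ∑ᴸ xs (λ x → c * f x) ≡ c * ∑ᴸ xs f
∑ᴸ-*ˡ c [] f = sym (*-zeroʳ c)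
∑ᴸ-*ˡ c (x ∷ xs) f rewrite ∑ᴸ-*ˡ c xs f = sym (*-distribˡ-+ c (f x) (∑ᴸ xs f))

∑ᴸ-0 : {A : Set} (xs : List A) → ∑ᴸ xs (λ _ → 0) ≡ 0
∑ᴸ-0 [] = refl
∑ᴸ-0 (x ∷ xs) = ∑ᴸ-0 xs

∑ᴸ-const : {A : Set} (c : ℕ) (xs : List A) → ∑ᴸ xs (λ _ → c) ≡ length xs * c
∑ᴸ-const c [] = refl
∑ᴸ-const c (x ∷ xs) = cong (c +_) (∑ᴸ-const c xs)

∑ᴸ-swap : {A B : Set} (xs : List A) (ys : List B) (f : A → B → ℕ) →
  ∑ᴸ xs (λ x → ∑ᴸ ys (f x)) ≡ ∑ᴸ ys (λ y → ∑ᴸ xs (λ x → f x y))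
∑ᴸ-swap [] ys f = sym (∑ᴸ-0 ys)
∑ᴸ-swap (x ∷ xs) ys f rewrite ∑ᴸ-swap xs ys f = sym (∑ᴸ-+ ys (f x) (λ y → ∑ᴸ xs (λ z → f z y)))

∑ᴸ-++ : {A : Set} (xs ys : List A) (f : A → ℕ) → ∑ᴸ (xs ++ ys) f ≡ ∑ᴸ xs f + ∑ᴸ ys f
∑ᴸ-++ [] ys f = refl
∑ᴸ-++ (x ∷ xs) ys f rewrite ∑ᴸ-++ xs ys f = sym (+-assoc (f x) (∑ᴸ xs f) (∑ᴸ ys f))

∑ᴸ-map : {A B : Set} (g : A → B) (xs : List A) (f : B → ℕ) → ∑ᴸ (map g xs) f ≡ ∑ᴸ xs (f ∘ g)
∑ᴸ-map g [] f = refl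
∑ᴸ-map g (x ∷ xs) f = cong (f (g x) +_) (∑ᴸ-map g xs f)

∑ᴸ-concatMap : {A B : Set} (g : A → List B) (xs : List A) (f : B → ℕ) →
  ∑ᴸ (concatMap g xs) f ≡ ∑ᴸ xs (λ x → ∑ᴸ (g x) f)
∑ᴸ-concatMap g [] f = refl
∑ᴸ-concatMap g (x ∷ xs) f =
  trans (∑ᴸ-++ (g x) (concatMap g xs) f) (cong (∑ᴸ (g x) f +_) (∑ᴸ-concatMap g xs f))

∑ᴸ-∈ : {A : Set} {xs : List A} {x : A} (f : A → ℕ) → x ∈ xs → f x ≤ ∑ᴸ xs f
∑ᴸ-∈ f (here refl) = m≤m+n _ _
∑ᴸ-∈ f (there x∈) = ≤-trans (∑ᴸ-∈ f x∈) (m≤n+m _ _)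

∑ᴸ-unique : {A : Set} {P : A → Set} {xs : List A} → Unique xs → (P? : ∀ x → Dec (P x)) →
  (∀ x y → P x → P y → x ≡ y) → ∑ᴸ xs (ι ∘ P?) ≤ 1
∑ᴸ-unique [] P? same = z≤n
∑ᴸ-unique {P = P} {x ∷ xs} (x∉ ∷ u) P? same with P? x
... | no _ = ∑ᴸ-unique u P? same
... | yes px = s≤s (≤-reflexive (rest xs x∉))
  where
  rest : ∀ ys → All (λ y → ¬ x ≡ y) ys → ∑ᴸ ys (ι ∘ P?) ≡ 0
  rest [] [] = refl
  rest (y ∷ ys) (x≢y ∷ ne) rewrite ι-no (P? y) (λ py → x≢y (same x y px py)) = rest ys ne

-- Completeness serves the lower bounds of a double count, absence of repetitions the upper bounds.
record Enum (A : Set) : Set where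
  field
    elems    : List A
    complete : ∀ x → x ∈ elems
    unique   : Unique elems
open Enum

fin : {n : ℕ} → Enum (Fin n)
fin {n} = record { elems = allFin n ; complete = ∈-allFin ; unique = allFin⁺ n }

infixr 4 _⊗_
_⊗_ : {A B : Set} → Enum A → Enum B → Enum (A × B)
E ⊗ F = record
  { elems = cartesianProduct (elems E) (elems F)
  ; complete = λ (x , y) → ∈-cartesianProduct⁺ (complete E x) (complete F y)
  ; unique = cartesianProduct⁺ (unique E) (unique F)
  }

∑ : {A : Set} → Enum A → (A → ℕ) → ℕ
∑ E f = ∑ᴸ (elems E) f

module _ {A : Set} (E : Enum A) where

  ∑-mono : {f g : A → ℕ} → (∀ x → f x ≤ g x) → ∑ E f ≤ ∑ E g
  ∑-mono = ∑ᴸ-mono (elems E)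

  ∑-cong : {f g : A → ℕ} → (∀ x → f x ≡ g x) → ∑ E f ≡ ∑ E g
  ∑-cong = ∑ᴸ-cong (elems E)

  ∑-+ : (f g : A → ℕ) → ∑ E (λ x → f x + g x) ≡ ∑ E f + ∑ E g
  ∑-+ = ∑ᴸ-+ (elems E)

  ∑-*ˡ : (c : ℕ) (f : A → ℕ) → ∑ E (λ x → c * f x) ≡ c * ∑ E f
  ∑-*ˡ c = ∑ᴸ-*ˡ c (elems E)

  ∑-*ʳ : (c : ℕ) (f : A → ℕ) → ∑ E (λ x → f x * c) ≡ ∑ E f * c
  ∑-*ʳ c f = trans (∑-cong (λ x → *-comm (f x) c)) (trans (∑-*ˡ c f) (*-comm c (∑ E f)))

  ∑-∈ : (f : A → ℕ) (x : A) → f x ≤ ∑ E f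
  ∑-∈ f x = ∑ᴸ-∈ f (complete E x)

  ∑-ι-∃ : {P : A → Set} (P? : ∀ x → Dec (P x)) (x : A) → P x → 1 ≤ ∑ E (ι ∘ P?)
  ∑-ι-∃ P? x p = ≤-trans (≤-reflexive (sym (ι-yes (P? x) p))) (∑-∈ (ι ∘ P?) x)

  ∑-unique : {P : A → Set} (P? : ∀ x → Dec (P x)) → (∀ x y → P x → P y → x ≡ y) →
    ∑ E (ι ∘ P?) ≤ 1
  ∑-unique = ∑ᴸ-unique (unique E)

  ∑-swap : {B : Set} (F : Enum B) (f : A → B → ℕ) →
    ∑ E (λ x → ∑ F (f x)) ≡ ∑ F (λ y → ∑ E (λ x → f x y))
  ∑-swap F = ∑ᴸ-swap (elems E) (elems F)

  ∑-⊗ : {B : Set} (F : Enum B) (f : A × B → ℕ) →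
    ∑ (E ⊗ F) f ≡ ∑ E (λ x → ∑ F (λ y → f (x , y)))
  ∑-⊗ F f = go (elems E)
    where
    go : ∀ xs → ∑ᴸ (cartesianProduct xs (elems F)) f ≡ ∑ᴸ xs (λ x → ∑ F (λ y → f (x , y)))
    go [] = refl
    go (x ∷ xs) = trans (∑ᴸ-++ (map (x ,_) (elems F)) (cartesianProduct xs (elems F)) f)
      (cong₂ _+_ (∑ᴸ-map (x ,_) (elems F) f) (go xs))

  -- Exchange of sums, with `h x y` read as the charge that x places on y.
  ∑-double-count : {B : Set} (F : Enum B) {f : A → ℕ} {g : B → ℕ} (h : A → B → ℕ) →
    (∀ x → f x ≤ ∑ F (h x)) → (∀ y → ∑ E (λ x → h x y) ≤ g y) → ∑ E f ≤ ∑ F g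
  ∑-double-count F {f} {g} h lo hi = begin
    ∑ E f                           ≤⟨ ∑-mono lo ⟩
    ∑ E (λ x → ∑ F (h x))           ≡⟨ ∑-swap F h ⟩
    ∑ F (λ y → ∑ E (λ x → h x y))   ≤⟨ ∑ᴸ-mono (elems F) hi ⟩
    ∑ F g                           ∎
    where open ≤-Reasoning

  ∑-ι-injection : {B : Set} (F : Enum B) → DecidableEquality B →
    {P : A → Set} {R : B → Set} (P? : ∀ x → Dec (P x)) (R? : ∀ y → Dec (R y)) (φ : A → B) →
    (∀ x → P x → R (φ x)) → (∀ x y → P x → P y → φ x ≡ φ y → x ≡ y) →
    ∑ E (ι ∘ P?) ≤ ∑ F (ι ∘ R?)
  ∑-ι-injection F _≟ᴮ_ {P} {R} P? R? φ into inj = ∑-double-count F (λ x y → ι (both x y))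
    (λ x → ι-≤ (P? x) (λ p → ≤-trans (≤-reflexive (sym (ι-yes (both x (φ x)) (p , refl))))
        (∑ᴸ-∈ (λ y → ι (both x y)) (complete F (φ x)))))
    (λ y → fibre y (R? y))
    where
    both : ∀ x y → Dec (P x × φ x ≡ y)
    both x y = P? x ×-dec (φ x ≟ᴮ y)
    fibre : ∀ y (d : Dec (R y)) → ∑ E (λ x → ι (both x y)) ≤ ι d
    fibre y (yes _) = ∑-unique (λ x → both x y)
      (λ x z (px , ex) (pz , ez) → inj x z px pz (trans ex (sym ez)))
    fibre y (no ¬r) = ≤-trans (≤-reflexive (∑-cong
      (λ x → ι-no (both x y) (λ (px , ex) → ¬r (subst R ex (into x px))))))
      (≤-reflexive (∑ᴸ-0 (elems E)))

  -- For an involution one inequality is enough: applied to `f ∘ τ` it gives the other.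
  ∑-reindex : DecidableEquality A → (τ : A → A) → (∀ x → τ (τ x) ≡ x) → (f : A → ℕ) →
    ∑ E (f ∘ τ) ≡ ∑ E f
  ∑-reindex _≟ᴬ_ τ inv f = ≤-antisym (half f)
    (≤-trans (≤-reflexive (sym (∑-cong (λ x → cong f (inv x))))) (half (f ∘ τ)))
    where
    half : ∀ f → ∑ E (f ∘ τ) ≤ ∑ E f
    half f = ∑-double-count E (λ x y → ι (τ x ≟ᴬ y) * f y)
      (λ x → ≤-trans (≤-reflexive (sym (trans (cong (_* f (τ x)) (ι-yes (τ x ≟ᴬ τ x) refl)) (*-identityˡ _))))
        (∑-∈ (λ y → ι (τ x ≟ᴬ y) * f y) (τ x)))
      (λ y → ≤-trans (≤-reflexive (∑-*ʳ (f y) (λ x → ι (τ x ≟ᴬ y))))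
        (≤-trans (*-monoˡ-≤ (f y) (∑-unique (λ x → τ x ≟ᴬ y)
          (λ x z ex ez → trans (sym (inv x)) (trans (cong τ (trans ex (sym ez))) (inv z)))))
          (≤-reflexive (*-identityˡ (f y)))))

∑fin-const : ∀ n c → ∑ (fin {n}) (λ _ → c) ≡ n * c
∑fin-const n c = trans (∑ᴸ-const c (allFin n)) (cong (_* c) (length-tabulate {n = n} id))

∑fin-image : ∀ {m n} (f : Fin m → Fin n) → (∀ i j → f i ≡ f j → i ≡ j) →
  {P : Fin n → Set} (P? : ∀ x → Dec (P x)) → (∀ i → P (f i)) → m ≤ ∑ fin (ι ∘ P?)
∑fin-image {m} f inj P? hit = ≤-trans
  (≤-reflexive (sym (trans (∑fin-const m 1) (*-identityʳ m))))
  (∑-ι-injection fin fin _≟_ (λ _ → yes tt) P? f (λ i _ → hit i) (λ i j _ _ → inj i j))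
 

-- Connectivity

T-∧⁺ : ∀ {x y} → T x → T y → T (x ∧ y)
T-∧⁺ {true} {true} _ _ = tt

T-∧⁻ : ∀ {x y} → T (x ∧ y) → T x × T y
T-∧⁻ {true} {true} _ = tt , tt

T-∨⁻ : ∀ {x y} → T (x ∨ y) → T x ⊎ T y
T-∨⁻ {true} t = inj₁ t
T-∨⁻ {false} t = inj₂ t

T-∨ˡ : ∀ {x y} → T x → T (x ∨ y)
T-∨ˡ {true} _ = tt

T-∨ʳ : ∀ {x y} → T y → T (x ∨ y)
T-∨ʳ {true} _ = tt
T-∨ʳ {false} t = t

T-not⁺ : ∀ {x} → ¬ T x → T (not x)
T-not⁺ {true} f = f tt
T-not⁺ {false} _ = tt

T-not⁻ : ∀ {x} → T (not x) → ¬ T x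
T-not⁻ {false} _ ()

T-true : ∀ {x} → T x → x ≡ true
T-true {true} _ = refl

T-false : ∀ {x} → ¬ T x → x ≡ false
T-false {true} f = ⊥-elim (f tt)
T-false {false} _ = refl

T-ext : ∀ {x y} → (T x → T y) → (T y → T x) → x ≡ y
T-ext {true} f g = sym (T-true (f tt))
T-ext {false} f g = sym (T-false (λ t → g t))

module _ {n : ℕ} where

  anyB⁺ : {p : Fin n → Bool} (i : Fin n) → T (p i) → T (anyB p)
  anyB⁺ {p} i t = go (∈-allFin i)
    where
    go : ∀ {xs} → i ∈ xs → T (any p xs)
    go (here refl) = T-∨ˡ t
    go (there {x} i∈) = T-∨ʳ {p x} (go i∈)

  anyB⁻ : {p : Fin n → Bool} → T (anyB p) → ∃[ i ] T (p i)
  anyB⁻ {p} = go (allFin n)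
    where
    go : ∀ xs → T (any p xs) → ∃[ i ] T (p i)
    go (x ∷ xs) t with T-∨⁻ {p x} t
    ... | inj₁ px = x , px
    ... | inj₂ t' = go xs t'

  allB⁺ : {p : Fin n → Bool} → (∀ i → T (p i)) → T (allB p)
  allB⁺ {p} h = go (allFin n)
    where
    go : ∀ xs → T (all p xs)
    go [] = tt
    go (x ∷ xs) = T-∧⁺ (h x) (go xs)

  allB⁻ : {p : Fin n → Bool} → T (allB p) → ∀ i → T (p i)
  allB⁻ {p} t i = go (∈-allFin i) t
    where
    go : ∀ {xs} → i ∈ xs → T (all p xs) → T (p i)
    go (here refl) t = proj₁ (T-∧⁻ t)
    go (there {x} i∈) t = go i∈ (proj₂ (T-∧⁻ {p x} t))

  eqF⁻ : {i j : Fin n} → T (eqF i j) → i ≡ j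
  eqF⁻ {i} {j} t with i ≟ j
  ... | yes e = e

  eqF-refl : (i : Fin n) → T (eqF i i)
  eqF-refl i with i ≟ i
  ... | yes _ = tt
  ... | no i≢i = i≢i refl

  countB≤n : (p : Fin n → Bool) → countB p ≤ n
  countB≤n p = ≤-trans (∑-mono fin (λ i → ι≤1 (T? (p i))))
    (≤-reflexive (trans (∑fin-const n 1) (*-identityʳ n)))

  countB-mono : {p q : Fin n → Bool} → (∀ i → T (p i) → T (q i)) → countB p ≤ countB q
  countB-mono {p} {q} h = ∑-mono fin (λ i → ι-mono (T? (p i)) (T? (q i)) (h i))

  countB-cong : {p q : Fin n → Bool} → (∀ i → p i ≡ q i) → countB p ≡ countB q
  countB-cong h = ∑-cong fin (λ i → cong (λ b → if b then 1 else 0) (h i))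

  countB-mono-< : {p q : Fin n → Bool} (z : Fin n) → (∀ i → T (p i) → T (q i)) →
    ¬ T (p z) → T (q z) → suc (countB p) ≤ countB q
  countB-mono-< {p} {q} z h ¬pz qz = begin
    suc (countB p)                                            ≡⟨ +-comm 1 (countB p) ⟩
    countB p + 1                                              ≤⟨ +-monoʳ-≤ (countB p) (∑-ι-∃ fin (z ≟_) z refl) ⟩
    countB p + ∑ fin (ι ∘ (z ≟_))                             ≡⟨ ∑-+ fin (λ i → ι (T? (p i))) (λ i → ι (z ≟ i)) ⟨
    ∑ fin (λ i → ι (T? (p i)) + ι (z ≟ i))                    ≤⟨ ∑-mono fin pointwise ⟩
    countB q                                                  ∎
    where
    open ≤-Reasoning
    pointwise : ∀ i → ι (T? (p i)) + ι (z ≟ i) ≤ ι (T? (q i))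
    pointwise i with z ≟ i
    ... | yes refl rewrite ι-no (T? (p i)) ¬pz = ≤-reflexive (sym (ι-yes (T? (q i)) qz))
    ... | no _ rewrite +-identityʳ (ι (T? (p i))) = ι-mono (T? (p i)) (T? (q i)) (h i)

  -- By `conn-closed` and `conn-least`, `conn G r` is the least closed set containing r. Most later
  -- arguments on connectivity exhibit a closed set instead of a path.
  Closed : Adj n → (Fin n → Bool) → Set
  Closed G A = ∀ i j → T (A i) → T (G i j) → T (A j)

  reachIn-mono : ∀ k (G : Adj n) r i → T (reachIn k G r i) → T (reachIn (suc k) G r i)
  reachIn-mono k G r i t = T-∨ˡ t

  reachIn-≤ : ∀ {k l} (G : Adj n) r i → k ≤ l → T (reachIn k G r i) → T (reachIn l G r i)
  reachIn-≤ {l = zero} G r i z≤n t = t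
  reachIn-≤ {k} {suc l} G r i k≤ t with m≤n⇒m<n∨m≡n k≤
  ... | inj₁ (s≤s k≤l) = reachIn-mono l G r i (reachIn-≤ G r i k≤l t)
  ... | inj₂ refl = t

  reachIn-step : ∀ k (G : Adj n) r i j → T (reachIn k G r i) → T (G i j) →
    T (reachIn (suc k) G r j)
  reachIn-step k G r i j ri gij =
    T-∨ʳ {reachIn k G r j} (anyB⁺ {λ l → reachIn k G r l ∧ G l j} i (T-∧⁺ ri gij))

  reachIn-suc⁻ : ∀ k (G : Adj n) r j → T (reachIn (suc k) G r j) →
    T (reachIn k G r j) ⊎ ∃[ i ] (T (reachIn k G r i) × T (G i j))
  reachIn-suc⁻ k G r j t with T-∨⁻ {reachIn k G r j} t
  ... | inj₁ rj = inj₁ rj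
  ... | inj₂ a with anyB⁻ {λ l → reachIn k G r l ∧ G l j} a
  ...   | i , ti = inj₂ (i , T-∧⁻ ti)

  reachIn-least : ∀ k {G : Adj n} {A : Fin n → Bool} {r} → Closed G A → T (A r) →
    ∀ i → T (reachIn k G r i) → T (A i)
  reachIn-least zero {A = A} cl ar i t = subst (T ∘ A) (eqF⁻ t) ar
  reachIn-least (suc k) {G} {r = r} cl ar i t with reachIn-suc⁻ k G r i t
  ... | inj₁ rk = reachIn-least k cl ar i rk
  ... | inj₂ (l , rl , gli) = cl l i (reachIn-least k cl ar l rl) gli

  conn-least : {G : Adj n} {A : Fin n → Bool} {r : Fin n} → Closed G A → T (A r) →
    ∀ {i} → T (conn G r i) → T (A i)
  conn-least cl ar {i} = reachIn-least n cl ar i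

  conn-refl : (G : Adj n) (r : Fin n) → T (conn G r r)
  conn-refl G r = reachIn-≤ {0} {n} G r r z≤n (eqF-refl r)

  -- The sets reached within k steps grow strictly until they are closed.
  conn-closed : (G : Adj n) (r : Fin n) → Closed G (conn G r)
  conn-closed G r with grow n
    where
    escape? : ∀ k → Dec (∃[ i ] ∃[ j ] (T (reachIn k G r i) × T (G i j) × ¬ T (reachIn k G r j)))
    escape? k = any? λ i → any? λ j →
      T? (reachIn k G r i) ×-dec T? (G i j) ×-dec ¬? (T? (reachIn k G r j))
    stay : ∀ k → Closed G (reachIn k G r) → Closed G (reachIn (suc k) G r)
    stay k cl i j ri gij with reachIn-suc⁻ k G r i ri
    ... | inj₁ rk = reachIn-mono k G r j (cl i j rk gij)
    ... | inj₂ (l , rl , gli) = reachIn-mono k G r j (cl i j (cl l i rl gli) gij)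
    grow : ∀ k → Closed G (reachIn k G r) ⊎ suc k ≤ countB (reachIn k G r)
    grow zero = inj₂ (∑-ι-∃ fin (λ i → T? (eqF r i)) r (eqF-refl r))
    grow (suc k) with grow k
    ... | inj₁ cl = inj₁ (stay k cl)
    ... | inj₂ big with escape? k
    ...   | yes (i , j , ri , gij , ¬rj) = inj₂ (≤-trans (s≤s big)
            (countB-mono-< j (reachIn-mono k G r) ¬rj (reachIn-step k G r i j ri gij)))
    ...   | no ¬esc = inj₁ (stay k cl)
      where
      cl : Closed G (reachIn k G r)
      cl i j ri gij with T? (reachIn k G r j)
      ... | yes rj = rj
      ... | no ¬rj = ⊥-elim (¬esc (i , j , ri , gij , ¬rj))
  ... | inj₁ cl = cl
  ... | inj₂ big = ⊥-elim (<-irrefl refl (≤-trans big (countB≤n (conn G r))))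

  Symm : Adj n → Set
  Symm G = ∀ i j → T (G i j) → T (G j i)

  complement-closed : {G : Adj n} {A : Fin n → Bool} → Symm G → Closed G A → Closed G (not ∘ A)
  complement-closed sy cl i j ¬ai gij = T-not⁺ (λ aj → T-not⁻ ¬ai (cl j i aj (sy i j gij)))

  -- If j did not reach i, the complement of what j reaches would be a closed set containing i,
  -- hence also j.
  conn-sym : (G : Adj n) → Symm G → ∀ {i j} → T (conn G i j) → T (conn G j i)
  conn-sym G sy {i} {j} cij with T? (conn G j i)
  ... | yes t = t
  ... | no ¬t = ⊥-elim (T-not⁻
    (conn-least (complement-closed sy (conn-closed G j)) (T-not⁺ ¬t) cij) (conn-refl G j))

  conn-trans : (G : Adj n) → ∀ {i j k} → T (conn G i j) → T (conn G j k) → T (conn G i k)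
  conn-trans G {i} cij = conn-least (conn-closed G i) cij

  conn-same : (G : Adj n) → Symm G → ∀ {i j} → T (conn G i j) → ∀ k → conn G i k ≡ conn G j k
  conn-same G sy cij k = T-ext (conn-trans G (conn-sym G sy cij)) (conn-trans G cij)

-- Enumerations of vectors, subsets and graphs

vecs : {A : Set} (k : ℕ) → Enum A → Enum (Vec A k)
vecs zero E = record { elems = [] ∷ [] ; complete = λ { [] → here refl } ; unique = [] ∷ [] }
vecs (suc k) E = record
  { elems = cartesianProductWith _∷_ (elems E) (elems (vecs k E))
  ; complete = λ { (x ∷ v) → ∈-cartesianProductWith⁺ _∷_ (complete E x) (complete (vecs k E) v) }
  ; unique = cartesianProductWith⁺ _∷_ ∷-injective (unique E) (unique (vecs k E))
  }

bools : Enum Bool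
bools = record
  { elems = true ∷ false ∷ []
  ; complete = λ { true → here refl ; false → there (here refl) }
  ; unique = ((λ ()) ∷ []) ∷ ([] ∷ [])
  }

Subset : ℕ → Set
Subset n = Vec Bool n

subsets : {n : ℕ} → Enum (Subset n)
subsets {n} = vecs n bools

-- Graphs as data rather than functions, so that equality is decidable without extensionality.
Graph : ℕ → Set
Graph n = Vec (Vec Bool n) n

graphs : {n : ℕ} → Enum (Graph n)
graphs {n} = vecs n subsets

_≟ᴳ_ : {n : ℕ} → DecidableEquality (Graph n)
_≟ᴳ_ = ≡-dec (≡-dec Boolₚ._≟_)

adj : {n : ℕ} → Graph n → Adj n
adj G i j = lookup (lookup G i) j

-- Both lists branch on the first value and then recurse, so they correspond entry by entry. This
-- carries counts over `graphsOf` to sums over `graphs` without function extensionality.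
allFuns-vecs : {A B : Set} {R : A → B → Set} (E : Enum B) {xs : List A} (k : ℕ) →
  Pointwise R xs (elems E) →
  Pointwise (λ F v → ∀ i → R (F i) (lookup v i)) (allFuns k xs) (elems (vecs k E))
allFuns-vecs E zero rs = (λ ()) ∷ []
allFuns-vecs {A} {B} {R} E {xs} (suc k) rs =
  go rs (λ r → map⁺ _ _ (pointwise-map (λ rF → λ { zero → r ; (suc i) → rF i }) (allFuns-vecs E k rs)))
  where
  pointwise-map : {C D : Set} {S S' : C → D → Set} {cs : List C} {ds : List D} →
    (∀ {c d} → S c d → S' c d) → Pointwise S cs ds → Pointwise S' cs ds
  pointwise-map h [] = []
  pointwise-map h (s ∷ ss) = h s ∷ pointwise-map h ss
  go : {g : A → List (Fin (suc k) → A)} {as : List A} {bs : List B} → Pointwise R as bs →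
    (∀ {a b} → R a b → Pointwise (λ F v → ∀ i → R (F i) (lookup v i)) (g a) (map (b ∷_) (elems (vecs k E)))) →
    Pointwise (λ F v → ∀ i → R (F i) (lookup v i)) (concatMap g as)
      (cartesianProductWith _∷_ bs (elems (vecs k E)))
  go [] h = []
  go (r ∷ rs) h = ++⁺ (h r) (go rs h)

infix 4 _≈ᴬ_
_≈ᴬ_ : {n : ℕ} → Adj n → Adj n → Set
G ≈ᴬ H = ∀ i j → G i j ≡ H i j

adjs-graphs : (n : ℕ) →
  Pointwise (λ G v → G ≈ᴬ adj v) (allFuns n (allFuns n (true ∷ false ∷ []))) (elems (graphs {n}))
adjs-graphs n = allFuns-vecs subsets n (allFuns-vecs {R = _≡_} bools n (refl ∷ refl ∷ []))

∑ᴸ-Pointwise-≤ : {A B : Set} {R : A → B → Set} {xs : List A} {ys : List B} → Pointwise R xs ys →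
  {f : A → ℕ} {g : B → ℕ} → (∀ x y → R x y → f x ≤ g y) → ∑ᴸ xs f ≤ ∑ᴸ ys g
∑ᴸ-Pointwise-≤ [] h = z≤n
∑ᴸ-Pointwise-≤ (_∷_ {x = x} {y = y} r rs) h = +-mono-≤ (h x y r) (∑ᴸ-Pointwise-≤ rs h)

∑ᴸ-Pointwise-≥ : {A B : Set} {R : A → B → Set} {xs : List A} {ys : List B} → Pointwise R xs ys →
  {f : A → ℕ} {g : B → ℕ} → (∀ x y → R x y → g y ≤ f x) → ∑ᴸ ys g ≤ ∑ᴸ xs f
∑ᴸ-Pointwise-≥ [] h = z≤n
∑ᴸ-Pointwise-≥ (_∷_ {x = x} {y = y} r rs) h = +-mono-≤ (h x y r) (∑ᴸ-Pointwise-≥ rs h)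

length-filterᵇ : {A : Set} (p : A → Bool) (xs : List A) →
  length (filterᵇ p xs) ≡ ∑ᴸ xs (λ x → ι (T? (p x)))
length-filterᵇ p [] = refl
length-filterᵇ p (x ∷ xs) with p x
... | true = cong suc (length-filterᵇ p xs)
... | false = length-filterᵇ p xs

-- Realisations and 2-switches

record IsReal {n : ℕ} (D : Fin n → ℕ) (G : Adj n) : Set where
  field
    symm   : Symm G
    irrefl : ∀ i → ¬ T (G i i)
    degree : ∀ i → deg G i ≡ D i
open IsReal

module _ {n : ℕ} {D : Fin n → ℕ} where

  realises⁻ : {G : Adj n} → T (realises D G) → IsReal D G
  realises⁻ {G} t = record
    { symm = λ i j gij → subst T (same i j) gij
    ; irrefl = λ i → T-not⁻ (proj₂ (T-∧⁻ (allB⁻ {n} simple i)))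
    ; degree = λ i → ≡ᵇ⇒≡ (deg G i) (D i) (allB⁻ {n} (proj₂ (T-∧⁻ {isSimple G} t)) i)
    }
    where
    simple = proj₁ (T-∧⁻ {isSimple G} t)
    same : ∀ i j → G i j ≡ G j i
    same i j = toWitness (allB⁻ {n} (proj₁ (T-∧⁻ (allB⁻ {n} simple i))) j)

  realises⁺ : {G : Adj n} → IsReal D G → T (realises D G)
  realises⁺ {G} re = T-∧⁺ {isSimple G}
    (allB⁺ {n} (λ i → T-∧⁺ (allB⁺ {n} (λ j → fromWitness (T-ext (symm re i j) (symm re j i))))
      (T-not⁺ (irrefl re i))))
    (allB⁺ {n} (λ i → ≡⇒≡ᵇ (deg G i) (D i) (degree re i)))

  isReal? : (G : Adj n) → Dec (IsReal D G)
  isReal? G = map′ realises⁻ realises⁺ (T? (realises D G))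

  IsReal-≈ : {G H : Adj n} → G ≈ᴬ H → IsReal D G → IsReal D H
  IsReal-≈ e re = record
    { symm = λ i j h → subst T (e j i) (symm re i j (subst T (sym (e i j)) h))
    ; irrefl = λ i h → irrefl re i (subst T (sym (e i i)) h)
    ; degree = λ i → trans (countB-cong (λ j → sym (e i j))) (degree re i)
    }

-- Both orientations of the edges ab and cd. For a switch, `Among x y u v` lists the removed pairs
-- and `Among x u y v` the added ones.
data Among {n : ℕ} (a b c d : Fin n) : Fin n → Fin n → Set where
  ab : Among a b c d a b
  ba : Among a b c d b a
  cd : Among a b c d c d
  dc : Among a b c d d c

module _ {n : ℕ} where

  _∈₂_,_ : Fin n → Fin n → Fin n → Bool
  i ∈₂ p , q = eqF i p ∨ eqF i q

  ∈₂⁻ : ∀ {i p q} → T (i ∈₂ p , q) → i ≡ p ⊎ i ≡ q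
  ∈₂⁻ {i} {p} t with T-∨⁻ {eqF i p} t
  ... | inj₁ e = inj₁ (eqF⁻ e)
  ... | inj₂ e = inj₂ (eqF⁻ e)

  ∈₂ˡ : ∀ {i q} → T (i ∈₂ i , q)
  ∈₂ˡ {i} = T-∨ˡ (eqF-refl i)

  ∈₂ʳ : ∀ {i p} → T (i ∈₂ p , i)
  ∈₂ʳ {i} {p} = T-∨ʳ {eqF i p} (eqF-refl i)

  -- The 4-cycle x y v u, whose toggling exchanges the edges xy, uv for xu, yv.
  fourCycle : (x y u v : Fin n) → Adj n
  fourCycle x y u v i j = ((i ∈₂ x , v) ∧ (j ∈₂ y , u)) ∨ ((i ∈₂ y , u) ∧ (j ∈₂ x , v))

  fourCycle⁻ : ∀ {x y u v i j} → T (fourCycle x y u v i j) →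
    Among x y u v i j ⊎ Among x u y v i j
  fourCycle⁻ {x} {y} {u} {v} {i} {j} t with T-∨⁻ {(i ∈₂ x , v) ∧ (j ∈₂ y , u)} t
  ... | inj₁ s with ∈₂⁻ {i} {x} {v} (proj₁ (T-∧⁻ s)) | ∈₂⁻ {j} {y} {u} (proj₂ (T-∧⁻ {i ∈₂ x , v} s))
  ...   | inj₁ refl | inj₁ refl = inj₁ ab
  ...   | inj₁ refl | inj₂ refl = inj₂ ab
  ...   | inj₂ refl | inj₁ refl = inj₂ dc
  ...   | inj₂ refl | inj₂ refl = inj₁ dc
  fourCycle⁻ {x} {y} {u} {v} {i} {j} t | inj₂ s
    with ∈₂⁻ {i} {y} {u} (proj₁ (T-∧⁻ s)) | ∈₂⁻ {j} {x} {v} (proj₂ (T-∧⁻ {i ∈₂ y , u} s))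
  ...   | inj₁ refl | inj₁ refl = inj₁ ba
  ...   | inj₁ refl | inj₂ refl = inj₂ cd
  ...   | inj₂ refl | inj₁ refl = inj₂ ba
  ...   | inj₂ refl | inj₂ refl = inj₁ cd

  fourCycle-old : ∀ {x y u v i j} → Among x y u v i j → T (fourCycle x y u v i j)
  fourCycle-old {x} {y} {u} {v} ab = T-∨ˡ (T-∧⁺ (∈₂ˡ {x} {v}) (∈₂ˡ {y} {u}))
  fourCycle-old {x} {y} {u} {v} ba =
    T-∨ʳ {(y ∈₂ x , v) ∧ (x ∈₂ y , u)} (T-∧⁺ (∈₂ˡ {y} {u}) (∈₂ˡ {x} {v}))
  fourCycle-old {x} {y} {u} {v} cd =
    T-∨ʳ {(u ∈₂ x , v) ∧ (v ∈₂ y , u)} (T-∧⁺ (∈₂ʳ {u} {y}) (∈₂ʳ {v} {x}))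
  fourCycle-old {x} {y} {u} {v} dc = T-∨ˡ (T-∧⁺ (∈₂ʳ {v} {x}) (∈₂ʳ {u} {y}))

  fourCycle-new : ∀ {x y u v i j} → Among x u y v i j → T (fourCycle x y u v i j)
  fourCycle-new {x} {y} {u} {v} ab = T-∨ˡ (T-∧⁺ (∈₂ˡ {x} {v}) (∈₂ʳ {u} {y}))
  fourCycle-new {x} {y} {u} {v} ba =
    T-∨ʳ {(u ∈₂ x , v) ∧ (x ∈₂ y , u)} (T-∧⁺ (∈₂ʳ {u} {y}) (∈₂ˡ {x} {v}))
  fourCycle-new {x} {y} {u} {v} cd =
    T-∨ʳ {(y ∈₂ x , v) ∧ (v ∈₂ y , u)} (T-∧⁺ (∈₂ˡ {y} {u}) (∈₂ʳ {v} {x}))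
  fourCycle-new {x} {y} {u} {v} dc = T-∨ˡ (T-∧⁺ (∈₂ʳ {v} {x}) (∈₂ˡ {y} {u}))

  Quad : Set
  Quad = Fin n × Fin n × Fin n × Fin n

  quads : Enum Quad
  quads = fin ⊗ fin ⊗ fin ⊗ fin

  -- Defined by xor on every graph, realisation or not, so that it is its own inverse and a switch
  -- is undone by the same quadruple.
  toggle : Quad → Graph n → Graph n
  toggle (x , y , u , v) G = tabulate λ i → tabulate λ j → adj G i j xor fourCycle x y u v i j

  adj-toggle : ∀ x y u v G i j →
    adj (toggle (x , y , u , v) G) i j ≡ adj G i j xor fourCycle x y u v i j
  adj-toggle x y u v G i j = trans
    (cong (λ row → lookup row j) (lookup∘tabulate (λ i → tabulate λ j → adj G i j xor fourCycle x y u v i j) i))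
    (lookup∘tabulate (λ j → adj G i j xor fourCycle x y u v i j) j)

  toggle-involutive : ∀ σ G → toggle σ (toggle σ G) ≡ G
  toggle-involutive (x , y , u , v) G = trans
    (tabulate-cong λ i → trans (tabulate-cong λ j →
        trans (cong (_xor fourCycle x y u v i j) (adj-toggle x y u v G i j))
          (xor-twice (adj G i j) (fourCycle x y u v i j)))
      (tabulate∘lookup (lookup G i)))
    (tabulate∘lookup G)
    where
    xor-twice : ∀ a b → (a xor b) xor b ≡ a
    xor-twice true true = refl
    xor-twice true false = refl
    xor-twice false true = refl
    xor-twice false false = refl

  -- In a realisation this makes the four vertices distinct: x = v or y = u would turn a required
  -- edge into a required non-edge.
  Switchable : Adj n → Quad → Set
  Switchable G (x , y , u , v) =
    T (G x y) × T (G u v) × ¬ T (G x u) × ¬ T (G y v) × x ≢ u × y ≢ v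

  switchable? : (G : Adj n) (σ : Quad) → Dec (Switchable G σ)
  switchable? G (x , y , u , v) = T? (G x y) ×-dec T? (G u v) ×-dec ¬? (T? (G x u)) ×-dec
    ¬? (T? (G y v)) ×-dec ¬? (x ≟ u) ×-dec ¬? (y ≟ v)

  -- After the indicator of p is added on one side and that of q on the other, the two sums agree
  -- term by term.
  countB-swap : (f g : Fin n → Bool) (p q : Fin n) → T (f p) → ¬ T (f q) →
    (∀ j → T (g j) → j ≡ p ⊎ j ≡ q) → T (g p) → T (g q) →
    countB (λ j → f j xor g j) ≡ countB f
  countB-swap f g p q fp ¬fq g⁻ gp gq = +-cancelʳ-≡ 1 (countB f⊕g) (countB f) (begin
    countB f⊕g + 1                                   ≡⟨ cong (countB f⊕g +_) (one p) ⟨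
    countB f⊕g + ∑ fin (ι ∘ (p ≟_))                  ≡⟨ ∑-+ fin (λ j → ι (T? (f⊕g j))) (ι ∘ (p ≟_)) ⟨
    ∑ fin (λ j → ι (T? (f⊕g j)) + ι (p ≟ j))         ≡⟨ ∑-cong fin pointwise ⟩
    ∑ fin (λ j → ι (T? (f j)) + ι (q ≟ j))           ≡⟨ ∑-+ fin (λ j → ι (T? (f j))) (ι ∘ (q ≟_)) ⟩
    countB f + ∑ fin (ι ∘ (q ≟_))                    ≡⟨ cong (countB f +_) (one q) ⟩
    countB f + 1                                     ∎)
    where
    open ≡-Reasoning
    f⊕g : Fin n → Bool
    f⊕g j = f j xor g j
    one : ∀ p → ∑ fin (ι ∘ (p ≟_)) ≡ 1
    one p = ≤-antisym (∑-unique fin (p ≟_) (λ x y ex ey → trans (sym ex) ey)) (∑-ι-∃ fin (p ≟_) p refl)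
    pointwise : ∀ j → ι (T? (f⊕g j)) + ι (p ≟ j) ≡ ι (T? (f j)) + ι (q ≟ j)
    pointwise j with p ≟ j | q ≟ j
    ... | yes refl | yes refl = ⊥-elim (¬fq fp)
    ... | yes refl | no _ rewrite T-true fp | T-true gp = refl
    ... | no _ | yes refl rewrite T-false ¬fq | T-true gq = refl
    ... | no p≢ | no q≢ rewrite T-false {g j} (λ t → [ (λ e → p≢ (sym e)) , (λ e → q≢ (sym e)) ]′ (g⁻ j t)) =
      cong (λ b → (if b then 1 else 0) + 0) (Boolₚ.xor-identityʳ (f j))

-- The interface through which arguments about components see a switch, free of xor.
record Switch {n : ℕ} (G G' : Adj n) (x y u v : Fin n) : Set where
  field
    able : Switchable G (x , y , u , v)
    keep : ∀ {i j} → T (G i j) → T (G' i j) ⊎ Among x y u v i j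
    from : ∀ {i j} → T (G' i j) → T (G i j) ⊎ Among x u y v i j
    new  : ∀ {i j} → Among x u y v i j → T (G' i j)
    gone : ∀ {i j} → Among x y u v i j → ¬ T (G' i j)
open Switch

module _ {n : ℕ} {D : Fin n → ℕ} where

  toggle-Switch : ∀ {x y u v} (G : Graph n) → IsReal D (adj G) → Switchable (adj G) (x , y , u , v) →
    Switch (adj G) (adj (toggle (x , y , u , v) G)) x y u v
  toggle-Switch {x} {y} {u} {v} G re able@(gxy , guv , ¬gxu , ¬gyv , _) = record
    { able = able
    ; keep = λ {i} {j} g → keep' i j g
    ; from = λ {i} {j} g → from' i j g
    ; new = λ {i} {j} am → subst T (sym (at i j))
        (xor-on (¬-new am) (fourCycle-new am))
    ; gone = λ {i} {j} am t → xor-off (old am) (fourCycle-old am) (subst T (at i j) t)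
    }
    where
    at = adj-toggle x y u v G
    xor-on : ∀ {a b} → ¬ T a → T b → T (a xor b)
    xor-on {true} ¬a _ = ⊥-elim (¬a tt)
    xor-on {false} _ b = b
    xor-off : ∀ {a b} → T a → T b → ¬ T (a xor b)
    xor-off {true} {true} _ _ ()
    old : ∀ {i j} → Among x y u v i j → T (adj G i j)
    old ab = gxy
    old ba = symm re _ _ gxy
    old cd = guv
    old dc = symm re _ _ guv
    ¬-new : ∀ {i j} → Among x u y v i j → ¬ T (adj G i j)
    ¬-new ab = ¬gxu
    ¬-new ba g = ¬gxu (symm re _ _ g)
    ¬-new cd = ¬gyv
    ¬-new dc g = ¬gyv (symm re _ _ g)
    keep' : ∀ i j → T (adj G i j) → T (adj (toggle (x , y , u , v) G) i j) ⊎ Among x y u v i j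
    keep' i j g with T? (fourCycle x y u v i j)
    ... | no ¬e rewrite at i j | T-true g | T-false ¬e = inj₁ tt
    ... | yes e with fourCycle⁻ e
    ...   | inj₁ am = inj₂ am
    ...   | inj₂ am = ⊥-elim (¬-new am g)
    from' : ∀ i j → T (adj (toggle (x , y , u , v) G) i j) → T (adj G i j) ⊎ Among x u y v i j
    from' i j t with T? (adj G i j)
    ... | yes g = inj₁ g
    ... | no ¬g with fourCycle⁻ {_} {x} {y} {u} {v} {i} {j} (xor-off' ¬g (subst T (at i j) t))
      where
      xor-off' : ∀ {a b} → ¬ T a → T (a xor b) → T b
      xor-off' {true} ¬a _ = ⊥-elim (¬a tt)
      xor-off' {false} _ t = t
    ...   | inj₁ am = ⊥-elim (¬g (old am))
    ...   | inj₂ am = inj₂ am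

  toggle-IsReal : ∀ {x y u v} (G : Graph n) → IsReal D (adj G) → Switchable (adj G) (x , y , u , v) →
    IsReal D (adj (toggle (x , y , u , v) G))
  toggle-IsReal {x} {y} {u} {v} G re (gxy , guv , ¬gxu , ¬gyv , x≢u , y≢v) = record
    { symm = λ i j t → subst T (trans (sym (flip i j)) (sym (at j i))) (subst T (at i j) t)
    ; irrefl = λ i t → no-loop i (subst T (at i i) t)
    ; degree = λ i → trans (trans (countB-cong (at i)) (same-degree i)) (degree re i)
    }
    where
    at = adj-toggle x y u v G
    g = adj G
    E = fourCycle x y u v
    x≢y : x ≢ y
    x≢y refl = irrefl re x gxy
    u≢v : u ≢ v
    u≢v refl = irrefl re u guv
    E-sym : ∀ i j → T (E i j) → T (E j i)
    E-sym i j e with fourCycle⁻ {_} {x} {y} {u} {v} {i} {j} e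
    ... | inj₁ ab = fourCycle-old {_} {x} {y} {u} {v} ba
    ... | inj₁ ba = fourCycle-old {_} {x} {y} {u} {v} ab
    ... | inj₁ cd = fourCycle-old {_} {x} {y} {u} {v} dc
    ... | inj₁ dc = fourCycle-old {_} {x} {y} {u} {v} cd
    ... | inj₂ ab = fourCycle-new {_} {x} {y} {u} {v} ba
    ... | inj₂ ba = fourCycle-new {_} {x} {y} {u} {v} ab
    ... | inj₂ cd = fourCycle-new {_} {x} {y} {u} {v} dc
    ... | inj₂ dc = fourCycle-new {_} {x} {y} {u} {v} cd
    flip : ∀ i j → g j i xor E j i ≡ g i j xor E i j
    flip i j = cong₂ _xor_ (T-ext (symm re j i) (symm re i j)) (T-ext (E-sym j i) (E-sym i j))
    no-loop : ∀ i → ¬ T (g i i xor E i i)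
    no-loop i rewrite T-false (irrefl re i) = λ e → loopless (fourCycle⁻ {_} {x} {y} {u} {v} {i} {i} e)
      where
      loopless : Among x y u v i i ⊎ Among x u y v i i → ⊥
      loopless (inj₁ ab) = x≢y refl
      loopless (inj₁ ba) = x≢y refl
      loopless (inj₁ cd) = u≢v refl
      loopless (inj₁ dc) = u≢v refl
      loopless (inj₂ ab) = x≢u refl
      loopless (inj₂ ba) = x≢u refl
      loopless (inj₂ cd) = y≢v refl
      loopless (inj₂ dc) = y≢v refl
    old⁺ : ∀ {i j} → Among x y u v i j → T (E i j)
    old⁺ = fourCycle-old
    new⁺ : ∀ {i j} → Among x u y v i j → T (E i j)
    new⁺ = fourCycle-new
    E⁻ : ∀ i j → T (E i j) → Among x y u v i j ⊎ Among x u y v i j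
    E⁻ i j = fourCycle⁻
    -- Each corner of the 4-cycle trades one neighbour for another; every other row is unchanged.
    same-degree : ∀ i → countB (λ j → g i j xor E i j) ≡ countB (g i)
    same-degree i = cases i (i ≟ x) (i ≟ y) (i ≟ u) (i ≟ v)
      where
      cases : ∀ i → Dec (i ≡ x) → Dec (i ≡ y) → Dec (i ≡ u) → Dec (i ≡ v) →
        countB (λ j → g i j xor E i j) ≡ countB (g i)
      cases i (yes refl) _ _ _ = countB-swap (g x) (E x) y u gxy ¬gxu
          (λ j e → row (E⁻ x j e)) (old⁺ ab) (new⁺ ab)
        where
        row : ∀ {j} → Among x y u v x j ⊎ Among x u y v x j → j ≡ y ⊎ j ≡ u
        row (inj₁ ab) = inj₁ refl
        row (inj₁ ba) = ⊥-elim (x≢y refl)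
        row (inj₁ cd) = ⊥-elim (x≢u refl)
        row (inj₁ dc) = inj₂ refl
        row (inj₂ ab) = inj₂ refl
        row (inj₂ ba) = ⊥-elim (x≢u refl)
        row (inj₂ cd) = ⊥-elim (x≢y refl)
        row (inj₂ dc) = inj₁ refl
      cases i (no i≢x) (yes refl) _ _ = countB-swap (g y) (E y) x v (symm re x y gxy) ¬gyv
          (λ j e → row (E⁻ y j e)) (old⁺ ba) (new⁺ cd)
        where
        row : ∀ {j} → Among x y u v y j ⊎ Among x u y v y j → j ≡ x ⊎ j ≡ v
        row (inj₁ ab) = ⊥-elim (i≢x refl)
        row (inj₁ ba) = inj₁ refl
        row (inj₁ cd) = inj₂ refl
        row (inj₁ dc) = ⊥-elim (y≢v refl)
        row (inj₂ ab) = ⊥-elim (i≢x refl)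
        row (inj₂ ba) = inj₁ refl
        row (inj₂ cd) = inj₂ refl
        row (inj₂ dc) = ⊥-elim (y≢v refl)
      cases i (no i≢x) (no i≢y) (yes refl) _ =
          countB-swap (g u) (E u) v x guv (λ t → ¬gxu (symm re u x t))
          (λ j e → row (E⁻ u j e)) (old⁺ cd) (new⁺ ba)
        where
        row : ∀ {j} → Among x y u v u j ⊎ Among x u y v u j → j ≡ v ⊎ j ≡ x
        row (inj₁ ab) = ⊥-elim (i≢x refl)
        row (inj₁ ba) = ⊥-elim (i≢y refl)
        row (inj₁ cd) = inj₁ refl
        row (inj₁ dc) = ⊥-elim (u≢v refl)
        row (inj₂ ab) = ⊥-elim (i≢x refl)
        row (inj₂ ba) = inj₂ refl
        row (inj₂ cd) = ⊥-elim (i≢y refl)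
        row (inj₂ dc) = ⊥-elim (u≢v refl)
      cases i (no i≢x) (no i≢y) (no i≢u) (yes refl) =
          countB-swap (g v) (E v) u y (symm re u v guv) (λ t → ¬gyv (symm re v y t))
          (λ j e → row (E⁻ v j e)) (old⁺ dc) (new⁺ dc)
        where
        row : ∀ {j} → Among x y u v v j ⊎ Among x u y v v j → j ≡ u ⊎ j ≡ y
        row (inj₁ ab) = ⊥-elim (i≢x refl)
        row (inj₁ ba) = ⊥-elim (i≢y refl)
        row (inj₁ cd) = ⊥-elim (i≢u refl)
        row (inj₁ dc) = inj₁ refl
        row (inj₂ ab) = ⊥-elim (i≢x refl)
        row (inj₂ ba) = ⊥-elim (i≢u refl)
        row (inj₂ cd) = ⊥-elim (i≢y refl)
        row (inj₂ dc) = inj₂ refl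
      cases i (no i≢x) (no i≢y) (no i≢u) (no i≢v) = countB-cong λ j →
          trans (cong (g i j xor_) (T-false (λ e → off (E⁻ i j e)))) (Boolₚ.xor-identityʳ (g i j))
        where
        off : ∀ {j} → Among x y u v i j ⊎ Among x u y v i j → ⊥
        off (inj₁ ab) = i≢x refl
        off (inj₁ ba) = i≢y refl
        off (inj₁ cd) = i≢u refl
        off (inj₁ dc) = i≢v refl
        off (inj₂ ab) = i≢x refl
        off (inj₂ ba) = i≢u refl
        off (inj₂ cd) = i≢y refl
        off (inj₂ dc) = i≢v refl

wt : {n : ℕ} → (Fin n → ℕ) → Fin n → ℕ
wt D v = if D v ≡ᵇ 2 then 0 else D v

W : {n : ℕ} → (Fin n → ℕ) → (Fin n → Bool) → ℕ
W D K = ∑ fin (λ i → if K i then wt D i else 0)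

wt-≢2 : ∀ {n} {D : Fin n → ℕ} {v} → D v ≢ 2 → wt D v ≡ D v
wt-≢2 {D = D} {v} ne rewrite T-false {D v ≡ᵇ 2} (λ t → ne (≡ᵇ⇒≡ (D v) 2 t)) = refl

∑fin-single : ∀ {n} (v : Fin n) (c : ℕ) → ∑ fin (λ j → ι (j ≟ v) * c) ≡ c
∑fin-single v c = trans (∑-*ʳ fin c (λ j → ι (j ≟ v))) (trans (cong (_* c) once) (*-identityˡ c))
  where
  once : ∑ fin (λ j → ι (j ≟ v)) ≡ 1
  once = ≤-antisym (∑-unique fin (_≟ v) (λ x y ex ey → trans ex (sym ey))) (∑-ι-∃ fin (_≟ v) v refl)

-- Suppression of degree-2 vertices

module _ {n : ℕ} where

  eqF≡ : (i j : Fin n) → eqF i j ≡ does (i ≟ j)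
  eqF≡ i j = isYes≗does (i ≟ j)

  link? : (a b i j : Fin n) → Dec ((i ≡ a × j ≡ b) ⊎ (i ≡ b × j ≡ a))
  link? a b i j = ((i ≟ a) ×-dec (j ≟ b)) ⊎-dec ((i ≟ b) ×-dec (j ≟ a))

  -- The row sum counts a loop at v once, and the extra summand supplies its second end.
  mdeg-∑ : (H : MG n) (v : Fin n) → mdeg H v ≡ ∑ fin (mult H v) + mult H v v
  mdeg-∑ H v = begin
    ∑ fin off + (mult H v v + (mult H v v + 0))       ≡⟨ cong (λ z → ∑ fin off + (mult H v v + z)) (+-identityʳ _) ⟩
    ∑ fin off + (mult H v v + mult H v v)             ≡⟨ +-assoc (∑ fin off) _ _ ⟨
    ∑ fin off + mult H v v + mult H v v               ≡⟨ cong (λ z → ∑ fin off + z + mult H v v) (∑fin-single v (mult H v v)) ⟨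
    ∑ fin off + ∑ fin (λ j → ι (j ≟ v) * mult H v v) + mult H v v
      ≡⟨ cong (_+ mult H v v) (∑-+ fin off (λ j → ι (j ≟ v) * mult H v v)) ⟨
    ∑ fin (λ j → off j + ι (j ≟ v) * mult H v v) + mult H v v
      ≡⟨ cong (_+ mult H v v) (∑-cong fin pointwise) ⟩
    ∑ fin (mult H v) + mult H v v                     ∎
    where
    open ≡-Reasoning
    off : Fin n → ℕ
    off j = if eqF v j then 0 else mult H v j
    pointwise : ∀ j → off j + ι (j ≟ v) * mult H v v ≡ mult H v j
    pointwise j with v ≟ j | j ≟ v
    ... | yes refl | yes _ = +-identityʳ _
    ... | yes refl | no ne = ⊥-elim (ne refl)
    ... | no ne | yes refl = ⊥-elim (ne refl)
    ... | no _ | no _ = +-identityʳ _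

  ∑-nbrs : (H : MG n) (v : Fin n) → mult H v v ≡ 0 → (f : Fin n → ℕ) →
    ∑ᴸ (nbrs H v) f ≡ ∑ fin (λ j → mult H v j * f j)
  ∑-nbrs H v loopless f = trans (∑ᴸ-concatMap _ (allFin n) f) (∑-cong fin pointwise)
    where
    ∑-replicate : ∀ k j → ∑ᴸ (replicate k j) f ≡ k * f j
    ∑-replicate zero j = refl
    ∑-replicate (suc k) j = cong (f j +_) (∑-replicate k j)
    pointwise : ∀ j → ∑ᴸ (if eqF v j then [] else replicate (mult H v j) j) f ≡ mult H v j * f j
    pointwise j with v ≟ j
    ... | yes refl rewrite loopless = refl
    ... | no _ = ∑-replicate (mult H v j) j

  module Replace (H : MG n) (v a b : Fin n) where

    H' : MG n
    H' = replaceBy H v a b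

    alive⁻ : ∀ {i} → T (alive H' i) → T (alive H i) × i ≢ v
    alive⁻ {i} t with T-∧⁻ {alive H i} t
    ... | al , ne = al , λ { refl → T-not⁻ ne (eqF-refl v) }

    alive⁺ : ∀ {i} → T (alive H i) → i ≢ v → T (alive H' i)
    alive⁺ al ne = T-∧⁺ al (T-not⁺ (λ t → ne (eqF⁻ t)))

    mult-removedˡ : ∀ j → mult H' v j ≡ 0
    mult-removedˡ j rewrite T-true (eqF-refl v) = refl

    mult-removedʳ : ∀ i → mult H' i v ≡ 0
    mult-removedʳ i rewrite T-true (eqF-refl v) | Boolₚ.∨-zeroʳ (eqF i v) = refl

    mult-kept : ∀ {i j} → i ≢ v → j ≢ v → mult H' i j ≡ mult H i j + ι (link? a b i j)
    mult-kept {i} {j} i≢ j≢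
      rewrite T-false {eqF i v} (λ t → i≢ (eqF⁻ t)) | T-false {eqF j v} (λ t → j≢ (eqF⁻ t))
            | eqF≡ i a | eqF≡ j b | eqF≡ i b | eqF≡ j a = refl

  module _ (D : Fin n → ℕ) (G : Adj n) (re : IsReal D G) where

    -- The invariant of suppression. `degree'` counts a loop twice; `within` keeps edges inside the
    -- components of G; `branch` forbids a part consisting only of degree-2 vertices, which could
    -- shrink to a single vertex with a loop and then block suppression.
    record Reduct (H : MG n) : Set where
      field
        mult-sym : ∀ i j → mult H i j ≡ mult H j i
        degree'  : ∀ {i} → T (alive H i) → ∑ fin (mult H i) + mult H i i ≡ D i
        dead     : ∀ {i} j → ¬ T (alive H i) → mult H i j ≡ 0
        within   : ∀ {i j} → mult H i j ≢ 0 → T (conn G i j)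
        branch   : ∀ (A : Fin n → Bool) {v} → Closed (mAdj H) A → T (A v) → T (alive H v) →
                   ∃[ w ] (T (A w) × D w ≢ 2)

      mAdj⁺ : ∀ {i j} → mult H i j ≢ 0 → T (mAdj H i j)
      mAdj⁺ {i} {j} ne = T-∧⁺ (live i j ne) (T-∧⁺ (live j i (λ e → ne (trans (mult-sym i j) e)))
        (T-not⁺ (λ t → ne (≡ᵇ⇒≡ (mult H i j) 0 t))))
        where
        live : ∀ i j → mult H i j ≢ 0 → T (alive H i)
        live i j ne with T? (alive H i)
        ... | yes t = t
        ... | no ¬t = ⊥-elim (ne (dead j ¬t))

      mAdj⁻ : ∀ {i j} → T (mAdj H i j) → mult H i j ≢ 0
      mAdj⁻ {i} {j} t e = T-not⁻ (proj₂ (T-∧⁻ {alive H j} (proj₂ (T-∧⁻ {alive H i} t))))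
        (≡⇒≡ᵇ (mult H i j) 0 e)

    module _ {H : MG n} (I : Reduct H) {v a b : Fin n} (v-alive : T (alive H v)) (Dv : D v ≡ 2)
      (loopless : mult H v v ≡ 0) (ends : ∀ i → mult H v i ≡ ι (i ≟ a) + ι (i ≟ b)) where
      open Reduct I
      open Replace H v a b

      private
        a-end : mult H v a ≢ 0
        a-end e = 1+n≢0 (trans (sym (trans (ends a) (cong (_+ ι (a ≟ b)) (ι-yes (a ≟ a) refl)))) e)
        b-end : mult H v b ≢ 0
        b-end e = 1+n≢0 (trans (sym (trans (ends b)
          (trans (+-comm (ι (b ≟ a)) _) (cong (_+ ι (b ≟ a)) (ι-yes (b ≟ b) refl))))) e)
        a≢v : a ≢ v
        a≢v refl = a-end loopless
        b≢v : b ≢ v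
        b≢v refl = b-end loopless
        end⁻ : ∀ {i} → mult H v i ≢ 0 → i ≡ a ⊎ i ≡ b
        end⁻ {i} ne with i ≟ a | i ≟ b | ends i
        ... | yes e | _ | _ = inj₁ e
        ... | no _ | yes e | _ = inj₂ e
        ... | no _ | no _ | e = ⊥-elim (ne e)
        a-alive : T (alive H a)
        a-alive = proj₁ (T-∧⁻ {alive H a} (proj₂ (T-∧⁻ {alive H v} (mAdj⁺ a-end))))
        b-alive : T (alive H b)
        b-alive = proj₁ (T-∧⁻ {alive H b} (proj₂ (T-∧⁻ {alive H v} (mAdj⁺ b-end))))
        ¬link-v : ∀ {i} → ι (link? a b i v) ≡ 0
        ¬link-v {i} = ι-no (link? a b i v) λ { (inj₁ (_ , e)) → b≢v (sym e) ; (inj₂ (_ , e)) → a≢v (sym e) }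

        -- A new loop counts twice at its vertex.
        link-ends : ∀ i → ∑ fin (λ j → ι (link? a b i j)) + ι (link? a b i i) ≡ ι (i ≟ a) + ι (i ≟ b)
        link-ends i = begin
          ∑ fin (λ j → ι (link? a b i j)) + ι (link? a b i i)
            ≡⟨ cong (∑ fin (λ j → ι (link? a b i j)) +_) (∑fin-single i (ι (link? a b i i))) ⟨
          ∑ fin (λ j → ι (link? a b i j)) + ∑ fin (λ j → ι (j ≟ i) * ι (link? a b i i))
            ≡⟨ ∑-+ fin (λ j → ι (link? a b i j)) (λ j → ι (j ≟ i) * ι (link? a b i i)) ⟨
          ∑ fin (λ j → ι (link? a b i j) + ι (j ≟ i) * ι (link? a b i i))
            ≡⟨ ∑-cong fin pointwise ⟩
          ∑ fin (λ j → ι (j ≟ b) * ι (i ≟ a) + ι (j ≟ a) * ι (i ≟ b))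
            ≡⟨ ∑-+ fin (λ j → ι (j ≟ b) * ι (i ≟ a)) (λ j → ι (j ≟ a) * ι (i ≟ b)) ⟩
          ∑ fin (λ j → ι (j ≟ b) * ι (i ≟ a)) + ∑ fin (λ j → ι (j ≟ a) * ι (i ≟ b))
            ≡⟨ cong₂ _+_ (∑fin-single b (ι (i ≟ a))) (∑fin-single a (ι (i ≟ b))) ⟩
          ι (i ≟ a) + ι (i ≟ b) ∎
          where
          open ≡-Reasoning
          pointwise : ∀ j → ι (link? a b i j) + ι (j ≟ i) * ι (link? a b i i) ≡
            ι (j ≟ b) * ι (i ≟ a) + ι (j ≟ a) * ι (i ≟ b)
          pointwise j with j ≟ i
          ... | yes refl with i ≟ a | i ≟ b
          ...   | yes _ | yes _ = refl
          ...   | yes _ | no _ = refl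
          ...   | no _ | yes _ = refl
          ...   | no _ | no _ = refl
          pointwise j | no j≢i with i ≟ a | i ≟ b | j ≟ a | j ≟ b
          ...   | yes refl | _ | yes refl | _ = ⊥-elim (j≢i refl)
          ...   | _ | yes refl | _ | yes refl = ⊥-elim (j≢i refl)
          ...   | yes _ | yes _ | no _ | no _ = refl
          ...   | yes _ | no _ | no _ | yes _ = refl
          ...   | yes _ | no _ | no _ | no _ = refl
          ...   | no _ | yes _ | yes _ | no _ = refl
          ...   | no _ | yes _ | no _ | no _ = refl
          ...   | no _ | no _ | yes _ | yes _ = refl
          ...   | no _ | no _ | yes _ | no _ = refl
          ...   | no _ | no _ | no _ | yes _ = refl
          ...   | no _ | no _ | no _ | no _ = refl

      replace-Reduct : Reduct H'
      replace-Reduct = record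
        { mult-sym = mult-sym'
        ; degree' = λ {i} al → degree'' i (proj₁ (alive⁻ al)) (proj₂ (alive⁻ al))
        ; dead = dead'
        ; within = λ {i} {j} → within' i j
        ; branch = branch'
        }
        where
        at-v : ∀ i → i ≡ v ⊎ i ≢ v
        at-v i with i ≟ v
        ... | yes e = inj₁ e
        ... | no ne = inj₂ ne

        link-swap : ∀ i j → ι (link? a b i j) ≡ ι (link? a b j i)
        link-swap i j = ι-cong (link? a b i j) (link? a b j i) swap swap
          where
          swap : ∀ {i j} → (i ≡ a × j ≡ b) ⊎ (i ≡ b × j ≡ a) → (j ≡ a × i ≡ b) ⊎ (j ≡ b × i ≡ a)
          swap (inj₁ (p , q)) = inj₂ (q , p)
          swap (inj₂ (p , q)) = inj₁ (q , p)

        mult-sym' : ∀ i j → mult H' i j ≡ mult H' j i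
        mult-sym' i j with at-v i | at-v j
        ... | inj₁ refl | _ = trans (mult-removedˡ j) (sym (mult-removedʳ j))
        ... | inj₂ _ | inj₁ refl = trans (mult-removedʳ i) (sym (mult-removedˡ i))
        ... | inj₂ i≢ | inj₂ j≢ = trans (mult-kept i≢ j≢)
              (trans (cong₂ _+_ (mult-sym i j) (link-swap i j)) (sym (mult-kept j≢ i≢)))

        degree'' : ∀ i → T (alive H i) → i ≢ v → ∑ fin (mult H' i) + mult H' i i ≡ D i
        -- The ends lost at v are added to both sides to avoid subtraction. By `link-ends` and
        -- `ends`, the new link returns to i exactly as many ends as it loses with v.
        degree'' i al i≢ = +-cancelʳ-≡ (mult H i v) _ _ (begin
          ∑ fin (mult H' i) + mult H' i i + mult H i v
            ≡⟨ shuffle (∑ fin (mult H' i)) (mult H' i i) (mult H i v) ⟩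
          ∑ fin (mult H' i) + mult H i v + mult H' i i
            ≡⟨ cong₂ _+_ summed (mult-kept i≢ i≢) ⟩
          ∑ fin (mult H i) + ∑ fin (λ j → ι (link? a b i j)) + (mult H i i + ι (link? a b i i))
            ≡⟨ interchange (∑ fin (mult H i)) _ _ _ ⟩
          ∑ fin (mult H i) + mult H i i + (∑ fin (λ j → ι (link? a b i j)) + ι (link? a b i i))
            ≡⟨ cong₂ _+_ (degree' al) (trans (link-ends i) (trans (sym (ends i)) (mult-sym v i))) ⟩
          D i + mult H i v ∎)
          where
          open ≡-Reasoning
          shuffle : ∀ x y z → x + y + z ≡ x + z + y
          shuffle = solve-∀
          interchange : ∀ x y z t → x + y + (z + t) ≡ x + z + (y + t)
          interchange = solve-∀
          pointwise : ∀ j → mult H' i j + ι (j ≟ v) * mult H i v ≡ mult H i j + ι (link? a b i j)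
          pointwise j with at-v j
          ... | inj₁ refl = trans (cong₂ _+_ (mult-removedʳ i)
                  (trans (cong (_* mult H i v) (ι-yes (v ≟ v) refl)) (*-identityˡ (mult H i v))))
                (sym (trans (cong (mult H i v +_) (¬link-v {i})) (+-identityʳ _)))
          ... | inj₂ j≢ = trans (cong (λ z → mult H' i j + z * mult H i v) (ι-no (j ≟ v) j≢)) (trans (+-identityʳ _) (mult-kept i≢ j≢))
          summed : ∑ fin (mult H' i) + mult H i v ≡ ∑ fin (mult H i) + ∑ fin (λ j → ι (link? a b i j))
          summed = begin
            ∑ fin (mult H' i) + mult H i v
              ≡⟨ cong (∑ fin (mult H' i) +_) (∑fin-single v (mult H i v)) ⟨
            ∑ fin (mult H' i) + ∑ fin (λ j → ι (j ≟ v) * mult H i v)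
              ≡⟨ ∑-+ fin (mult H' i) (λ j → ι (j ≟ v) * mult H i v) ⟨
            ∑ fin (λ j → mult H' i j + ι (j ≟ v) * mult H i v)
              ≡⟨ ∑-cong fin pointwise ⟩
            ∑ fin (λ j → mult H i j + ι (link? a b i j))
              ≡⟨ ∑-+ fin (mult H i) (λ j → ι (link? a b i j)) ⟩
            ∑ fin (mult H i) + ∑ fin (λ j → ι (link? a b i j)) ∎

        dead' : ∀ {i} j → ¬ T (alive H' i) → mult H' i j ≡ 0
        dead' {i} j ¬al with at-v i | at-v j
        ... | inj₁ refl | _ = mult-removedˡ j
        ... | inj₂ _ | inj₁ refl = mult-removedʳ i
        ... | inj₂ i≢ | inj₂ j≢ = trans (mult-kept i≢ j≢) (cong₂ _+_
              (dead j (λ al → ¬al (alive⁺ al i≢)))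
              (ι-no (link? a b i j) λ { (inj₁ (refl , _)) → ¬al (alive⁺ a-alive i≢)
                                      ; (inj₂ (refl , _)) → ¬al (alive⁺ b-alive i≢) }))

        within' : ∀ i j → mult H' i j ≢ 0 → T (conn G i j)
        within' i j ne with at-v i | at-v j
        ... | inj₁ refl | _ = ⊥-elim (ne (mult-removedˡ j))
        ... | inj₂ _ | inj₁ refl = ⊥-elim (ne (mult-removedʳ i))
        ... | inj₂ i≢ | inj₂ j≢ with link? a b i j | mult H i j ℕ.≟ 0
        ...   | yes (inj₁ (refl , refl)) | _ = conn-trans G (conn-sym G (symm re) (within a-end)) (within b-end)
        ...   | yes (inj₂ (refl , refl)) | _ = conn-trans G (conn-sym G (symm re) (within b-end)) (within a-end)
        ...   | no _ | no eq = within eq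
        ...   | no ¬l | yes eq = ⊥-elim (ne (trans (mult-kept {i} {j} i≢ j≢) (cong₂ _+_ eq (ι-no (link? a b i j) ¬l))))

        branch' : ∀ (A : Fin n → Bool) {w₀} → Closed (mAdj H') A → T (A w₀) → T (alive H' w₀) →
          ∃[ w ] (T (A w) × D w ≢ 2)
        branch' A {w₀} cl aw al
          with branch A⁺ cl⁺ (A⁺-other aw (proj₂ (alive⁻ {w₀} al))) (proj₁ (alive⁻ {w₀} al))
          where
          -- A set closed after the suppression becomes closed before it once v is put on the side
          -- of a. The new link keeps a and b on the same side. The vertex found cannot be v, which
          -- has degree 2.
          A⁺ : Fin n → Bool
          A⁺ i = (A i ∧ not (eqF i v)) ∨ (eqF i v ∧ A a)
          A⁺-other : ∀ {i} → T (A i) → i ≢ v → T (A⁺ i)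
          A⁺-other t ne = T-∨ˡ (T-∧⁺ t (T-not⁺ (λ e → ne (eqF⁻ e))))
          A⁺⁻ : ∀ {i} → T (A⁺ i) → (T (A i) × i ≢ v) ⊎ (i ≡ v × T (A a))
          A⁺⁻ {i} t with T-∨⁻ {A i ∧ not (eqF i v)} t
          ... | inj₁ s = inj₁ (proj₁ (T-∧⁻ s) ,
                λ { refl → T-not⁻ (proj₂ (T-∧⁻ {A i} s)) (eqF-refl i) })
          ... | inj₂ s = inj₂ (eqF⁻ (proj₁ (T-∧⁻ {eqF i v} s)) , proj₂ (T-∧⁻ {eqF i v} s))
          mult'≢0 : ∀ i j → i ≢ v → j ≢ v → mult H i j ≢ 0 ⊎ ((i ≡ a × j ≡ b) ⊎ (i ≡ b × j ≡ a)) → mult H' i j ≢ 0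
          mult'≢0 i j i≢ j≢ (inj₁ ne) e = ne (m+n≡0⇒m≡0 (mult H i j) (trans (sym (mult-kept i≢ j≢)) e))
          mult'≢0 i j i≢ j≢ (inj₂ l) e = 1+n≢0 (trans (sym (ι-yes (link? a b i j) l))
            (m+n≡0⇒n≡0 (mult H i j) (trans (sym (mult-kept i≢ j≢)) e)))
          mAdj'⁺ : ∀ i j → T (alive H i) → T (alive H j) → i ≢ v → j ≢ v → mult H' i j ≢ 0 → T (mAdj H' i j)
          mAdj'⁺ i j ai aj i≢ j≢ ne = T-∧⁺ (alive⁺ {i} ai i≢) (T-∧⁺ (alive⁺ {j} aj j≢)
            (T-not⁺ (λ t → ne (≡ᵇ⇒≡ (mult H' i j) 0 t))))
          a→b : T (A a) → T (A b)
          a→b t = cl a b t (mAdj'⁺ a b a-alive b-alive a≢v b≢v (mult'≢0 a b a≢v b≢v (inj₂ (inj₁ (refl , refl)))))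
          b→a : T (A b) → T (A a)
          b→a t = cl b a t (mAdj'⁺ b a b-alive a-alive b≢v a≢v (mult'≢0 b a b≢v a≢v (inj₂ (inj₂ (refl , refl)))))
          end→A : ∀ {j} → T (A a) → j ≡ a ⊎ j ≡ b → T (A j)
          end→A t (inj₁ refl) = t
          end→A t (inj₂ refl) = a→b t
          A→a : ∀ {j} → T (A j) → j ≡ a ⊎ j ≡ b → T (A a)
          A→a t (inj₁ refl) = t
          A→a t (inj₂ refl) = b→a t
          v∈A⁺ : T (A a) → T (A⁺ v)
          v∈A⁺ t = T-∨ʳ {A v ∧ not (eqF v v)} (T-∧⁺ (eqF-refl v) t)
          cl⁺ : Closed (mAdj H) A⁺
          cl⁺ i j ti adjacent with A⁺⁻ {i} ti | at-v j
          ... | inj₁ (ai , i≢) | inj₁ refl = v∈A⁺ (A→a ai (end⁻ (λ e → mAdj⁻ {i} adjacent (trans (mult-sym i j) e))))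
          ... | inj₂ (refl , aa) | inj₁ refl = v∈A⁺ aa
          ... | inj₂ (refl , aa) | inj₂ j≢ = A⁺-other (end→A aa (end⁻ (mAdj⁻ {i} adjacent))) j≢
          ... | inj₁ (ai , i≢) | inj₂ j≢ = A⁺-other (cl i j ai (mAdj'⁺ i j (proj₁ (T-∧⁻ {alive H i} adjacent))
                  (proj₁ (T-∧⁻ {alive H j} (proj₂ (T-∧⁻ {alive H i} adjacent)))) i≢ j≢
                  (mult'≢0 i j i≢ j≢ (inj₁ (mAdj⁻ {i} adjacent))))) j≢
        ... | w , tw , Dw with T-∨⁻ {A w ∧ not (eqF w v)} tw
        ...   | inj₁ aw' = w , proj₁ (T-∧⁻ aw') , Dw
        ...   | inj₂ s with eqF⁻ {i = w} {v} (proj₁ (T-∧⁻ {eqF w v} s))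
        ...     | refl = ⊥-elim (Dw Dv)

    Unfinished : MG n → Fin n → Set
    Unfinished H v = T (alive H v) × D v ≡ 2 × mult H v v ≡ 0

    -- The last component is why a single pass over the vertices suffices: loops are only gained and
    -- alive vertices only lost, so a finished vertex stays finished.
    suppress-step : ∀ {H} → Reduct H → ∀ v → Reduct (suppress H v) ×
      ¬ Unfinished (suppress H v) v × (∀ w → ¬ Unfinished H w → ¬ Unfinished (suppress H v) w)
    suppress-step {H} I v with T? (alive H v ∧ (mdeg H v ≡ᵇ 2) ∧ (mult H v v ≡ᵇ 0))
    ... | no ¬c rewrite T-false ¬c = I , (λ (al , Dv , loopless) → ¬c (T-∧⁺ al
          (T-∧⁺ (≡⇒≡ᵇ (mdeg H v) 2 (trans (mdeg-∑ H v) (trans (Reduct.degree' I al) Dv)))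
            (≡⇒≡ᵇ (mult H v v) 0 loopless)))) , λ w h → h
    ... | yes c rewrite T-true c = two-nbrs (nbrs H v) refl
      where
      al = proj₁ (T-∧⁻ {alive H v} c)
      two : mdeg H v ≡ 2
      two = ≡ᵇ⇒≡ (mdeg H v) 2 (proj₁ (T-∧⁻ {mdeg H v ≡ᵇ 2} (proj₂ (T-∧⁻ {alive H v} c))))
      loopless : mult H v v ≡ 0
      loopless = ≡ᵇ⇒≡ (mult H v v) 0 (proj₂ (T-∧⁻ {mdeg H v ≡ᵇ 2} (proj₂ (T-∧⁻ {alive H v} c))))
      Dv : D v ≡ 2
      Dv = trans (sym (Reduct.degree' I al)) (trans (sym (mdeg-∑ H v)) two)
      length-nbrs : ∑ᴸ (nbrs H v) (λ _ → 1) ≡ 2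
      length-nbrs = trans (∑-nbrs H v loopless (λ _ → 1)) (trans (∑-cong fin (λ j → *-identityʳ (mult H v j)))
        (trans (sym (+-identityʳ _)) (trans (cong (∑ fin (mult H v) +_) (sym loopless))
          (trans (sym (mdeg-∑ H v)) two))))
      occurrences : ∀ i → ∑ᴸ (nbrs H v) (λ z → ι (i ≟ z)) ≡ mult H v i
      occurrences i = trans (∑-nbrs H v loopless (λ z → ι (i ≟ z)))
        (trans (∑-cong fin pointwise) (∑fin-single i (mult H v i)))
        where
        pointwise : ∀ j → mult H v j * ι (i ≟ j) ≡ ι (j ≟ i) * mult H v i
        pointwise j with i ≟ j | j ≟ i
        ... | yes refl | yes _ = *-comm (mult H v i) 1
        ... | yes refl | no ne = ⊥-elim (ne refl)
        ... | no ne | yes refl = ⊥-elim (ne refl)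
        ... | no _ | no _ = *-zeroʳ (mult H v j)
      two-nbrs : ∀ xs → nbrs H v ≡ xs → Reduct (replaceNbrs H v xs) ×
        ¬ Unfinished (replaceNbrs H v xs) v ×
        (∀ w → ¬ Unfinished H w → ¬ Unfinished (replaceNbrs H v xs) w)
      two-nbrs [] e = ⊥-elim (0≢1+n (trans (cong (λ l → ∑ᴸ l (λ _ → 1)) (sym e)) length-nbrs))
      two-nbrs (_ ∷ []) e = ⊥-elim (0≢1+n (suc-injective
        (trans (cong (λ l → ∑ᴸ l (λ _ → 1)) (sym e)) length-nbrs)))
      two-nbrs (_ ∷ _ ∷ _ ∷ _) e = ⊥-elim (1+n≢0 (suc-injective (suc-injective
        (trans (cong (λ l → ∑ᴸ l (λ _ → 1)) (sym e)) length-nbrs))))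
      two-nbrs (a ∷ b ∷ []) e =
        replace-Reduct I al Dv loopless ends ,
        (λ (al' , _) → proj₂ (alive⁻ {v} al') refl) ,
        λ w fin-w (al' , Dw , ll) → fin-w (proj₁ (alive⁻ {w} al') , Dw ,
          m+n≡0⇒m≡0 (mult H w w) (trans (sym (mult-kept (proj₂ (alive⁻ {w} al')) (proj₂ (alive⁻ {w} al')))) ll))
        where
        open Replace H v a b
        ends : ∀ i → mult H v i ≡ ι (i ≟ a) + ι (i ≟ b)
        ends i = trans (sym (occurrences i)) (trans (cong (λ l → ∑ᴸ l (λ z → ι (i ≟ z))) e)
          (cong (ι (i ≟ a) +_) (+-identityʳ (ι (i ≟ b)))))

    suppress-all : ∀ xs {H} → Reduct H → Reduct (foldl suppress H xs) ×
      (∀ v → v ∈ xs ⊎ ¬ Unfinished H v → ¬ Unfinished (foldl suppress H xs) v)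
    suppress-all [] I = I , λ { v (inj₂ f) → f }
    suppress-all (x ∷ xs) I with suppress-step I x
    ... | I' , done , still with suppress-all xs I'
    ...   | I″ , rest = I″ , λ { v (inj₁ (here refl)) → rest v (inj₂ done)
                              ; v (inj₁ (there v∈)) → rest v (inj₁ v∈)
                              ; v (inj₂ f) → rest v (inj₂ (still v f)) }

    cyclic-spread : ∀ {i j} → T (conn G i j) → T (inCyclicComp G i) → T (inCyclicComp G j)
    cyclic-spread {i} {j} cij t = allB⁺ {n} (λ w →
      subst (λ b → T (if b then deg G w ≡ᵇ 2 else true)) (conn-same G (symm re) cij w)
        (allB⁻ {n} t w))

    deleteCyclic-Reduct : Reduct (deleteCyclic G)
    deleteCyclic-Reduct = record
      { mult-sym = mult-sym₀
      ; degree' = λ {i} → degree₀ i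
      ; dead = λ {i} → dead₀ i
      ; within = λ {i} {j} → within₀ i j
      ; branch = branch₀
      }
      where
      al : Fin n → Bool
      al i = not (inCyclicComp G i)
      step : ∀ {i j} → T (G i j) → T (conn G i j)
      step {i} {j} g = conn-closed G i i j (conn-refl G i) g
      al-step : ∀ {i j} → T (conn G i j) → T (al i) → T (al j)
      al-step c ai = T-not⁺ (λ t → T-not⁻ ai (cyclic-spread (conn-sym G (symm re) c) t))
      mult₀ : ∀ {i j} → T (al i) → mult (deleteCyclic G) i j ≡ ι (T? (G i j))
      mult₀ {i} {j} ai rewrite T-true ai with T? (G i j)
      ... | yes g rewrite T-true (al-step (step g) ai) | T-true g = refl
      ... | no ¬g rewrite T-false ¬g | Boolₚ.∧-zeroʳ (al j) = refl
      dead₀ : ∀ i j → ¬ T (al i) → mult (deleteCyclic G) i j ≡ 0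
      dead₀ i j ¬ai rewrite T-false ¬ai = refl
      mult-sym₀ : ∀ i j → mult (deleteCyclic G) i j ≡ mult (deleteCyclic G) j i
      mult-sym₀ i j = cong (λ b → if b then 1 else 0)
        (T-ext {al i ∧ al j ∧ G i j} {al j ∧ al i ∧ G j i} (swap i j) (swap j i))
        where
        swap : ∀ i j → T (al i ∧ al j ∧ G i j) → T (al j ∧ al i ∧ G j i)
        swap i j t with T-∧⁻ {al i} t
        ... | ai , s with T-∧⁻ {al j} s
        ...   | aj , g = T-∧⁺ aj (T-∧⁺ ai (symm re i j g))
      degree₀ : ∀ i → T (al i) → ∑ fin (mult (deleteCyclic G) i) + mult (deleteCyclic G) i i ≡ D i
      degree₀ i ai = trans (cong₂ _+_ (∑-cong fin (λ j → mult₀ {i} {j} ai))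
        (trans (mult₀ {i} {i} ai) (ι-no (T? (G i i)) (irrefl re i))))
        (trans (+-identityʳ _) (degree re i))
      edge₀ : ∀ i j → mult (deleteCyclic G) i j ≢ 0 → T (G i j)
      edge₀ i j ne with T? (al i ∧ al j ∧ G i j)
      ... | yes t = proj₂ (T-∧⁻ {al j} (proj₂ (T-∧⁻ {al i} t)))
      ... | no ¬t = ⊥-elim (ne (cong (λ b → if b then 1 else 0) (T-false ¬t)))
      within₀ : ∀ i j → mult (deleteCyclic G) i j ≢ 0 → T (conn G i j)
      within₀ i j ne = step (edge₀ i j ne)
      branch₀ : ∀ (A : Fin n → Bool) {v} → Closed (mAdj (deleteCyclic G)) A → T (A v) → T (al v) →
        ∃[ w ] (T (A w) × D w ≢ 2)
      -- If all degrees in the component of v were 2, it would be cyclic and v would have been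
      -- deleted.
      branch₀ A {v} cl av alv with any? (λ w → T? (conn G v w) ×-dec ¬? (D w ℕ.≟ 2))
      ... | no none = ⊥-elim (T-not⁻ alv (allB⁺ {n} all-two))
        where
        all-two : ∀ w → T (if conn G v w then deg G w ≡ᵇ 2 else true)
        all-two w with T? (conn G v w) | D w ℕ.≟ 2
        ... | no ¬c | _ rewrite T-false ¬c = tt
        ... | yes c | yes Dw rewrite T-true c = ≡⇒≡ᵇ (deg G w) 2 (trans (degree re w) Dw)
        ... | yes c | no Dw = ⊥-elim (none (w , c , Dw))
      ... | yes (w , c , Dw) = w , proj₁ (T-∧⁻ {A w} (conn-least closed (T-∧⁺ av alv) c)) , Dw
        where
        closed : Closed G (λ i → A i ∧ al i)
        closed i j t g with T-∧⁻ {A i} t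
        ... | ai , li = T-∧⁺ (cl i j ai (T-∧⁺ li (T-∧⁺ lj (T-not⁺ λ z →
              1+n≢0 (trans (sym (trans (mult₀ {i} {j} li) (ι-yes (T? (G i j)) g))) (≡ᵇ⇒≡ (mult (deleteCyclic G) i j) 0 z)))))) lj
          where
          lj = al-step (step g) li

    private
      Hof-suppressed = suppress-all (allFin n) deleteCyclic-Reduct

    Hof-Reduct : Reduct (Hof G)
    Hof-Reduct = proj₁ Hof-suppressed

    -- Only a loop can save a vertex of degree 2 from suppression. The loop uses up its degree, so
    -- the vertex alone is a closed set, and `branch` contradicts its degree.
    Hof-degree : ∀ {v} → T (alive (Hof G) v) → D v ≢ 2
    Hof-degree {v} al Dv = contradiction Dw (Dw≢2)
      where
      open Reduct Hof-Reduct
      H = Hof G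
      loop : mult H v v ≢ 0
      loop e = proj₂ Hof-suppressed v (inj₁ (∈-allFin v)) (al , Dv , e)
      isolated : ∀ j → j ≢ v → mult H v j ≡ 0
      isolated j j≢v with mult H v j in eq
      ... | zero = refl
      ... | suc m = ⊥-elim (<-irrefl refl (≤-trans three (≤-reflexive (trans (degree' al) Dv))))
        where
        sum-ι : ∑ fin (λ z → ι (z ≟ v) * mult H v v) + ∑ fin (λ z → ι (z ≟ j) * mult H v j) ≤ ∑ fin (mult H v)
        sum-ι = ≤-trans (≤-reflexive (sym (∑-+ fin (λ z → ι (z ≟ v) * mult H v v) (λ z → ι (z ≟ j) * mult H v j))))
          (∑-mono fin pointwise)
          where
          pointwise : ∀ z → ι (z ≟ v) * mult H v v + ι (z ≟ j) * mult H v j ≤ mult H v z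
          pointwise z with z ≟ v | z ≟ j
          ... | yes refl | yes refl = ⊥-elim (j≢v refl)
          ... | yes refl | no _ = ≤-reflexive (trans (+-identityʳ _) (+-identityʳ _))
          ... | no _ | yes refl = ≤-reflexive (+-identityʳ _)
          ... | no _ | no _ = z≤n
        three : 3 ≤ ∑ fin (mult H v) + mult H v v
        three = +-mono-≤ (≤-trans (+-mono-≤ (n≢0⇒n>0 loop) (≤-trans (s≤s z≤n) (≤-reflexive (sym eq))))
          (≤-trans (≤-reflexive (sym (cong₂ _+_ (∑fin-single v (mult H v v)) (∑fin-single j (mult H v j))))) sum-ι))
          (n≢0⇒n>0 loop)
      singleton-closed : Closed (mAdj H) (λ i → eqF i v)
      singleton-closed i j t adjacent with eqF⁻ {i = i} {v} t | j ≟ v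
      ... | refl | yes refl = tt
      ... | refl | no j≢ = ⊥-elim (mAdj⁻ {i} adjacent (isolated j j≢))
      branching = branch (λ i → eqF i v) singleton-closed (eqF-refl v) al
      Dw : D (proj₁ branching) ≡ 2
      Dw = trans (cong D (eqF⁻ (proj₁ (proj₂ branching)))) Dv
      Dw≢2 : D (proj₁ branching) ≢ 2
      Dw≢2 = proj₂ (proj₂ branching)

    -- Each edge is charged to its smaller end and each loop to its vertex. A vertex is charged at
    -- most its degree, which is its weight because no alive vertex has degree 2.
    mCompSize≤W : ∀ v → mCompSize (Hof G) v ≤ W D (conn G v)
    mCompSize≤W v = ∑-mono fin pointwise
      where
      open Reduct Hof-Reduct
      H = Hof G
      conn-closed' : Closed (mAdj H) (conn G v)
      conn-closed' i j ci adjacent = conn-trans G ci (within (mAdj⁻ {i} adjacent))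
      inner : ∀ i → ∑ fin (λ j → if alive H j ∧ mconn H v j ∧ ltF i j then mult H i j else 0) ≤ ∑ fin (mult H i)
      inner i = ∑-mono fin λ j → if-≤ (alive H j ∧ mconn H v j ∧ ltF i j) (mult H i j)
        where
        if-≤ : ∀ b m → (if b then m else 0) ≤ m
        if-≤ true m = ≤-refl
        if-≤ false m = z≤n
      pointwise : ∀ i → (if alive H i ∧ mconn H v i
          then mult H i i + ∑ fin (λ j → if alive H j ∧ mconn H v j ∧ ltF i j then mult H i j else 0)
          else 0) ≤ (if conn G v i then wt D i else 0)
      pointwise i with T? (alive H i ∧ mconn H v i)
      ... | no ¬t rewrite T-false ¬t = z≤n
      ... | yes t rewrite T-true t | T-true (conn-least conn-closed' (conn-refl G v) (proj₂ (T-∧⁻ {alive H i} t))) =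
        begin
          mult H i i + ∑ fin (λ j → if alive H j ∧ mconn H v j ∧ ltF i j then mult H i j else 0)
            ≤⟨ +-monoʳ-≤ (mult H i i) (inner i) ⟩
          mult H i i + ∑ fin (mult H i)   ≡⟨ +-comm (mult H i i) _ ⟩
          ∑ fin (mult H i) + mult H i i   ≡⟨ degree' al ⟩
          D i                             ≡⟨ wt-≢2 {D = D} (Hof-degree al) ⟨
          wt D i                          ∎
        where
        open ≤-Reasoning
        al = proj₁ (T-∧⁻ {alive H i} t)

-- Connected vertex sets with small boundary

-- The binomial coefficient of p + q over q.
pascal : ℕ → ℕ → ℕ
pascal zero q = 1
pascal (suc p) zero = 1
pascal (suc p) (suc q) = pascal p (suc q) + pascal (suc p) q

pascal>0 : ∀ p q → 1 ≤ pascal p q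
pascal>0 zero q = ≤-refl
pascal>0 (suc p) zero = ≤-refl
pascal>0 (suc p) (suc q) = ≤-trans (pascal>0 p (suc q)) (m≤m+n _ _)

lookup-injective : ∀ {n} {K L : Subset n} → (∀ i → lookup K i ≡ lookup L i) → K ≡ L
lookup-injective {K = K} {L} e =
  trans (sym (tabulate∘lookup K)) (trans (tabulate-cong e) (tabulate∘lookup L))

module _ {n : ℕ} where

  restrict : Adj n → (Fin n → Bool) → Adj n
  restrict G K i j = K i ∧ K j ∧ G i j

  restrict⁺ : ∀ {G K i j} → T (K i) → T (K j) → T (G i j) → T (restrict G K i j)
  restrict⁺ ki kj g = T-∧⁺ ki (T-∧⁺ kj g)

  restrict⁻ : ∀ {G K i j} → T (restrict G K i j) → T (K i) × T (K j) × T (G i j)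
  restrict⁻ {G} {K} {i} {j} t with T-∧⁻ {K i} t
  ... | ki , s with T-∧⁻ {K j} s
  ...   | kj , g = ki , kj , g

  Exit : Adj n → (Fin n → Bool) → Fin n → Fin n → Set
  Exit G K i u = T (K i) × ¬ T (K u) × T (G i u)

  exit? : ∀ G K i u → Dec (Exit G K i u)
  exit? G K i u = T? (K i) ×-dec ¬? (T? (K u)) ×-dec T? (G i u)

  boundary : Adj n → (Fin n → Bool) → ℕ
  boundary G K = ∑ fin λ i → ∑ fin λ u → ι (exit? G K i u)

  Spanned : Adj n → (Fin n → Bool) → Fin n → Set
  Spanned G K r = ∀ w → T (K w) → T (conn (restrict G K) r w)

  Piece : Fin n → ℕ → ℕ → Adj n → (Fin n → Bool) → Set
  Piece r s b G K = T (K r) × countB K ≤ s × boundary G K ≤ b × Spanned G K r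

  piece? : ∀ r s b G K → Dec (Piece r s b G K)
  piece? r s b G K = T? (K r) ×-dec (countB K ≤? s) ×-dec (boundary G K ≤? b) ×-dec
    all? (λ w → T? (K w) →-dec T? (conn (restrict G K) r w))

  insert : (Fin n → Bool) → Fin n → Fin n → Bool
  insert A z i = A i ∨ eqF i z

  insert⁻ : ∀ {A z i} → T (insert A z i) → T (A i) ⊎ i ≡ z
  insert⁻ {A} {z} {i} t with T-∨⁻ {A i} t
  ... | inj₁ a = inj₁ a
  ... | inj₂ e = inj₂ (eqF⁻ e)

  insert-grows : ∀ (A : Fin n → Bool) z → ¬ T (A z) → suc (countB A) ≤ countB (insert A z)
  insert-grows A z ¬az = countB-mono-< z (λ i → T-∨ˡ) ¬az (T-∨ʳ {A z} (eqF-refl z))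

  ≤boundaryʳ : ∀ G K (Z : Fin n → Bool) → (∀ z → T (Z z) → ¬ T (K z) × ∃[ i ] (T (K i) × T (G i z))) →
    countB Z ≤ boundary G K
  ≤boundaryʳ G K Z h = ≤-trans
    (∑-mono fin (λ z → ι-≤ (T? (Z z)) (λ tz → let ¬kz , i , ki , g = h z tz in
      ∑-ι-∃ fin (λ i → exit? G K i z) i (ki , ¬kz , g))))
    (≤-reflexive (sym (∑-swap fin fin (λ i u → ι (exit? G K i u)))))

  Between : Fin n → ℕ → ℕ → Adj n → (A Z : Fin n → Bool) → Subset n → Set
  Between r s b G A Z K = Piece r s b G (lookup K) × (∀ i → T (A i) → T (lookup K i)) ×
    (∀ z → T (Z z) → ¬ T (lookup K z))

  between? : ∀ r s b G A Z K → Dec (Between r s b G A Z K)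
  between? r s b G A Z K = piece? r s b G (lookup K) ×-dec
    all? (λ i → T? (A i) →-dec T? (lookup K i)) ×-dec
    all? (λ z → T? (Z z) →-dec ¬? (T? (lookup K z)))

  -- Branch on whether a neighbour z of A lies in K: it either enlarges A, or it uses up a
  -- boundary edge of K.
  pieces-between : ∀ r s b (G : Adj n) p q (A Z : Fin n → Bool) → T (A r) →
    s ≤ countB A + p → b ≤ countB Z + q → (∀ z → T (Z z) → ∃[ i ] (T (A i) × T (G i z))) →
    ∑ subsets (λ K → ι (between? r s b G A Z K)) ≤ pascal p q
  pieces-between r s b G p q A Z ar sA bZ adjacent
    with any? (λ z → ¬? (T? (A z)) ×-dec ¬? (T? (Z z)) ×-dec any? (λ i → T? (A i) ×-dec T? (G i z)))
  -- When no neighbour of A is left undecided, connectivity forces K to equal A.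
  ... | no stuck = ≤-trans (∑-unique subsets (between? r s b G A Z) λ K L hK hL → lookup-injective {K = K} {L} λ i →
          T-ext (λ k → proj₁ (proj₂ hL) i (only K hK i k)) (λ l → proj₁ (proj₂ hK) i (only L hL i l)))
        (pascal>0 p q)
    where
    only : ∀ K → Between r s b G A Z K → ∀ i → T (lookup K i) → T (A i)
    only K ((_ , _ , _ , spanned) , A⊆K , ¬Z) i ki = conn-least closed ar (spanned i ki)
      where
      closed : Closed (restrict G (lookup K)) A
      closed i j ai g with T? (A j) | restrict⁻ {G} {lookup K} {i} {j} g
      ... | yes aj | _ = aj
      ... | no ¬aj | (_ , kj , gij) = ⊥-elim (stuck (j , ¬aj , (λ zj → ¬Z j zj kj) , i , ai , gij))
  ... | yes (z , ¬az , ¬zz , i , ai , giz) = ≤-trans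
        (≤-trans (∑-mono subsets split) (≤-reflexive (∑-+ subsets (ι ∘ btw? A⁺ Z) (ι ∘ btw? A Z⁺)))) (recurse p q sA bZ)
    where
    btw? = between? r s b G
    A⁺ = insert A z
    Z⁺ = insert Z z
    split : ∀ K → ι (btw? A Z K) ≤ ι (btw? A⁺ Z K) + ι (btw? A Z⁺ K)
    split K = ι-≤-+ (btw? A Z K) (btw? A⁺ Z K) (btw? A Z⁺ K) decide
      where
      decide : Between r s b G A Z K → Between r s b G A⁺ Z K ⊎ Between r s b G A Z⁺ K
      decide (pc , A⊆K , ¬Z) with T? (lookup K z)
      ... | yes kz = inj₁ (pc , (λ i t → [ A⊆K i , (λ { refl → kz }) ]′ (insert⁻ {A} {z} {i} t)) , ¬Z)
      ... | no ¬kz = inj₂ (pc , A⊆K , λ i t → [ ¬Z i , (λ { refl → ¬kz }) ]′ (insert⁻ {Z} {z} {i} t))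
    -- Here p and q are the remaining budgets of vertices and of boundary edges. When a budget is
    -- exhausted, the branch that would draw on it contains no set.
    none : ∀ {P : Subset n → Set} (P? : ∀ K → Dec (P K)) → (∀ K → ¬ P K) → ∑ subsets (ι ∘ P?) ≡ 0
    none P? ¬P = trans (∑-cong subsets (λ K → ι-no (P? K) (¬P K))) (∑ᴸ-0 (elems (subsets {n})))
    too-big : s ≤ countB A + 0 → ∀ K → ¬ Between r s b G A⁺ Z K
    too-big sA K ((_ , small , _) , A⊆K , _) = <-irrefl refl (begin-strict
      countB A          <⟨ insert-grows A z ¬az ⟩
      countB A⁺         ≤⟨ countB-mono A⊆K ⟩
      countB (lookup K) ≤⟨ small ⟩
      s                 ≤⟨ sA ⟩
      countB A + 0      ≡⟨ +-identityʳ _ ⟩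
      countB A          ∎)
      where open ≤-Reasoning
    too-exposed : b ≤ countB Z + 0 → ∀ K → ¬ Between r s b G A Z⁺ K
    too-exposed bZ K ((_ , _ , few , _) , A⊆K , ¬Z) = <-irrefl refl (begin-strict
      countB Z                   <⟨ insert-grows Z z ¬zz ⟩
      countB Z⁺                  ≤⟨ ≤boundaryʳ G (lookup K) Z⁺ (λ w t → ¬Z w t , exposed w t) ⟩
      boundary G (lookup K)      ≤⟨ few ⟩
      b                          ≤⟨ bZ ⟩
      countB Z + 0               ≡⟨ +-identityʳ _ ⟩
      countB Z                   ∎)
      where
      open ≤-Reasoning
      exposed : ∀ w → T (Z⁺ w) → ∃[ i ] (T (lookup K i) × T (G i w))
      exposed w t with insert⁻ {Z} {z} {w} t
      ... | inj₁ zw = let j , aj , g = adjacent w zw in j , A⊆K j aj , g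
      ... | inj₂ refl = i , A⊆K i ai , giz
    grow-A : ∀ p q → s ≤ countB A + suc p → b ≤ countB Z + q →
      ∑ subsets (ι ∘ btw? A⁺ Z) ≤ pascal p q
    grow-A p q sA bZ = pieces-between r s b G p q A⁺ Z (T-∨ˡ ar)
      (≤-trans sA (≤-trans (≤-reflexive (+-suc (countB A) p)) (+-monoˡ-≤ p (insert-grows A z ¬az))))
      bZ (λ w zw → let j , aj , g = adjacent w zw in j , T-∨ˡ aj , g)
    grow-Z : ∀ p q → s ≤ countB A + p → b ≤ countB Z + suc q →
      ∑ subsets (ι ∘ btw? A Z⁺) ≤ pascal p q
    grow-Z p q sA bZ = pieces-between r s b G p q A Z⁺ ar sA
      (≤-trans bZ (≤-trans (≤-reflexive (+-suc (countB Z) q)) (+-monoˡ-≤ q (insert-grows Z z ¬zz))))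
      (λ w zw → [ adjacent w , (λ { refl → i , ai , giz }) ]′ (insert⁻ {Z} {z} {w} zw))
    recurse : ∀ p q → s ≤ countB A + p → b ≤ countB Z + q →
      ∑ subsets (ι ∘ btw? A⁺ Z) + ∑ subsets (ι ∘ btw? A Z⁺) ≤ pascal p q
    recurse zero zero sA bZ = ≤-trans (≤-reflexive (cong₂ _+_
      (none (btw? A⁺ Z) (too-big sA)) (none (btw? A Z⁺) (too-exposed bZ)))) z≤n
    recurse zero (suc q) sA bZ = ≤-trans
      (≤-reflexive (cong (_+ ∑ subsets (ι ∘ btw? A Z⁺)) (none (btw? A⁺ Z) (too-big sA)))) (grow-Z zero q sA bZ)
    recurse (suc p) zero sA bZ = ≤-trans
      (≤-reflexive (trans (cong (∑ subsets (ι ∘ btw? A⁺ Z) +_) (none (btw? A Z⁺) (too-exposed bZ)))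
        (+-identityʳ _))) (≤-trans (grow-A p zero sA bZ) (≤-reflexive (pascal-zeroʳ p)))
      where
      pascal-zeroʳ : ∀ p → pascal p 0 ≡ 1
      pascal-zeroʳ zero = refl
      pascal-zeroʳ (suc p) = refl
    recurse (suc p) (suc q) sA bZ = +-mono-≤ (grow-A p (suc q) sA bZ) (grow-Z (suc p) q sA bZ)

  pieces-bound : ∀ r s b (G : Adj n) →
    ∑ subsets (λ K → ι (piece? r s b G (lookup K))) ≤ pascal s b
  pieces-bound r s b G = ≤-trans
    (∑-mono subsets λ K → ι-mono (piece? r s b G (lookup K))
        (between? r s b G (λ i → eqF i r) (λ _ → false) K) (λ pc@(kr , _) → pc ,
      (λ i t → subst (T ∘ lookup K) (sym (eqF⁻ {i = i} {r} t)) kr) , λ z ()))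
    (pieces-between r s b G s b (λ i → eqF i r) (λ _ → false) (eqF-refl r)
      (m≤n+m s _) (m≤n+m b _) (λ z ()))

  -- A breadth-first tree of K with root r: the parent is reached within some k steps in which w is
  -- not.
  record Parents (G : Adj n) (K : Fin n → Bool) (r : Fin n) : Set where
    field
      parent : Fin n → Fin n
      earlier : ∀ w → T (K w) → w ≡ r ⊎ ∃[ k ] (T (reachIn k (restrict G K) r (parent w)) ×
        ¬ T (reachIn k (restrict G K) r w) × T (restrict G K (parent w) w))

  parents : ∀ {G K r} → Spanned G K r → Parents G K r
  parents {G} {K} {r} spanned = record
    { parent = λ w → proj₁ (choose w) ; earlier = λ w kw → proj₂ (choose w) kw }
    where
    R = restrict G K
    From : Fin n → Fin n → Set
    From w p = w ≡ r ⊎ ∃[ k ] (T (reachIn k R r p) × ¬ T (reachIn k R r w) × T (R p w))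
    search : ∀ k w → T (reachIn k R r w) → ∃[ p ] From w p
    search zero w t = r , inj₁ (sym (eqF⁻ t))
    search (suc k) w t with T? (reachIn k R r w) | reachIn-suc⁻ k R r w t
    ... | yes t' | _ = search k w t'
    ... | no ¬t | inj₁ t' = ⊥-elim (¬t t')
    ... | no ¬t | inj₂ (l , rl , g) = l , inj₂ (k , rl , ¬t , g)
    choose : ∀ w → ∃[ p ] (T (K w) → From w p)
    choose w with T? (K w)
    ... | no ¬kw = r , λ kw → ⊥-elim (¬kw kw)
    ... | yes kw = let p , f = search n w (spanned w kw) in p , λ _ → f

  -- The path to w is rebuilt along tree edges, by induction on the number of steps within which w
  -- is reached; none of these edges is xy.
  spanned-without : ∀ {G G' K r x y} → Spanned G K r → (P : Parents G K r) →
    x ≢ Parents.parent P y → y ≢ Parents.parent P x →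
    (∀ {i j} → T (K i) → T (K j) → T (G i j) → T (G' i j) ⊎ (i ≡ x × j ≡ y) ⊎ (i ≡ y × j ≡ x)) →
    Spanned G' K r
  spanned-without {G} {G'} {K} {r} {x} {y} spanned P x≢ y≢ keeps w kw = reached n w kw (spanned w kw)
    where
    open Parents P
    R = restrict G K
    reached : ∀ k w → T (K w) → T (reachIn k R r w) → T (conn (restrict G' K) r w)
    reached zero w _ t = subst (T ∘ conn (restrict G' K) r) (eqF⁻ t) (conn-refl (restrict G' K) r)
    reached (suc k) w kw t with earlier w kw
    ... | inj₁ refl = conn-refl (restrict G' K) r
    ... | inj₂ (l , rl , ¬l , g) with l ≤? k | restrict⁻ {G} {K} {parent w} {w} g
    ...   | no l≰k | _ = ⊥-elim (¬l (reachIn-≤ R r w (≰⇒> l≰k) t))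
    ...   | yes l≤k | (kp , _ , gpw) with keeps kp kw gpw
    ...     | inj₁ g' = conn-closed (restrict G' K) r (parent w) w
              (reached k (parent w) kp (reachIn-≤ R r (parent w) l≤k rl)) (restrict⁺ {G'} {K} kp kw g')
    ...     | inj₂ (inj₁ (e , refl)) = ⊥-elim (x≢ (sym e))
    ...     | inj₂ (inj₂ (e , refl)) = ⊥-elim (y≢ (sym e))

  conn-Spanned : ∀ (G : Adj n) r → Spanned G (conn G r) r
  conn-Spanned G r w kw = conn-least closed (conn-refl R r) kw
    where
    R = restrict G (conn G r)
    inside : ∀ i → T (conn R r i) → T (conn G r i)
    inside i = conn-least (λ i j ci g → conn-closed G r i j ci (proj₂ (proj₂ (restrict⁻ {G} {conn G r} {i} {j} g))))
      (conn-refl G r)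
    closed : Closed G (conn R r)
    closed i j ti g = conn-closed R r i j ti
      (restrict⁺ {G} {conn G r} (inside i ti) (conn-closed G r i j (inside i ti) g) g)

  -- For fixed σ toggling permutes all graphs, so the pairs may be counted from the far end: `upper`
  -- bounds the quadruples that lead into G.
  switch-count : (g : Graph n → ℕ) {P : Graph n → Quad → Set} (P? : ∀ G σ → Dec (P G σ)) →
    (∀ G → ∑ quads (λ σ → ι (P? (toggle σ G) σ)) ≤ g G) →
    ∑ graphs (λ G → ∑ quads (λ σ → ι (P? G σ))) ≤ ∑ graphs g
  switch-count g P? upper = begin
    ∑ graphs (λ G → ∑ quads (λ σ → ι (P? G σ)))                   ≡⟨ ∑-swap graphs quads (λ G σ → ι (P? G σ)) ⟩
    ∑ quads (λ σ → ∑ graphs (λ G → ι (P? G σ)))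
      ≡⟨ ∑-cong quads (λ σ → ∑-reindex graphs _≟ᴳ_ (toggle σ) (toggle-involutive σ) (λ G → ι (P? G σ))) ⟨
    ∑ quads (λ σ → ∑ graphs (λ G → ι (P? (toggle σ G) σ)))
      ≡⟨ ∑-swap graphs quads (λ G σ → ι (P? (toggle σ G) σ)) ⟨
    ∑ graphs (λ G → ∑ quads (λ σ → ι (P? (toggle σ G) σ)))        ≤⟨ ∑-mono graphs upper ⟩
    ∑ graphs g                                                    ∎
    where open ≤-Reasoning

  ∑₂ : (Fin n → Fin n → ℕ) → ℕ
  ∑₂ f = ∑ fin λ i → ∑ fin (f i)

  ∑₂-mono : {f g : Fin n → Fin n → ℕ} → (∀ i j → f i j ≤ g i j) → ∑₂ f ≤ ∑₂ g
  ∑₂-mono h = ∑-mono fin λ i → ∑-mono fin (h i)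

  ∑₂-+ : (f g : Fin n → Fin n → ℕ) → ∑₂ (λ i j → f i j + g i j) ≡ ∑₂ f + ∑₂ g
  ∑₂-+ f g = trans (∑-cong fin λ i → ∑-+ fin (f i) (g i)) (∑-+ fin (λ i → ∑ fin (f i)) (λ i → ∑ fin (g i)))

  ∑₂-unique : {P : Fin n → Fin n → Set} (P? : ∀ i j → Dec (P i j)) →
    (∀ {i j k l} → P i j → P k l → i ≡ k × j ≡ l) → ∑₂ (λ i j → ι (P? i j)) ≤ 1
  ∑₂-unique P? same = ≤-trans (≤-reflexive (sym (∑-⊗ fin fin (λ (i , j) → ι (P? i j)))))
    (∑-unique (fin ⊗ fin) (λ (i , j) → P? i j) λ { (i , j) (k , l) p q → cong₂ _,_ (proj₁ (same p q)) (proj₂ (same p q)) })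

  ∑-quads : (f : Quad → ℕ) → ∑ quads f ≡ ∑₂ (λ x y → ∑₂ (λ u v → f (x , y , u , v)))
  ∑-quads f = trans (∑-⊗ fin (fin ⊗ fin ⊗ fin) f) (∑-cong fin λ x →
    trans (∑-⊗ fin (fin ⊗ fin) (λ z → f (x , z))) (∑-cong fin λ y →
      ∑-⊗ fin fin (λ z → f (x , y , z))))

ι-⊎ : {P R : Set} (d : Dec P) (e : Dec R) → ι (d ⊎-dec e) ≤ ι d + ι e
ι-⊎ d e = ι-≤-+ (d ⊎-dec e) d e id

-- Dense pieces of small order: pulling a spanned set out of its component by 2-switches

-- The factor of a step consists of the ordered choices of two among at most 2 (j + 1) boundary
-- edges, and of a 2 for the orientations of a candidate lost in `moves`.
reversals : ℕ → ℕ
reversals zero = 1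
reversals (suc j) = reversals j * (2 * ((2 * suc j) * (2 * suc j)))

module Dense {n : ℕ} (D : Fin n → ℕ) (positive : IsDegreeSequence D) (r : Fin n) (Q-1 S : ℕ) where

  private Q = suc Q-1

  -- A former component K after j switches, each of which adds at most two boundary edges. The
  -- weight of K is unchanged, as it depends only on the degrees.
  State : ℕ → Adj n → (Fin n → Bool) → Set
  State j G K = IsReal D G × M D ≤ Q * W D K × Piece r S (2 * j) G K

  state? : ∀ j G K → Dec (State j G K)
  state? j G K = isReal? G ×-dec (M D ≤? Q * W D K) ×-dec piece? r S (2 * j) G K

  Move : ℕ → (Fin n → Bool) → Graph n → Quad → Set
  Move j K G σ@(x , y , u , v) = IsReal D (adj G) × T (K x) × T (K y) × ¬ T (K u) × ¬ T (K v) ×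
    Switchable (adj G) σ × State (suc j) (adj (toggle σ G)) K

  move? : ∀ j K G σ → Dec (Move j K G σ)
  move? j K G σ@(x , y , u , v) = isReal? (adj G) ×-dec T? (K x) ×-dec T? (K y) ×-dec
    ¬? (T? (K u)) ×-dec ¬? (T? (K v)) ×-dec switchable? (adj G) σ ×-dec
    state? (suc j) (adj (toggle σ G)) K

  module _ (j : ℕ) (G : Graph n) (K : Fin n → Bool) (st : State j (adj G) K)
    (tree : Parents (adj G) K r) where
    private
      g = adj G
      re = proj₁ st
      spanned = proj₂ (proj₂ (proj₂ (proj₂ (proj₂ st))))
    open Parents tree

    Border : Fin n → Set
    Border i = ∃[ u ] Exit g K i u

    border? : ∀ i → Dec (Border i)
    border? i = any? (exit? g K i)

    -- An edge outside the tree, so that K stays connected without it. A neighbour u of a free v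
    -- could be adjacent to x, making xu illegal, or to y, making yu illegal, but not to both if x
    -- and y are not both on the border.
    Candidate : Fin n → Fin n → Set
    Candidate x y = T (K x) × T (K y) × T (g x y) × x ≢ parent y × y ≢ parent x × ¬ (Border x × Border y)

    candidate? : ∀ x y → Dec (Candidate x y)
    candidate? x y = T? (K x) ×-dec T? (K y) ×-dec T? (g x y) ×-dec ¬? (x ≟ parent y) ×-dec
      ¬? (y ≟ parent x) ×-dec ¬? (border? x ×-dec border? y)

    Free : Fin n → Set
    Free v = ¬ T (K v) × ¬ (∃[ i ] (T (K i) × T (g i v)))

    free? : ∀ v → Dec (Free v)
    free? v = ¬? (T? (K v)) ×-dec ¬? (any? (λ i → T? (K i) ×-dec T? (g i v)))

    #candidates = ∑₂ (λ x y → ι (candidate? x y))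
    #free = ∑ fin (λ v → ι (free? v))
    #border = ∑ fin (λ i → ι (border? i))

    border≤boundary : #border ≤ boundary g K
    border≤boundary = ∑-mono fin (λ i → ι-≤ (border? i) (λ (u , e) → ∑-ι-∃ fin (exit? g K i) u e))

    -- W is at most the number of ordered adjacent pairs starting in K. A pair that is no candidate
    -- leaves K, joins a vertex and its parent in one of two directions, or has both ends on the
    -- border.
    W≤candidates : W D K ≤ #candidates + (boundary g K + (countB K + (countB K + #border * #border)))
    W≤candidates = begin
      W D K ≤⟨ ∑-mono fin row ⟩
      ∑₂ (λ x y → ι (inner? x y)) ≤⟨ ∑₂-mono pointwise ⟩
      ∑₂ (λ x y → c x y + (e x y + (p x y + (p' x y + b x y)))) ≡⟨ split ⟩
      ∑₂ c + (∑₂ e + (∑₂ p + (∑₂ p' + ∑₂ b))) ≤⟨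
        +-monoʳ-≤ (∑₂ c) (+-monoʳ-≤ (∑₂ e) (+-mono-≤ parents≤ (+-mono-≤ parents≤' (≤-reflexive borders)))) ⟩
      #candidates + (boundary g K + (countB K + (countB K + #border * #border))) ∎
      where
      open ≤-Reasoning
      inner? : ∀ x y → Dec (T (K x) × T (g x y))
      inner? x y = T? (K x) ×-dec T? (g x y)
      par? : ∀ x y → Dec (T (K x) × y ≡ parent x)
      par? x y = T? (K x) ×-dec (y ≟ parent x)
      c e p p' b : Fin n → Fin n → ℕ
      c x y = ι (candidate? x y)
      e x y = ι (exit? g K x y)
      p x y = ι (par? x y)
      p' x y = ι (par? y x)
      b x y = ι (border? x) * ι (border? y)
      row : ∀ x → (if K x then wt D x else 0) ≤ ∑ fin (λ y → ι (inner? x y))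
      row x with K x
      ... | false = z≤n
      ... | true = ≤-trans (wt≤D (D x)) (≤-reflexive (sym (degree re x)))
        where
        wt≤D : ∀ d → (if d ≡ᵇ 2 then 0 else d) ≤ d
        wt≤D d with d ≡ᵇ 2
        ... | true = z≤n
        ... | false = ≤-refl
      pointwise : ∀ x y → ι (inner? x y) ≤ c x y + (e x y + (p x y + (p' x y + b x y)))
      pointwise x y = ≤-trans (ι-≤-+ (inner? x y) (candidate? x y) rest₁ classify)
        (+-monoʳ-≤ (c x y) (≤-trans (ι-⊎ (exit? g K x y) rest₂) (+-monoʳ-≤ (e x y)
          (≤-trans (ι-⊎ (par? x y) rest₃) (+-monoʳ-≤ (p x y)
            (≤-trans (ι-⊎ (par? y x) rest₄) (+-monoʳ-≤ (p' x y) (≤-reflexive (ι-× (border? x) (border? y))))))))))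
        where
        rest₄ = border? x ×-dec border? y
        rest₃ = par? y x ⊎-dec rest₄
        rest₂ = par? x y ⊎-dec rest₃
        rest₁ = exit? g K x y ⊎-dec rest₂
        classify : T (K x) × T (g x y) → Candidate x y ⊎ Exit g K x y ⊎ (T (K x) × y ≡ parent x) ⊎
          (T (K y) × x ≡ parent y) ⊎ (Border x × Border y)
        classify (kx , gxy) with T? (K y)
        ... | no ¬ky = inj₂ (inj₁ (kx , ¬ky , gxy))
        ... | yes ky with y ≟ parent x | x ≟ parent y | border? x ×-dec border? y
        ...   | yes ey | _ | _ = inj₂ (inj₂ (inj₁ (kx , ey)))
        ...   | no _ | yes ex | _ = inj₂ (inj₂ (inj₂ (inj₁ (ky , ex))))
        ...   | no _ | no _ | yes bb = inj₂ (inj₂ (inj₂ (inj₂ bb)))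
        ...   | no ney | no nex | no ¬bb = inj₁ (kx , ky , gxy , nex , ney , ¬bb)
      split : ∑₂ (λ x y → c x y + (e x y + (p x y + (p' x y + b x y)))) ≡
        ∑₂ c + (∑₂ e + (∑₂ p + (∑₂ p' + ∑₂ b)))
      split = trans (∑₂-+ c _) (cong (∑₂ c +_) (trans (∑₂-+ e _) (cong (∑₂ e +_)
        (trans (∑₂-+ p _) (cong (∑₂ p +_) (∑₂-+ p' b))))))
      parents≤ : ∑₂ p ≤ countB K
      parents≤ = ∑-mono fin λ x → ≤-trans (∑-mono fin λ y → ≤-reflexive (ι-× (T? (K x)) (y ≟ parent x)))
        (≤-trans (≤-reflexive (∑-*ˡ fin (ι (T? (K x))) (λ y → ι (y ≟ parent x))))
          (ι*-once x))
        where
        ι*-once : ∀ x → ι (T? (K x)) * ∑ fin (λ y → ι (y ≟ parent x)) ≤ ι (T? (K x))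
        ι*-once x = ≤-trans (*-monoʳ-≤ (ι (T? (K x)))
          (∑-unique fin (_≟ parent x) (λ a b ea eb → trans ea (sym eb)))) (≤-reflexive (*-identityʳ _))
      parents≤' : ∑₂ p' ≤ countB K
      parents≤' = ≤-trans (≤-reflexive (∑-swap fin fin p')) parents≤
      borders : ∑₂ b ≡ #border * #border
      borders = trans (∑-cong fin λ x → ∑-*ˡ fin (ι (border? x)) (λ y → ι (border? y)))
        (∑-*ʳ fin #border (λ x → ι (border? x)))

    n≤free : n ≤ #free + (countB K + boundary g K)
    n≤free = begin
      n                                     ≡⟨ trans (∑fin-const n 1) (*-identityʳ n) ⟨
      ∑ fin (λ (_ : Fin n) → 1)             ≤⟨ ∑-mono fin pointwise ⟩
      ∑ fin (λ v → ι (free? v) + (ι (T? (K v)) + ι (hit? v)))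
        ≡⟨ trans (∑-+ fin (λ v → ι (free? v)) (λ v → ι (T? (K v)) + ι (hit? v)))
             (cong (#free +_) (∑-+ fin (λ v → ι (T? (K v))) (λ v → ι (hit? v)))) ⟩
      #free + (countB K + ∑ fin (λ v → ι (hit? v))) ≤⟨ +-monoʳ-≤ #free (+-monoʳ-≤ (countB K) hits) ⟩
      #free + (countB K + boundary g K)     ∎
      where
      open ≤-Reasoning
      hit? : ∀ v → Dec (∃[ i ] Exit g K i v)
      hit? v = any? (λ i → exit? g K i v)
      hits : ∑ fin (λ v → ι (hit? v)) ≤ boundary g K
      hits = ≤-trans (∑-mono fin (λ v → ι-≤ (hit? v) (λ (i , e) → ∑-ι-∃ fin (λ i → exit? g K i v) i e)))
        (≤-reflexive (sym (∑-swap fin fin (λ i u → ι (exit? g K i u)))))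
      pointwise : ∀ v → 1 ≤ ι (free? v) + (ι (T? (K v)) + ι (hit? v))
      pointwise v = ≤-trans (ι-≤-+ (yes tt) (free? v) (T? (K v) ⊎-dec hit? v) (λ _ → classify))
        (+-monoʳ-≤ (ι (free? v)) (ι-⊎ (T? (K v)) (hit? v)))
        where
        classify : Free v ⊎ (T (K v) ⊎ (∃[ i ] Exit g K i v))
        classify with T? (K v) | any? (λ i → T? (K i) ×-dec T? (g i v))
        ... | yes kv | _ = inj₂ (inj₁ kv)
        ... | no ¬kv | yes (i , ki , giv) = inj₂ (inj₂ (i , ki , ¬kv , giv))
        ... | no ¬kv | no none = inj₁ (¬kv , none)

    -- The edges xu and yv are the only new exits, and K stays connected because xy is not in the
    -- tree.
    make-move : ∀ {x y u v} → T (K x) → T (K y) → T (g x y) → x ≢ parent y → y ≢ parent x →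
      ¬ T (K u) → ¬ T (K v) → T (g u v) → ¬ T (g x u) → ¬ T (g y v) → Move j K G (x , y , u , v)
    make-move {x} {y} {u} {v} kx ky gxy nx ny ¬ku ¬kv guv ¬gxu ¬gyv =
      re , kx , ky , ¬ku , ¬kv , can , toggle-IsReal G re can , proj₁ (proj₂ st) ,
      proj₁ (proj₂ (proj₂ st)) , proj₁ (proj₂ (proj₂ (proj₂ st))) , exits , spanned'
      where
      separate : ∀ {x u} → T (K x) → ¬ T (K u) → x ≢ u
      separate kx ¬ku refl = ¬ku kx
      can : Switchable g (x , y , u , v)
      can = gxy , guv , ¬gxu , ¬gyv , separate kx ¬ku , separate ky ¬kv
      g' = adj (toggle (x , y , u , v) G)
      sw : Switch g g' x y u v
      sw = toggle-Switch G re can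
      at? : ∀ a b i k → Dec (i ≡ a × k ≡ b)
      at? a b i k = (i ≟ a) ×-dec (k ≟ b)
      once : ∀ a b → ∑₂ (λ i k → ι (at? a b i k)) ≤ 1
      once a b = ∑₂-unique (at? a b) (λ { (refl , refl) (refl , refl) → refl , refl })
      exits : boundary g' K ≤ 2 * suc j
      exits = begin
        boundary g' K ≤⟨ ∑₂-mono pointwise ⟩
        ∑₂ (λ i k → ι (exit? g K i k) + (ι (at? x u i k) + ι (at? y v i k)))
          ≡⟨ trans (∑₂-+ (λ i k → ι (exit? g K i k)) (λ i k → ι (at? x u i k) + ι (at? y v i k)))
               (cong (boundary g K +_) (∑₂-+ (λ i k → ι (at? x u i k)) (λ i k → ι (at? y v i k)))) ⟩
        boundary g K + (∑₂ (λ i k → ι (at? x u i k)) + ∑₂ (λ i k → ι (at? y v i k)))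
          ≤⟨ +-mono-≤ (proj₁ (proj₂ (proj₂ (proj₂ (proj₂ st))))) (+-mono-≤ (once x u) (once y v)) ⟩
        2 * j + 2 ≡⟨ double j ⟩
        2 * suc j ∎
        where
        open ≤-Reasoning
        double : ∀ j → 2 * j + 2 ≡ 2 * suc j
        double = solve-∀
        classify : ∀ i k → Exit g' K i k → Exit g K i k ⊎ ((i ≡ x × k ≡ u) ⊎ (i ≡ y × k ≡ v))
        classify i k (ki , ¬kk , gik) with from sw gik
        ... | inj₁ old = inj₁ (ki , ¬kk , old)
        ... | inj₂ ab = inj₂ (inj₁ (refl , refl))
        ... | inj₂ ba = ⊥-elim (¬ku ki)
        ... | inj₂ cd = inj₂ (inj₂ (refl , refl))
        ... | inj₂ dc = ⊥-elim (¬kv ki)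
        pointwise : ∀ i k → ι (exit? g' K i k) ≤ ι (exit? g K i k) + (ι (at? x u i k) + ι (at? y v i k))
        pointwise i k = ≤-trans
          (ι-≤-+ (exit? g' K i k) (exit? g K i k) (at? x u i k ⊎-dec at? y v i k) (classify i k))
          (+-monoʳ-≤ (ι (exit? g K i k)) (ι-⊎ (at? x u i k) (at? y v i k)))
      spanned' : Spanned g' K r
      spanned' = spanned-without {G = g} {g'} {K} {r} {x} {y} spanned tree nx ny keeps
        where
        keeps : ∀ {i k} → T (K i) → T (K k) → T (g i k) → T (g' i k) ⊎ (i ≡ x × k ≡ y) ⊎ (i ≡ y × k ≡ x)
        keeps ki kk gik with keep sw gik
        ... | inj₁ t = inj₁ t
        ... | inj₂ ab = inj₂ (inj₁ (refl , refl))
        ... | inj₂ ba = inj₂ (inj₂ (refl , refl))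
        ... | inj₂ cd = ⊥-elim (¬ku ki)
        ... | inj₂ dc = ⊥-elim (¬ku kk)

    -- Of the two orientations of a candidate edge at least one is compatible with uv.
    moves : #candidates * #free ≤ 2 * ∑ quads (λ σ → ι (move? j K G σ))
    moves = begin
      #candidates * #free ≡⟨ trans (∑-cong fin λ x → ∑-*ʳ fin #free (λ y → ι (candidate? x y)))
                               (∑-*ʳ fin #free (λ x → ∑ fin (λ y → ι (candidate? x y)))) ⟨
      ∑₂ (λ x y → ι (candidate? x y) * #free) ≤⟨ ∑₂-mono pair ⟩
      ∑₂ (λ x y → m x y + m y x) ≡⟨ ∑₂-+ m (λ x y → m y x) ⟩
      ∑₂ m + ∑₂ (λ x y → m y x) ≡⟨ cong (∑₂ m +_) (trans (∑-swap fin fin (λ x y → m y x)) (sym (+-identityʳ _))) ⟩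
      2 * ∑₂ m ≡⟨ cong (2 *_) (∑-quads (λ σ → ι (move? j K G σ))) ⟨
      2 * ∑ quads (λ σ → ι (move? j K G σ)) ∎
      where
      open ≤-Reasoning
      m : Fin n → Fin n → ℕ
      m x y = ∑₂ (λ u v → ι (move? j K G (x , y , u , v)))
      has-neighbour : ∀ v → ∃[ u ] T (g v u)
      has-neighbour v with any? (λ u → T? (g v u))
      ... | yes h = h
      ... | no none = ⊥-elim (<-irrefl refl (≤-trans (positive v)
              (≤-reflexive (trans (sym (degree re v)) (trans (∑-cong fin λ u → ι-no (T? (g v u)) (λ t → none (u , t)))
                (∑ᴸ-0 (allFin n)))))))
      pair : ∀ x y → ι (candidate? x y) * #free ≤ m x y + m y x
      pair x y = ι*-≤ (candidate? x y) λ (kx , ky , gxy , nx , ny , ¬bb) → begin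
        #free ≤⟨ ∑-mono fin (λ v → ι-≤ (free? v) (λ fv → one kx ky gxy nx ny ¬bb v fv)) ⟩
        ∑ fin (λ v → ∑ fin (λ u → ι (move? j K G (x , y , u , v))) + ∑ fin (λ u → ι (move? j K G (y , x , u , v))))
          ≡⟨ ∑-+ fin (λ v → ∑ fin (λ u → ι (move? j K G (x , y , u , v)))) (λ v → ∑ fin (λ u → ι (move? j K G (y , x , u , v)))) ⟩
        ∑₂ (λ v u → ι (move? j K G (x , y , u , v))) + ∑₂ (λ v u → ι (move? j K G (y , x , u , v)))
          ≡⟨ cong₂ _+_ (∑-swap fin fin (λ v u → ι (move? j K G (x , y , u , v))))
                       (∑-swap fin fin (λ v u → ι (move? j K G (y , x , u , v)))) ⟩
        m x y + m y x ∎
        where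
        one : T (K x) → T (K y) → T (g x y) → x ≢ parent y → y ≢ parent x → ¬ (Border x × Border y) →
          ∀ v → Free v →
          1 ≤ ∑ fin (λ u → ι (move? j K G (x , y , u , v))) + ∑ fin (λ u → ι (move? j K G (y , x , u , v)))
        one kx ky gxy nx ny ¬bb v (¬kv , far) with has-neighbour v
        ... | u , gvu with T? (g x u)
        ...   | no ¬gxu = ≤-trans (∑-ι-∃ fin (λ u → move? j K G (x , y , u , v)) u
                (make-move kx ky gxy nx ny (λ ku → far (u , ku , symm re v u gvu)) ¬kv (symm re v u gvu) ¬gxu
                  (λ gyv → far (y , ky , gyv)))) (m≤m+n _ _)
        ...   | yes gxu = ≤-trans (∑-ι-∃ fin (λ u → move? j K G (y , x , u , v)) u
                (make-move ky kx (symm re x y gxy) ny nx ¬ku ¬kv (symm re v u gvu)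
                  (λ gyu → ¬bb ((u , kx , ¬ku , gxu) , (u , ky , ¬ku , gyu)))
                  (λ gxv → far (x , kx , gxv)))) (m≤n+m _ _)
          where
          ¬ku : ¬ T (K u)
          ¬ku ku = far (u , ku , symm re v u gvu)

    -- P and V are lower bounds for the candidates and the free vertices. The terms added to P are
    -- the losses in `W≤candidates`; those added to V account for K and its outer neighbours.
    many-moves : ∀ {t P V} → j ≤ t → Q * (P + (2 * t + (S + (S + (2 * t) * (2 * t))))) ≤ M D →
      V + (S + 2 * t) ≤ n → P * V ≤ 2 * ∑ quads (λ σ → ι (move? j K G σ))
    many-moves {t} {P} {V} j≤t enough room = ≤-trans (*-mono-≤ P≤ V≤) moves
      where
      open ≤-Reasoning
      size≤ : countB K ≤ S
      size≤ = proj₁ (proj₂ (proj₂ (proj₂ st)))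
      boundary≤ : boundary g K ≤ 2 * t
      boundary≤ = ≤-trans (proj₁ (proj₂ (proj₂ (proj₂ (proj₂ st))))) (*-monoʳ-≤ 2 j≤t)
      border≤ = ≤-trans border≤boundary boundary≤
      P≤ : P ≤ #candidates
      P≤ = +-cancelʳ-≤ (2 * t + (S + (S + (2 * t) * (2 * t)))) P #candidates (begin
        P + (2 * t + (S + (S + (2 * t) * (2 * t))))
          ≤⟨ *-cancelˡ-≤ Q (≤-trans enough (proj₁ (proj₂ st))) ⟩
        W D K ≤⟨ W≤candidates ⟩
        #candidates + (boundary g K + (countB K + (countB K + #border * #border)))
          ≤⟨ +-monoʳ-≤ #candidates (+-mono-≤ boundary≤ (+-mono-≤ size≤ (+-mono-≤ size≤ (*-mono-≤ border≤ border≤)))) ⟩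
        #candidates + (2 * t + (S + (S + (2 * t) * (2 * t)))) ∎)
      V≤ : V ≤ #free
      V≤ = +-cancelʳ-≤ (S + 2 * t) V #free
        (≤-trans room (≤-trans n≤free (+-monoʳ-≤ #free (+-mono-≤ size≤ boundary≤))))

  -- To undo a move with K known it is enough to name the exits xu and yv, in order.
  few-reversals : ∀ j K G → ∑ quads (λ σ → ι (move? j K (toggle σ G) σ)) ≤
    ι (state? (suc j) (adj G) K) * ((2 * suc j) * (2 * suc j))
  few-reversals j K G = go (state? (suc j) (adj G) K)
    where
    open ≤-Reasoning
    g = adj G
    e : Fin n → Fin n → ℕ
    e x u = ι (exit? g K x u)
    back : ∀ {x y u v} → Move j K (toggle (x , y , u , v) G) (x , y , u , v) →
      State (suc j) g K × Exit g K x u × Exit g K y v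
    back {x} {y} {u} {v} (re , kx , ky , ¬ku , ¬kv , can , st') =
      subst (λ H → State (suc j) (adj H) K) (toggle-involutive _ G) st' ,
      (kx , ¬ku , appears ab) , (ky , ¬kv , appears cd)
      where
      appears : ∀ {i k} → Among x u y v i k → T (g i k)
      appears {i} {k} am = subst (λ H → T (adj H i k)) (toggle-involutive _ G)
        (new (toggle-Switch (toggle (x , y , u , v) G) re can) am)
    go : (d : Dec (State (suc j) g K)) → ∑ quads (λ σ → ι (move? j K (toggle σ G) σ)) ≤
      ι d * ((2 * suc j) * (2 * suc j))
    go (no ¬st) = ≤-trans (≤-reflexive (∑-cong (quads {n}) (λ σ@(x , y , u , v) →
      ι-no (move? j K (toggle σ G) σ) (λ mv → ¬st (proj₁ (back {x} {y} {u} {v} mv))))))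
      (≤-reflexive (∑ᴸ-0 (elems (quads {n}))))
    go (yes st) = begin
      ∑ quads (λ σ → ι (move? j K (toggle σ G) σ)) ≡⟨ ∑-quads (λ σ → ι (move? j K (toggle σ G) σ)) ⟩
      ∑₂ (λ x y → ∑₂ (λ u v → ι (move? j K (toggle (x , y , u , v) G) (x , y , u , v))))
        ≤⟨ ∑₂-mono (λ x y → ∑₂-mono (λ u v → pointwise x y u v)) ⟩
      ∑₂ (λ x y → ∑₂ (λ u v → e x u * e y v))
        ≡⟨ ∑-cong fin (λ x → ∑-cong fin (λ y → trans (∑-cong fin (λ u → ∑-*ˡ fin (e x u) (e y)))
             (∑-*ʳ fin (∑ fin (e y)) (e x)))) ⟩
      ∑₂ (λ x y → ∑ fin (e x) * ∑ fin (e y))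
        ≡⟨ trans (∑-cong fin (λ x → ∑-*ˡ fin (∑ fin (e x)) (λ y → ∑ fin (e y))))
             (∑-*ʳ fin (∑₂ e) (λ x → ∑ fin (e x))) ⟩
      ∑₂ e * ∑₂ e ≤⟨ *-mono-≤ few few ⟩
      (2 * suc j) * (2 * suc j) ≡⟨ *-identityˡ _ ⟨
      1 * ((2 * suc j) * (2 * suc j)) ∎
      where
      few : ∑₂ e ≤ 2 * suc j
      few = proj₁ (proj₂ (proj₂ (proj₂ (proj₂ st))))
      pointwise : ∀ x y u v → ι (move? j K (toggle (x , y , u , v) G) (x , y , u , v)) ≤ e x u * e y v
      pointwise x y u v = ≤-trans (ι-mono (move? j K (toggle (x , y , u , v) G) (x , y , u , v))
          (exit? g K x u ×-dec exit? g K y v) (λ mv → proj₂ (back {x} {y} {u} {v} mv)))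
        (≤-reflexive (ι-× (exit? g K x u) (exit? g K y v)))

  #states : ℕ → ℕ
  #states j = ∑ subsets λ K → ∑ graphs λ G → ι (state? j (adj G) (lookup K))

  states-step : ∀ {j t P V} → j ≤ t → Q * (P + (2 * t + (S + (S + (2 * t) * (2 * t))))) ≤ M D →
    V + (S + 2 * t) ≤ n → (P * V) * #states j ≤ 2 * ((2 * suc j) * (2 * suc j)) * #states (suc j)
  states-step {j} {t} {P} {V} j≤t enough room = begin
    (P * V) * #states j ≡⟨ ∑-*ˡ subsets (P * V) (λ K → ∑ graphs λ G → ι (state? j (adj G) (lookup K))) ⟨
    ∑ subsets (λ K → (P * V) * ∑ graphs (λ G → ι (state? j (adj G) (lookup K)))) ≤⟨ ∑-mono subsets per-K ⟩
    ∑ subsets (λ K → 2 * ((2 * suc j) * (2 * suc j)) * ∑ graphs (λ G → ι (state? (suc j) (adj G) (lookup K))))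
      ≡⟨ ∑-*ˡ subsets (2 * ((2 * suc j) * (2 * suc j))) (λ K → ∑ graphs λ G → ι (state? (suc j) (adj G) (lookup K))) ⟩
    2 * ((2 * suc j) * (2 * suc j)) * #states (suc j) ∎
    where
    open ≤-Reasoning
    c = (2 * suc j) * (2 * suc j)
    per-K : ∀ L → (P * V) * ∑ graphs (λ G → ι (state? j (adj G) (lookup L))) ≤
      2 * c * ∑ graphs (λ G → ι (state? (suc j) (adj G) (lookup L)))
    per-K L = begin
      (P * V) * ∑ graphs (λ G → ι (state? j (adj G) K)) ≡⟨ ∑-*ˡ graphs (P * V) (λ G → ι (state? j (adj G) K)) ⟨
      ∑ graphs (λ G → (P * V) * ι (state? j (adj G) K)) ≤⟨ ∑-mono graphs (λ G → ≤-trans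
          (≤-reflexive (*-comm (P * V) (ι (state? j (adj G) K))))
          (ι*-≤ (state? j (adj G) K) (λ st → many-moves j G K st (parents {G = adj G} (proj₂ (proj₂ (proj₂ (proj₂ (proj₂ st)))))) {t} {P} {V} j≤t enough room))) ⟩
      ∑ graphs (λ G → 2 * ∑ quads (λ σ → ι (move? j K G σ)))
        ≡⟨ ∑-*ˡ graphs 2 (λ G → ∑ quads (λ σ → ι (move? j K G σ))) ⟩
      2 * ∑ graphs (λ G → ∑ quads (λ σ → ι (move? j K G σ)))
        ≤⟨ *-monoʳ-≤ 2 (switch-count (λ G → ι (state? (suc j) (adj G) K) * c) (move? j K) (few-reversals j K)) ⟩
      2 * ∑ graphs (λ G → ι (state? (suc j) (adj G) K) * c)
        ≡⟨ cong (2 *_) (∑-*ʳ graphs c (λ G → ι (state? (suc j) (adj G) K))) ⟩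
      2 * (∑ graphs (λ G → ι (state? (suc j) (adj G) K)) * c) ≡⟨ rearrange (∑ graphs (λ G → ι (state? (suc j) (adj G) K))) c ⟩
      2 * c * ∑ graphs (λ G → ι (state? (suc j) (adj G) K)) ∎
      where
      K = lookup L
      rearrange : ∀ a c → 2 * (a * c) ≡ 2 * c * a
      rearrange = solve-∀

  states-chain : ∀ {t P V} → Q * (P + (2 * t + (S + (S + (2 * t) * (2 * t))))) ≤ M D →
    V + (S + 2 * t) ≤ n → ∀ j → j ≤ t → (P * V) ^ j * #states 0 ≤ reversals j * #states j
  states-chain enough room zero j≤t = ≤-refl
  states-chain {t} {P} {V} enough room (suc j) j<t = begin
    (P * V) * (P * V) ^ j * #states 0               ≡⟨ *-assoc (P * V) _ _ ⟩
    (P * V) * ((P * V) ^ j * #states 0)             ≤⟨ *-monoʳ-≤ (P * V) (states-chain {t} {P} {V} enough room j (<⇒≤ j<t)) ⟩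
    (P * V) * (reversals j * #states j)             ≡⟨ swap (P * V) (reversals j) (#states j) ⟩
    reversals j * ((P * V) * #states j)             ≤⟨ *-monoʳ-≤ (reversals j) (states-step {j} {t} {P} {V} (<⇒≤ j<t) enough room) ⟩
    reversals j * (2 * ((2 * suc j) * (2 * suc j)) * #states (suc j)) ≡⟨ *-assoc (reversals j) _ _ ⟨
    reversals (suc j) * #states (suc j)             ∎
    where
    open ≤-Reasoning
    swap : ∀ a b c → a * (b * c) ≡ b * (a * c)
    swap = solve-∀

  #real : ℕ
  #real = ∑ graphs (λ G → ι (isReal? {D = D} (adj G)))

  -- The price of having carried K along: it is forgotten again by counting all pieces of each
  -- graph.
  states-bound : ∀ j → #states j ≤ pascal S (2 * j) * #real
  states-bound j = begin
    #states j ≡⟨ ∑-swap subsets graphs (λ K G → ι (state? j (adj G) (lookup K))) ⟩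
    ∑ graphs (λ G → ∑ subsets (λ K → ι (state? j (adj G) (lookup K)))) ≤⟨ ∑-mono graphs per-graph ⟩
    ∑ graphs (λ G → ι (isReal? {D = D} (adj G)) * pascal S (2 * j))
      ≡⟨ trans (∑-*ʳ graphs (pascal S (2 * j)) (λ G → ι (isReal? {D = D} (adj G)))) (*-comm #real _) ⟩
    pascal S (2 * j) * #real ∎
    where
    open ≤-Reasoning
    per-graph : ∀ G → ∑ subsets (λ K → ι (state? j (adj G) (lookup K))) ≤
      ι (isReal? {D = D} (adj G)) * pascal S (2 * j)
    per-graph G = begin
      ∑ subsets (λ K → ι (state? j (adj G) (lookup K)))
        ≤⟨ ∑-mono subsets (λ K → ≤-trans
             (ι-mono (state? j (adj G) (lookup K)) (isReal? (adj G) ×-dec piece K)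
               (λ (re , _ , pc) → re , pc))
             (≤-reflexive (ι-× (isReal? {D = D} (adj G)) (piece K)))) ⟩
      ∑ subsets (λ K → ι (isReal? {D = D} (adj G)) * ι (piece K))
        ≡⟨ ∑-*ˡ subsets (ι (isReal? {D = D} (adj G))) (λ K → ι (piece K)) ⟩
      ι (isReal? {D = D} (adj G)) * ∑ subsets (λ K → ι (piece K))
        ≤⟨ *-monoʳ-≤ (ι (isReal? {D = D} (adj G))) (pieces-bound r S (2 * j) (adj G)) ⟩
      ι (isReal? {D = D} (adj G)) * pascal S (2 * j) ∎
      where
      piece : (K : Subset n) → Dec (Piece r S (2 * j) (adj G) (lookup K))
      piece K = piece? r S (2 * j) (adj G) (lookup K)

Small : ∀ {n} → (Fin n → ℕ) → Fin n → (Q s : ℕ) → Adj n → Set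
Small D r Q s G = IsReal D G × countB (conn G r) ≤ s × M D ≤ Q * W D (conn G r)

small? : ∀ {n} (D : Fin n → ℕ) r Q s G → Dec (Small D r Q s G)
small? D r Q s G = isReal? G ×-dec (countB (conn G r) ≤? s) ×-dec (M D ≤? Q * W D (conn G r))

#small : ∀ {n} → (Fin n → ℕ) → Fin n → (Q s : ℕ) → ℕ
#small D r Q s = ∑ graphs (λ G → ι (small? D r Q s (adj G)))

W-cong : ∀ {n} (D : Fin n → ℕ) {K L : Fin n → Bool} → (∀ i → K i ≡ L i) → W D K ≡ W D L
W-cong D e = ∑-cong fin (λ i → cong (λ b → if b then wt D i else 0) (e i))

module _ {n : ℕ} (D : Fin n → ℕ) (positive : IsDegreeSequence D) (r : Fin n) (Q-1 S : ℕ) where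
  open Dense D positive r Q-1 S

  -- The component of r itself is a piece without boundary.
  small≤states : #small D r (suc Q-1) S ≤ #states 0
  small≤states = ≤-trans (∑-mono graphs λ G → ι-≤ (small? D r (suc Q-1) S (adj G))
      (λ sm → ∑-ι-∃ subsets (λ K → state? 0 (adj G) (lookup K)) (component G) (start G sm)))
    (≤-reflexive (∑-swap graphs subsets (λ G K → ι (state? 0 (adj G) (lookup K)))))
    where
    component : Graph n → Subset n
    component G = tabulate (conn (adj G) r)
    start : ∀ G → Small D r (suc Q-1) S (adj G) → State 0 (adj G) (lookup (component G))
    start G (re , size , heavy) = re ,
      ≤-trans heavy (≤-reflexive (cong (suc Q-1 *_) (sym (W-cong D same)))) ,
      subst T (sym (same r)) (conn-refl g r) ,
      ≤-trans (≤-reflexive (countB-cong same)) size ,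
      ≤-reflexive (trans (∑-cong fin λ i → trans (∑-cong fin λ u → ι-no (exit? g K i u) (no-exit i u)) (∑ᴸ-0 (allFin n)))
        (∑ᴸ-0 (allFin n))) ,
      λ w kw → conn-least (λ i k ci h → conn-closed (restrict g K) r i k ci (widen i k h))
        (conn-refl (restrict g K) r) (conn-Spanned g r w (subst T (same w) kw))
      where
      g = adj G
      K = lookup (component G)
      same : ∀ i → K i ≡ conn g r i
      same i = lookup∘tabulate (conn g r) i
      no-exit : ∀ i u → ¬ Exit g K i u
      no-exit i u (ki , ¬ku , giu) = ¬ku (subst T (sym (same u)) (conn-closed g r i u (subst T (same i) ki) giu))
      widen : ∀ i k → T (restrict g (conn g r) i k) → T (restrict g K i k)
      widen i k t = let ci , ck , h = restrict⁻ {G = g} {conn g r} {i} {k} t in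
        restrict⁺ {G = g} {K} (subst T (sym (same i)) ci) (subst T (sym (same k)) ck) h

  dense-bound : ∀ {t P V} → suc Q-1 * (P + (2 * t + (S + (S + (2 * t) * (2 * t))))) ≤ M D →
    V + (S + 2 * t) ≤ n →
    (P * V) ^ t * #small D r (suc Q-1) S ≤ reversals t * (pascal S (2 * t) * #real)
  dense-bound {t} {P} {V} enough room = ≤-trans (*-monoʳ-≤ ((P * V) ^ t) small≤states)
    (≤-trans (states-chain {t} {P} {V} enough room t ≤-refl) (*-monoʳ-≤ (reversals t) (states-bound t)))

-- Merging a short cyclic component into the component of r

module _ {n : ℕ} where

  handshake : (f : Fin n → Fin n → ℕ) → (∀ i j → f i j ≡ f j i) → (∀ i → f i i ≡ 0) →
    ∃[ e ] ∑₂ f ≡ 2 * e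
  handshake f f-sym f-diag = ∑₂ below , (begin
    ∑₂ f                                  ≡⟨ ∑-cong fin (λ i → ∑-cong fin (λ j → pointwise i j)) ⟩
    ∑₂ (λ i j → below i j + below j i)    ≡⟨ ∑₂-+ below (λ i j → below j i) ⟩
    ∑₂ below + ∑₂ (λ i j → below j i)     ≡⟨ cong (∑₂ below +_) (trans (∑-swap fin fin (λ i j → below j i)) (sym (+-identityʳ _))) ⟩
    2 * ∑₂ below                          ∎)
    where
    open ≡-Reasoning
    below : Fin n → Fin n → ℕ
    below i j = ι (i <F? j) * f i j
    pointwise : ∀ i j → f i j ≡ below i j + below j i
    pointwise i j with <F-cmp i j
    ... | tri< i<j _ ¬j<i = sym (trans (cong₂ _+_
            (trans (cong (_* f i j) (ι-yes (i <F? j) i<j)) (*-identityˡ _)) (cong (_* f j i) (ι-no (j <F? i) ¬j<i)))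
            (+-identityʳ _))
    ... | tri≈ ¬i<i refl _ = trans (f-diag i) (sym (cong₂ _+_ (cong (_* f i i) (ι-no (i <F? i) ¬i<i))
            (cong (_* f i i) (ι-no (i <F? i) ¬i<i))))
    ... | tri> ¬i<j _ j<i = sym (cong₂ _+_ (cong (_* f i j) (ι-no (i <F? j) ¬i<j))
            (trans (cong (_* f j i) (ι-yes (j <F? i) j<i)) (trans (*-identityˡ _) (f-sym j i))))

  -- An edge pq of a 2-regular component is no bridge, since the side of p would have odd degree sum.
  no-bridge : {D : Fin n → ℕ} {g : Adj n} (re : IsReal D g) {U : Fin n → Bool} → Closed g U →
    (∀ i → T (U i) → D i ≡ 2) → ∀ {p q} → T (U p) → T (g p q) →
    (A : Fin n → Bool) → (∀ {i j} → T (A i) → T (U i) → T (g i j) → T (A j) ⊎ Among p q p q i j) →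
    T (A p) → T (A q)
  no-bridge {D} {g} re {U} U-closed two {p} {q} up gpq A A-closed ap with T? (A q)
  ... | yes aq = aq
  ... | no ¬aq = ⊥-elim (even≢odd (countB B) (proj₁ hs) (begin
      -- The degree sum of B counts the edges inside B from both ends and pq once, so it would be
      -- odd.
      2 * countB B                          ≡⟨ ∑-*ˡ fin 2 (λ i → ι (T? (B i))) ⟨
      ∑ fin (λ i → 2 * ι (T? (B i)))        ≡⟨ ∑-cong fin row ⟩
      ∑₂ (λ i j → inside i j + ι (bridge? i j)) ≡⟨ ∑₂-+ inside (λ i j → ι (bridge? i j)) ⟩
      ∑₂ inside + ∑₂ (λ i j → ι (bridge? i j)) ≡⟨ cong₂ _+_ (proj₂ hs) once ⟩
      2 * proj₁ hs + 1                      ≡⟨ +-comm _ 1 ⟩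
      suc (2 * proj₁ hs)                    ∎))
    where
    open ≡-Reasoning
    B : Fin n → Bool
    B i = A i ∧ U i
    inside? : ∀ i j → Dec (T (B i) × T (B j) × T (g i j))
    inside? i j = T? (B i) ×-dec T? (B j) ×-dec T? (g i j)
    inside : Fin n → Fin n → ℕ
    inside i j = ι (inside? i j)
    bridge? : ∀ i j → Dec (i ≡ p × j ≡ q)
    bridge? i j = (i ≟ p) ×-dec (j ≟ q)
    hs = handshake inside
      (λ i j → ι-cong (inside? i j) (inside? j i) (λ (bi , bj , h) → bj , bi , symm re i j h) (λ (bi , bj , h) → bj , bi , symm re j i h))
      (λ i → ι-no (inside? i i) (λ (_ , _ , h) → irrefl re i h))
    once : ∑₂ (λ i j → ι (bridge? i j)) ≡ 1
    once = ≤-antisym (∑₂-unique bridge? (λ { (refl , refl) (refl , refl) → refl , refl }))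
      (≤-trans (∑-ι-∃ fin (bridge? p) q (refl , refl)) (∑-∈ fin (λ i → ∑ fin (λ j → ι (bridge? i j))) p))
    edge : ∀ i j → T (B i) → ι (T? (g i j)) ≡ inside i j + ι (bridge? i j)
    edge i j bi with T? (g i j)
    ... | no ¬h = trans (ι-no (T? (g i j)) ¬h) (sym (cong₂ _+_ (ι-no (inside? i j) (λ (_ , _ , h) → ¬h h))
          (ι-no (bridge? i j) (λ { (refl , refl) → ¬h gpq }))))
    ... | yes h with T-∧⁻ {A i} bi
    ...   | ai , ui with A-closed ai ui h
    ...     | inj₁ aj = trans (ι-yes (T? (g i j)) h) (sym (cong₂ _+_ (ι-yes (inside? i j) (bi , T-∧⁺ aj (U-closed i j ui h) , h))
              (ι-no (bridge? i j) (λ { (refl , refl) → ¬aq aj }))))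
    ...     | inj₂ ab = trans (ι-yes (T? (g i j)) h) (sym (cong₂ _+_ (ι-no (inside? i j) (λ (_ , bj , _) → ¬aq (proj₁ (T-∧⁻ bj))))
              (ι-yes (bridge? i j) (refl , refl))))
    ...     | inj₂ cd = trans (ι-yes (T? (g i j)) h) (sym (cong₂ _+_ (ι-no (inside? i j) (λ (_ , bj , _) → ¬aq (proj₁ (T-∧⁻ bj))))
              (ι-yes (bridge? i j) (refl , refl))))
    ...     | inj₂ ba = ⊥-elim (¬aq ai)
    ...     | inj₂ dc = ⊥-elim (¬aq ai)
    row : ∀ i → 2 * ι (T? (B i)) ≡ ∑ fin (λ j → inside i j + ι (bridge? i j))
    row i = by-cases (T? (B i))
      where
      by-cases : Dec (T (B i)) → 2 * ι (T? (B i)) ≡ ∑ fin (λ j → inside i j + ι (bridge? i j))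
      by-cases (yes bi) = begin
        2 * ι (T? (B i)) ≡⟨ cong (2 *_) (ι-yes (T? (B i)) bi) ⟩
        2 ≡⟨ trans (degree re i) (two i (proj₂ (T-∧⁻ {A i} bi))) ⟨
        ∑ fin (λ j → ι (T? (g i j))) ≡⟨ ∑-cong fin (λ j → edge i j bi) ⟩
        ∑ fin (λ j → inside i j + ι (bridge? i j)) ∎
      by-cases (no ¬bi) = trans (cong (2 *_) (ι-no (T? (B i)) ¬bi)) (sym (trans (∑-cong fin (λ j →
        cong₂ _+_ (ι-no (inside? i j) (λ (bi , _) → ¬bi bi)) (ι-no (bridge? i j) (λ { (refl , refl) → ¬bi (T-∧⁺ ap up) }))))
        (∑ᴸ-0 (allFin n))))

  W-mono : (D : Fin n → ℕ) {K L : Fin n → Bool} → (∀ i → T (K i) → T (L i)) → W D K ≤ W D L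
  W-mono D {K} {L} h = ∑-mono fin pointwise
    where
    pointwise : ∀ i → (if K i then wt D i else 0) ≤ (if L i then wt D i else 0)
    pointwise i with T? (K i)
    ... | no ¬k rewrite T-false ¬k = z≤n
    ... | yes k rewrite T-true k | T-true (h i k) = ≤-refl

module Sparse {n : ℕ} (D : Fin n → ℕ) (r : Fin n) (Q : ℕ) where

  -- An oriented edge of a cyclic component of order at most h that avoids r.
  Ring : ℕ → Adj n → Fin n → Fin n → Set
  Ring h g u v = T (g u v) × ¬ T (conn g r u) × (∀ w → T (conn g u w) → D w ≡ 2) × countB (conn g u) ≤ h

  ring? : ∀ h g u v → Dec (Ring h g u v)
  ring? h g u v = T? (g u v) ×-dec ¬? (T? (conn g r u)) ×-dec
    all? (λ w → T? (conn g u w) →-dec (D w ℕ.≟ 2)) ×-dec (countB (conn g u) ≤? h)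

  Stem : Adj n → Fin n → Fin n → Set
  Stem g x y = T (conn g r x) × D x ≢ 2 × T (g x y)

  stem? : ∀ g x y → Dec (Stem g x y)
  stem? g x y = T? (conn g r x) ×-dec ¬? (D x ℕ.≟ 2) ×-dec T? (g x y)

  -- Removing xy and uv and adding xu and yv opens the ring at uv and inserts it into the edge xy.
  Join : (s h : ℕ) → Graph n → Quad → Set
  Join s h G (x , y , u , v) = Small D r Q s (adj G) × Stem (adj G) x y × Ring h (adj G) u v

  join? : ∀ s h G σ → Dec (Join s h G σ)
  join? s h G (x , y , u , v) = small? D r Q s (adj G) ×-dec stem? (adj G) x y ×-dec ring? h (adj G) u v

  W≤stems : ∀ {g} → IsReal D g → W D (conn g r) ≤ ∑₂ (λ x y → ι (stem? g x y))
  W≤stems {g} re = ∑-mono fin λ x → by-cases x (T? (conn g r x)) (D x ℕ.≟ 2)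
    where
    by-cases : ∀ x → Dec (T (conn g r x)) → Dec (D x ≡ 2) →
      (if conn g r x then wt D x else 0) ≤ ∑ fin (λ y → ι (stem? g x y))
    by-cases x (no ¬c) _ rewrite T-false ¬c = z≤n
    by-cases x (yes c) (yes e) rewrite T-true c | e = z≤n
    by-cases x (yes c) (no ne) = begin
      (if conn g r x then wt D x else 0) ≡⟨ cong (λ b → if b then wt D x else 0) (T-true c) ⟩
      wt D x                             ≡⟨ wt-≢2 {D = D} ne ⟩
      D x                                ≡⟨ degree re x ⟨
      deg g x                            ≤⟨ ∑-mono fin (λ y → ι-mono (T? (g x y)) (stem? g x y) (λ h → c , ne , h)) ⟩
      ∑ fin (λ y → ι (stem? g x y))      ∎
      where open ≤-Reasoning

  module Joined {s h x y u v} (G : Graph n) (jn : Join s h G (x , y , u , v)) where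
    g = adj G
    g' = adj (toggle (x , y , u , v) G)
    K = conn g r
    U = conn g u
    re : IsReal D g
    re = proj₁ (proj₁ jn)
    kx : T (K x)
    kx = proj₁ (proj₁ (proj₂ jn))
    Dx : D x ≢ 2
    Dx = proj₁ (proj₂ (proj₁ (proj₂ jn)))
    gxy : T (g x y)
    gxy = proj₂ (proj₂ (proj₁ (proj₂ jn)))
    ky : T (K y)
    ky = conn-closed g r x y kx gxy
    guv : T (g u v)
    guv = proj₁ (proj₂ (proj₂ jn))
    ¬ku : ¬ T (K u)
    ¬ku = proj₁ (proj₂ (proj₂ (proj₂ jn)))
    two : ∀ w → T (U w) → D w ≡ 2
    two = proj₁ (proj₂ (proj₂ (proj₂ (proj₂ jn))))
    uu : T (U u)
    uu = conn-refl g u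
    uv : T (U v)
    uv = conn-closed g u u v uu guv
    disjoint : ∀ {w} → T (K w) → ¬ T (U w)
    disjoint kw uw = ¬ku (conn-trans g kw (conn-sym g (symm re) uw))
    ¬kv : ¬ T (K v)
    ¬kv kv = disjoint kv uv

    swappable : Switchable g (x , y , u , v)
    swappable = gxy , guv , (λ gxu → ¬ku (conn-closed g r x u kx gxu)) , (λ gyv → ¬kv (conn-closed g r y v ky gyv)) ,
      (λ { refl → ¬ku kx }) , (λ { refl → ¬kv ky })

    sw : Switch g g' x y u v
    sw = toggle-Switch G re swappable

    re' : IsReal D g'
    re' = toggle-IsReal G re swappable

    -- Since uv is no bridge, a set that spreads along all other edges of the ring gets from u to v
    -- and back.
    around : (A : Fin n → Bool) → (∀ {i j} → T (A i) → T (U i) → T (g i j) → T (A j) ⊎ Among u v u v i j) →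
      (T (A u) → T (A v)) × (T (A v) → T (A u))
    around A cl = no-bridge re (conn-closed g u) two uu guv A cl ,
      no-bridge re (conn-closed g u) two uv (symm re u v guv) A (λ ai ui h → flip (cl ai ui h))
      where
      flip : ∀ {i j} → T (A j) ⊎ Among u v u v i j → T (A j) ⊎ Among v u v u i j
      flip (inj₁ a) = inj₁ a
      flip (inj₂ ab) = inj₂ ba
      flip (inj₂ ba) = inj₂ ab
      flip (inj₂ cd) = inj₂ ba
      flip (inj₂ dc) = inj₂ ab

    -- The lost edge xy is replaced by the detour from x to u, round the ring to v, and on to y.
    joined-⊇ : ∀ {w} → T (K w) → T (conn g' r w)
    joined-⊇ {w} kw = proj₁ (T-∧⁻ {C w} (conn-least closed (T-∧⁺ (conn-refl g' r) (conn-refl g r)) kw))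
      where
      C = conn g' r
      C-edge : ∀ {i j} → T (C i) → T (g' i j) → T (C j)
      C-edge {i} {j} ci e = conn-closed g' r i j ci e
      loop = around C C-closed
        where
        C-closed : ∀ {i j} → T (C i) → T (U i) → T (g i j) → T (C j) ⊎ Among u v u v i j
        C-closed ci ui h with keep sw h
        ... | inj₁ e = inj₁ (C-edge ci e)
        ... | inj₂ ab = ⊥-elim (disjoint kx ui)
        ... | inj₂ ba = ⊥-elim (disjoint ky ui)
        ... | inj₂ cd = inj₂ ab
        ... | inj₂ dc = inj₂ ba
      closed : Closed g (λ i → C i ∧ K i)
      closed i j t h with T-∧⁻ {C i} t
      ... | ci , ki with keep sw h
      ...   | inj₁ e = T-∧⁺ (C-edge ci e) (conn-closed g r i j ki h)
      ...   | inj₂ ab = T-∧⁺ (C-edge (proj₁ loop (C-edge ci (new sw ab))) (new sw dc)) ky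
      ...   | inj₂ ba = T-∧⁺ (C-edge (proj₂ loop (C-edge ci (new sw cd))) (new sw ba)) kx
      ...   | inj₂ cd = ⊥-elim (¬ku ki)
      ...   | inj₂ dc = ⊥-elim (¬kv ki)

    v-joined : T (conn g' r v)
    v-joined = conn-closed g' r y v (joined-⊇ ky) (new sw cd)

    joined-⊆ : ∀ {w} → T (conn g' r w) → T (K w ∨ U w)
    joined-⊆ = conn-least closed (T-∨ˡ (conn-refl g r))
      where
      closed : Closed g' (λ i → K i ∨ U i)
      closed i j t e with from sw e
      ... | inj₁ h = [ (λ ki → T-∨ˡ (conn-closed g r i j ki h)) , (λ ui → T-∨ʳ {K j} (conn-closed g u i j ui h)) ]′ (T-∨⁻ {K i} t)
      ... | inj₂ ab = T-∨ʳ {K u} uu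
      ... | inj₂ ba = T-∨ˡ kx
      ... | inj₂ cd = T-∨ʳ {K v} uv
      ... | inj₂ dc = T-∨ˡ ky

    joined-small : Small D r Q (s + h) g'
    joined-small = re' , size , ≤-trans (proj₂ (proj₂ (proj₁ jn))) (*-monoʳ-≤ Q (W-mono D (λ i → joined-⊇ {i})))
      where
      open ≤-Reasoning
      size : countB (conn g' r) ≤ s + h
      size = begin
        countB (conn g' r) ≤⟨ ∑-mono fin (λ i → ι-≤-+ (T? (conn g' r i)) (T? (K i)) (T? (U i)) (λ t → T-∨⁻ {K i} (joined-⊆ t))) ⟩
        ∑ fin (λ i → ι (T? (K i)) + ι (T? (U i))) ≡⟨ ∑-+ fin (λ i → ι (T? (K i))) (λ i → ι (T? (U i))) ⟩
        countB K + countB U ≤⟨ +-mono-≤ (proj₁ (proj₂ (proj₁ jn))) (proj₂ (proj₂ (proj₂ (proj₂ (proj₂ jn))))) ⟩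
        s + h ∎

    ¬U-x : ¬ T (U x)
    ¬U-x = disjoint kx
    ¬U-y : ¬ T (U y)
    ¬U-y = disjoint ky

    ring-exits : ∀ {i j} → T (U i) → T (g' i j) → T (U j) ⊎ (i ≡ u × j ≡ x) ⊎ (i ≡ v × j ≡ y)
    ring-exits {i} {j} ui e with from sw e
    ... | inj₁ h = inj₁ (conn-closed g u i j ui h)
    ... | inj₂ ab = ⊥-elim (¬U-x ui)
    ... | inj₂ ba = inj₂ (inj₁ (refl , refl))
    ... | inj₂ cd = ⊥-elim (¬U-y ui)
    ... | inj₂ dc = inj₂ (inj₂ (refl , refl))

    -- The ring without uv still joins v to u, by `around`, and hence to all its vertices.
    ring-spanned : (A : Fin n → Bool) → T (A v) → (∀ {i j} → T (A i) → T (U i) → T (U j) → T (g' i j) → T (A j)) →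
      ∀ {w} → T (U w) → T (A w)
    ring-spanned A av cl {w} uw = proj₁ (T-∧⁻ {A w} (conn-least closed (T-∧⁺ av uv)
      (subst T (conn-same g (symm re) uv w) uw)))
      where
      a-edge : ∀ {i j} → T (A i) → T (U i) → T (g i j) → T (A j) ⊎ Among u v u v i j
      a-edge {i} {j} ai ui h with keep sw h
      ... | inj₁ e = inj₁ (cl ai ui (conn-closed g u i j ui h) e)
      ... | inj₂ ab = ⊥-elim (¬U-x ui)
      ... | inj₂ ba = ⊥-elim (¬U-y ui)
      ... | inj₂ cd = inj₂ ab
      ... | inj₂ dc = inj₂ ba
      au = proj₂ (around A a-edge) av
      closed : Closed g (λ i → A i ∧ U i)
      closed i j t h with T-∧⁻ {A i} t
      ... | ai , ui with a-edge ai ui h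
      ...   | inj₁ aj = T-∧⁺ aj (conn-closed g u i j ui h)
      ...   | inj₂ ab = T-∧⁺ av uv
      ...   | inj₂ ba = T-∧⁺ au uu
      ...   | inj₂ cd = T-∧⁺ av uv
      ...   | inj₂ dc = T-∧⁺ au uu

  -- In the merged graph the former ring is recovered from (v , y) by walking back to the
  -- first vertex of degree other than 2.
  joins-injective : ∀ {s h} (G : Graph n) {x y u v x₂ u₂} →
    Join s h (toggle (x , y , u , v) G) (x , y , u , v) →
    Join s h (toggle (x₂ , y , u₂ , v) G) (x₂ , y , u₂ , v) → x ≡ x₂ × u ≡ u₂
  joins-injective {s} {h} G {x} {y} {u} {v} {x₂} {u₂} j₁ j₂ with exits (⊆₂ J₁.uu) back
    where
    module J₁ = Joined (toggle (x , y , u , v) G) j₁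
    module J₂ = Joined (toggle (x₂ , y , u₂ , v) G) j₂
    restore₁ : ∀ {i j} → J₁.g' i j ≡ adj G i j
    restore₁ {i} {j} = cong (λ H → adj H i j) (toggle-involutive (x , y , u , v) G)
    restore₂ : ∀ {i j} → J₂.g' i j ≡ adj G i j
    restore₂ {i} {j} = cong (λ H → adj H i j) (toggle-involutive (x₂ , y , u₂ , v) G)
    exits : ∀ {i j} → T (J₂.U i) → T (adj G i j) → T (J₂.U j) ⊎ (i ≡ u₂ × j ≡ x₂) ⊎ (i ≡ v × j ≡ y)
    exits {i} {j} ui e = J₂.ring-exits ui (subst T (sym (restore₂ {i} {j})) e)
    -- Inside the first ring one cannot leave the second: its exits lead to x₂, whose degree is not
    -- 2, or to y, which lies outside the first ring.
    ⊆₂ : ∀ {w} → T (J₁.U w) → T (J₂.U w)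
    ⊆₂ = J₁.ring-spanned J₂.U J₂.uv step
      where
      step : ∀ {i j} → T (J₂.U i) → T (J₁.U i) → T (J₁.U j) → T (J₁.g' i j) → T (J₂.U j)
      step {i} {j} u₂i u₁i u₁j e with exits u₂i (subst T (restore₁ {i} {j}) e)
      ... | inj₁ t = t
      ... | inj₂ (inj₁ (_ , refl)) = ⊥-elim (J₂.Dx (J₁.two j u₁j))
      ... | inj₂ (inj₂ (_ , refl)) = ⊥-elim (J₁.¬U-y u₁j)
    back : T (adj G u x)
    back = subst T (restore₁ {u} {x}) (new J₁.sw ba)
  ... | inj₁ t = ⊥-elim (J₁.Dx (J₂.two x t))
    where
    module J₁ = Joined (toggle (x , y , u , v) G) j₁
    module J₂ = Joined (toggle (x₂ , y , u₂ , v) G) j₂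
  -- The edge from u to x leaves the second ring, as x has degree other than 2. It is not the exit
  -- from v to y, since u and v are adjacent and thus distinct; so it is the exit from u₂ to x₂.
  ... | inj₂ (inj₁ (eu , ex)) = ex , eu
  ... | inj₂ (inj₂ (refl , refl)) = ⊥-elim (irrefl J₁.re u J₁.guv)
    where module J₁ = Joined (toggle (x , y , u , v) G) j₁

  -- By `joins-injective` a join is determined by (v , y). There v has degree 2 and lies in the
  -- merged component, which leaves two choices of y for each of at most s + h vertices.
  join-reversals : ∀ s h G → ∑ quads (λ σ → ι (join? s h (toggle σ G) σ)) ≤
    ι (small? D r Q (s + h) (adj G)) * (2 * (s + h))
  join-reversals s h G = go (small? D r Q (s + h) (adj G))
    where
    g = adj G
    small' : ∀ {σ} → Join s h (toggle σ G) σ → Small D r Q (s + h) g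
    small' {σ@(x , y , u , v)} jn = subst (λ H → Small D r Q (s + h) (adj H)) (toggle-involutive σ G)
      (Joined.joined-small (toggle σ G) jn)
    Landing : Fin n × Fin n → Set
    Landing (v , y) = T (conn g r v) × D v ≡ 2 × T (g v y)
    landing? : ∀ z → Dec (Landing z)
    landing? (v , y) = T? (conn g r v) ×-dec (D v ℕ.≟ 2) ×-dec T? (g v y)
    ending : Quad → Fin n × Fin n
    ending (x , y , u , v) = v , y
    lands : ∀ σ → Join s h (toggle σ G) σ → Landing (ending σ)
    lands σ@(x , y , u , v) jn =
      subst (λ H → T (conn (adj H) r v)) (toggle-involutive σ G) v-joined , two v uv ,
      subst (λ H → T (adj H v y)) (toggle-involutive σ G) (new sw dc)
      where open Joined (toggle σ G) jn
    go : (d : Dec (Small D r Q (s + h) g)) → ∑ quads (λ σ → ι (join? s h (toggle σ G) σ)) ≤ ι d * (2 * (s + h))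
    go (no ¬sm) = ≤-trans (≤-reflexive (∑-cong (quads {n}) (λ σ →
      ι-no (join? s h (toggle σ G) σ) (λ jn → ¬sm (small' {σ} jn))))) (≤-reflexive (∑ᴸ-0 (elems (quads {n}))))
    go (yes (re , size , _)) = begin
      ∑ quads (λ σ → ι (join? s h (toggle σ G) σ))
        ≤⟨ ∑-ι-injection quads (fin ⊗ fin) (×-≡-dec _≟_ _≟_) (λ σ → join? s h (toggle σ G) σ) landing? ending lands inj ⟩
      ∑ (fin ⊗ fin) (λ z → ι (landing? z)) ≡⟨ ∑-⊗ fin fin (λ z → ι (landing? z)) ⟩
      ∑₂ (λ v y → ι (landing? (v , y))) ≤⟨ ∑-mono fin (λ v → row v (T? (conn g r v))) ⟩
      ∑ fin (λ v → 2 * ι (T? (conn g r v))) ≡⟨ ∑-*ˡ fin 2 (λ v → ι (T? (conn g r v))) ⟩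
      2 * countB (conn g r) ≤⟨ *-monoʳ-≤ 2 size ⟩
      2 * (s + h) ≡⟨ *-identityˡ _ ⟨
      1 * (2 * (s + h)) ∎
      where
      open ≤-Reasoning
      inj : ∀ σ τ → Join s h (toggle σ G) σ → Join s h (toggle τ G) τ → ending σ ≡ ending τ → σ ≡ τ
      inj σ τ j₁ j₂ refl with joins-injective G j₁ j₂
      ... | refl , refl = refl
      row : ∀ v (d : Dec (T (conn g r v))) → ∑ fin (λ y → ι (landing? (v , y))) ≤ 2 * ι (T? (conn g r v))
      row v (no ¬c) = ≤-trans (≤-reflexive (trans (∑-cong fin (λ y → ι-no (landing? (v , y)) (λ (c , _) → ¬c c)))
        (∑ᴸ-0 (allFin n)))) z≤n
      row v (yes c) with D v ℕ.≟ 2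
      ... | no ne = ≤-trans (≤-reflexive (trans (∑-cong fin (λ y → ι-no (landing? (v , y)) (λ (_ , e , _) → ne e)))
        (∑ᴸ-0 (allFin n)))) z≤n
      ... | yes e = begin
        ∑ fin (λ y → ι (landing? (v , y))) ≤⟨ ∑-mono fin (λ y → ι-mono (landing? (v , y)) (T? (g v y)) (λ (_ , _ , t) → t)) ⟩
        deg g v ≡⟨ trans (degree re v) e ⟩
        2 ≡⟨ cong (2 *_) (ι-yes (T? (conn g r v)) c) ⟨
        2 * ι (T? (conn g r v)) ∎

  #rings : (h : ℕ) → Adj n → ℕ
  #rings h g = ∑₂ (λ u v → ι (ring? h g u v))

  -- The link between the two halves of a round: `cut-bound` bounds it from below, `merge-bound`
  -- from above.
  small-rings : (s h : ℕ) → ℕ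
  small-rings s h = ∑ graphs (λ G → ι (small? D r Q s (adj G)) * #rings h (adj G))

  -- Every ring can be inserted at any stem, and by heaviness of the component there are at least
  -- M/Q stems.
  merge-bound : ∀ s h → M D * small-rings s h ≤ Q * (2 * (s + h)) * #small D r Q (s + h)
  merge-bound s h = begin
    M D * small-rings s h ≡⟨ ∑-*ˡ graphs (M D) (λ G → ι (small? D r Q s (adj G)) * #rings h (adj G)) ⟨
    ∑ graphs (λ G → M D * (ι (small? D r Q s (adj G)) * #rings h (adj G))) ≤⟨ ∑-mono graphs per-graph ⟩
    ∑ graphs (λ G → Q * ∑ quads (λ σ → ι (join? s h G σ))) ≡⟨ ∑-*ˡ graphs Q (λ G → ∑ quads (λ σ → ι (join? s h G σ))) ⟩
    Q * ∑ graphs (λ G → ∑ quads (λ σ → ι (join? s h G σ)))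
      ≤⟨ *-monoʳ-≤ Q (switch-count (λ G → ι (small? D r Q (s + h) (adj G)) * (2 * (s + h))) (join? s h) (join-reversals s h)) ⟩
    Q * ∑ graphs (λ G → ι (small? D r Q (s + h) (adj G)) * (2 * (s + h)))
      ≡⟨ cong (Q *_) (trans (∑-*ʳ graphs (2 * (s + h)) (λ G → ι (small? D r Q (s + h) (adj G)))) (*-comm _ (2 * (s + h)))) ⟩
    Q * (2 * (s + h) * #small D r Q (s + h)) ≡⟨ *-assoc Q (2 * (s + h)) _ ⟨
    Q * (2 * (s + h)) * #small D r Q (s + h) ∎
    where
    open ≤-Reasoning
    per-graph : ∀ G → M D * (ι (small? D r Q s (adj G)) * #rings h (adj G)) ≤ Q * ∑ quads (λ σ → ι (join? s h G σ))
    per-graph G = begin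
      M D * (ι sm * #rings h g) ≡⟨ rearrange (M D) (ι sm) (#rings h g) ⟩
      ι sm * M D * #rings h g ≤⟨ *-monoˡ-≤ (#rings h g) (ι*-≤* sm (λ (re , _ , heavy) →
          ≤-trans heavy (*-monoʳ-≤ Q (W≤stems re)))) ⟩
      ι sm * (Q * ∑₂ st) * #rings h g ≡⟨ rearrange' (ι sm) Q (∑₂ st) (#rings h g) ⟩
      Q * (ι sm * (∑₂ st * #rings h g)) ≡⟨ cong (Q *_) expand ⟨
      Q * ∑ quads (λ σ → ι (join? s h G σ)) ∎
      where
      g = adj G
      sm = small? D r Q s g
      st rg : Fin n → Fin n → ℕ
      st x y = ι (stem? g x y)
      rg u v = ι (ring? h g u v)
      rearrange : ∀ a b c → a * (b * c) ≡ b * a * c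
      rearrange = solve-∀
      rearrange' : ∀ a b c d → a * (b * c) * d ≡ b * (a * (c * d))
      rearrange' = solve-∀
      expand : ∑ quads (λ σ → ι (join? s h G σ)) ≡ ι sm * (∑₂ st * #rings h g)
      expand = trans (∑-quads (λ σ → ι (join? s h G σ))) (trans
        (∑-cong fin (λ x → trans (∑-cong fin (λ y → cell x y))
          (trans (∑-*ˡ fin (ι sm) (λ y → st x y * #rings h g)) (cong (ι sm *_) (∑-*ʳ fin (#rings h g) (st x))))))
        (trans (∑-*ˡ fin (ι sm) (λ x → ∑ fin (st x) * #rings h g)) (cong (ι sm *_) (∑-*ʳ fin (#rings h g) (λ x → ∑ fin (st x))))))
        where
        cell : ∀ x y → ∑₂ (λ u v → ι (join? s h G (x , y , u , v))) ≡ ι sm * (st x y * #rings h g)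
        cell x y = trans (∑-cong fin (λ u → trans (∑-cong fin (λ v →
            trans (ι-× sm (stem? g x y ×-dec ring? h g u v)) (cong (ι sm *_) (ι-× (stem? g x y) (ring? h g u v)))))
            (trans (∑-*ˡ fin (ι sm) (λ v → st x y * rg u v)) (cong (ι sm *_) (∑-*ˡ fin (st x y) (rg u))))))
          (trans (∑-*ˡ fin (ι sm) (λ u → st x y * ∑ fin (rg u))) (cong (ι sm *_) (∑-*ˡ fin (st x y) (λ u → ∑ fin (rg u)))))

-- Cutting a short cycle out of a long path of degree-2 vertices

module _ {n : ℕ} {D : Fin n → ℕ} {g : Adj n} (re : IsReal D g) where

  only-two : ∀ {q a b c} → D q ≡ 2 → T (g q a) → T (g q b) → a ≢ b → T (g q c) → c ≡ a ⊎ c ≡ b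
  only-two {q} {a} {b} {c} two ga gb a≢b gc with c ≟ a | c ≟ b
  ... | yes e | _ = inj₁ e
  ... | no _ | yes e = inj₂ e
  ... | no c≢a | no c≢b = ⊥-elim (<-irrefl refl (≤-trans three (≤-reflexive (trans (degree re q) two))))
    where
    pick : Fin 3 → Fin n
    pick zero = a
    pick (suc zero) = b
    pick (suc (suc zero)) = c
    picks-differ : ∀ i j → pick i ≡ pick j → i ≡ j
    picks-differ zero zero _ = refl
    picks-differ zero (suc zero) e = ⊥-elim (a≢b e)
    picks-differ zero (suc (suc zero)) e = ⊥-elim (c≢a (sym e))
    picks-differ (suc zero) zero e = ⊥-elim (a≢b (sym e))
    picks-differ (suc zero) (suc zero) _ = refl
    picks-differ (suc zero) (suc (suc zero)) e = ⊥-elim (c≢b (sym e))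
    picks-differ (suc (suc zero)) zero e = ⊥-elim (c≢a e)
    picks-differ (suc (suc zero)) (suc zero) e = ⊥-elim (c≢b e)
    picks-differ (suc (suc zero)) (suc (suc zero)) _ = refl
    hit : ∀ i → T (g q (pick i))
    hit zero = ga
    hit (suc zero) = gb
    hit (suc (suc zero)) = gc
    three : 3 ≤ deg g q
    three = ∑fin-image pick picks-differ (λ j → T? (g q j)) hit

  another : ∀ p q → D q ≡ 2 → ∃[ z ] (T (g q z) × z ≢ p)
  another p q two with any? (λ z → T? (g q z) ×-dec ¬? (z ≟ p))
  ... | yes h = h
  ... | no none = ⊥-elim (<-irrefl refl (≤-trans (≤-reflexive (sym (trans (degree re q) two)))
          (∑-unique fin (λ j → T? (g q j)) (λ i j gi gj → trans (same i gi) (sym (same j gj))))))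
    where
    same : ∀ i → T (g q i) → i ≡ p
    same i gi with i ≟ p
    ... | yes e = e
    ... | no ne = ⊥-elim (none (i , gi , ne))

module _ {n : ℕ} (g : Adj n) where

  -- The continuation of a path that comes from p to q. The value q is a default; `next-spec`
  -- excludes it when q has degree 2.
  next : Fin n → Fin n → Fin n
  next p q with any? (λ z → T? (g q z) ×-dec ¬? (z ≟ p))
  ... | yes (z , _) = z
  ... | no _ = q

  -- The state is an oriented edge, from position k to position k + 1, so that the walk is
  -- determined and can be reversed.
  walk : Fin n → Fin n → ℕ → Fin n × Fin n
  walk a c zero = a , c
  walk a c (suc k) = proj₂ (walk a c k) , next (proj₁ (walk a c k)) (proj₂ (walk a c k))

  at : Fin n → Fin n → ℕ → Fin n
  at a c k = proj₁ (walk a c k)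

  next-spec : {D : Fin n → ℕ} → IsReal D g → ∀ p q → D q ≡ 2 → T (g q (next p q)) × next p q ≢ p
  next-spec re p q two with any? (λ z → T? (g q z) ×-dec ¬? (z ≟ p))
  ... | yes (z , h) = h
  ... | no none = ⊥-elim (none (another re p q two))

module SparseCut {n : ℕ} (D : Fin n → ℕ) (positive : IsDegreeSequence D) (r : Fin n) (Q : ℕ) where
  open Sparse D r Q

  module Walk (g : Adj n) (re : IsReal D g) where

    private
      K = conn g r

    -- The positions 0 to k have degree 2, and the walk starts, hence stays, outside the component
    -- of r.
    Good : Fin n → Fin n → ℕ → Set
    Good a c zero = ¬ T (K a) × T (g a c) × D a ≡ 2
    Good a c (suc k) = Good a c k × D (at g a c (suc k)) ≡ 2

    good? : ∀ a c k → Dec (Good a c k)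
    good? a c zero = ¬? (T? (K a)) ×-dec T? (g a c) ×-dec (D a ℕ.≟ 2)
    good? a c (suc k) = good? a c k ×-dec (D (at g a c (suc k)) ℕ.≟ 2)

    good-≤ : ∀ {a c j k} → j ≤ k → Good a c k → Good a c j
    good-≤ {k = zero} z≤n gd = gd
    good-≤ {j = j} {suc k} j≤ gd with m≤n⇒m<n∨m≡n j≤
    ... | inj₁ (s≤s j≤k) = good-≤ j≤k (proj₁ gd)
    ... | inj₂ refl = gd

    good-deg : ∀ {a c} k → Good a c k → D (at g a c k) ≡ 2
    good-deg zero gd = proj₂ (proj₂ gd)
    good-deg (suc k) gd = proj₂ gd

    good-edge : ∀ {a c} k → Good a c k → T (g (at g a c k) (at g a c (suc k)))
    good-edge zero gd = proj₁ (proj₂ gd)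
    good-edge {a} {c} (suc k) gd = proj₁ (next-spec g re (at g a c k) (at g a c (suc k)) (proj₂ gd))

    good-turn : ∀ {a c} k → Good a c (suc k) → at g a c (suc (suc k)) ≢ at g a c k
    good-turn {a} {c} k gd = proj₂ (next-spec g re (at g a c k) (at g a c (suc k)) (proj₂ gd))

    good-outside : ∀ {a c} k → Good a c k → ¬ T (K (at g a c k))
    good-outside zero gd = proj₁ gd
    good-outside {a} {c} (suc k) gd kw = good-outside k (proj₁ gd)
      (conn-closed g r (at g a c (suc k)) (at g a c k) kw (symm re (at g a c k) (at g a c (suc k)) (good-edge k (proj₁ gd))))

    good-nbr : ∀ {a c} k → Good a c (suc k) → ∀ {z} → T (g (at g a c (suc k)) z) →
      z ≡ at g a c k ⊎ z ≡ at g a c (suc (suc k))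
    good-nbr k gd h = only-two re (proj₂ gd) (symm re _ _ (good-edge k (proj₁ gd))) (good-edge (suc k) gd)
      (λ e → good-turn k gd (sym e)) h

    -- The walk can be run backwards: a vertex of degree 2 has only one neighbour besides the next
    -- position.
    walk-injective : ∀ {a c a' c'} k → Good a c k → Good a' c' k → walk g a c k ≡ walk g a' c' k →
      (a , c) ≡ (a' , c')
    walk-injective zero _ _ e = e
    walk-injective {a} {c} {a'} {c'} (suc k) gd gd' e = walk-injective k (proj₁ gd) (proj₁ gd')
      (cong₂ _,_ (back e₁ e₂) e₁)
      where
      e₁ : at g a c (suc k) ≡ at g a' c' (suc k)
      e₁ = cong proj₁ e
      e₂ : at g a c (suc (suc k)) ≡ at g a' c' (suc (suc k))
      e₂ = cong proj₂ e
      back : at g a c (suc k) ≡ at g a' c' (suc k) → at g a c (suc (suc k)) ≡ at g a' c' (suc (suc k)) →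
        at g a c k ≡ at g a' c' k
      back e₁ e₂ with good-nbr k gd' {at g a c k}
        (subst (λ q → T (g q (at g a c k))) e₁ (symm re _ _ (good-edge k (proj₁ gd))))
      ... | inj₁ same = same
      ... | inj₂ other = ⊥-elim (good-turn k gd (trans e₂ (sym other)))

    #good : ℕ → ℕ
    #good k = ∑₂ (λ a c → ι (good? a c k))

    ends? : ∀ p q → Dec (T (g p q) × D q ≢ 2)
    ends? p q = T? (g p q) ×-dec ¬? (D q ℕ.≟ 2)

    #ends≤M : ∑₂ (λ p q → ι (ends? p q)) ≤ M D
    #ends≤M = ≤-trans (≤-reflexive (∑-swap fin fin (λ p q → ι (ends? p q)))) (∑-mono fin column)
      where
      column : ∀ q → ∑ fin (λ p → ι (ends? p q)) ≤ wt D q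
      column q with D q ℕ.≟ 2
      ... | yes e = ≤-trans (≤-reflexive (trans (∑-cong fin (λ p → ι-no (ends? p q) (λ (_ , ne) → ne e))) (∑ᴸ-0 (allFin n)))) z≤n
      ... | no ne = ≤-trans (∑-mono fin (λ p → ι-mono (ends? p q) (T? (g q p)) (λ (h , _) → symm re p q h)))
            (≤-reflexive (trans (degree re q) (sym (wt-≢2 {D = D} ne))))

    -- A walk that fails at this step ends in an oriented edge into a vertex of degree other than 2.
    -- There are at most M such edges, and distinct walks end in distinct ones.
    good-step : ∀ k → #good k ≤ #good (suc k) + M D
    good-step k = begin
      #good k ≤⟨ ∑₂-mono (λ a c → ι-≤-+ (good? a c k) (good? a c (suc k)) (stop? (a , c)) (classify a c)) ⟩
      ∑₂ (λ a c → ι (good? a c (suc k)) + ι (stop? (a , c)))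
        ≡⟨ ∑₂-+ (λ a c → ι (good? a c (suc k))) (λ a c → ι (stop? (a , c))) ⟩
      #good (suc k) + ∑₂ (λ a c → ι (stop? (a , c))) ≤⟨ +-monoʳ-≤ (#good (suc k)) stops ⟩
      #good (suc k) + M D ∎
      where
      open ≤-Reasoning
      Stop : Fin n × Fin n → Set
      Stop (a , c) = Good a c k × D (at g a c (suc k)) ≢ 2
      stop? : ∀ e → Dec (Stop e)
      stop? (a , c) = good? a c k ×-dec ¬? (D (at g a c (suc k)) ℕ.≟ 2)
      classify : ∀ a c → Good a c k → Good a c (suc k) ⊎ Stop (a , c)
      classify a c gd with D (at g a c (suc k)) ℕ.≟ 2
      ... | yes e = inj₁ (gd , e)
      ... | no ne = inj₂ (gd , ne)
      stops : ∑₂ (λ a c → ι (stop? (a , c))) ≤ M D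
      stops = begin
        ∑₂ (λ a c → ι (stop? (a , c))) ≡⟨ ∑-⊗ fin fin (λ e → ι (stop? e)) ⟨
        ∑ (fin ⊗ fin) (λ e → ι (stop? e))
          ≤⟨ ∑-ι-injection (fin ⊗ fin) (fin ⊗ fin) (×-≡-dec _≟_ _≟_) stop? (λ (p , q) → ends? p q)
               (λ (a , c) → walk g a c k) (λ (a , c) (gd , ne) → good-edge k gd , ne)
               (λ (a , c) (a' , c') (gd , _) (gd' , _) e → walk-injective k gd gd' e) ⟩
        ∑ (fin ⊗ fin) (λ (p , q) → ι (ends? p q)) ≡⟨ ∑-⊗ fin fin (λ (p , q) → ι (ends? p q)) ⟩
        ∑₂ (λ p q → ι (ends? p q)) ≤⟨ #ends≤M ⟩
        M D ∎

    -- A vertex of degree 2 outside the component of r starts two walks. Any other vertex is paid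
    -- for by the component or by its own weight, which is positive if its degree is not 2.
    good-start : 2 * n ≤ #good 0 + (2 * countB K + 2 * M D)
    good-start = begin
      2 * n ≡⟨ trans (*-comm 2 n) (sym (∑fin-const n 2)) ⟩
      ∑ fin (λ (_ : Fin n) → 2) ≤⟨ ∑-mono fin pointwise ⟩
      ∑ fin (λ a → ∑ fin (λ c → ι (good? a c 0)) + (2 * ι (T? (K a)) + 2 * wt D a))
        ≡⟨ trans (∑-+ fin (λ a → ∑ fin (λ c → ι (good? a c 0))) (λ a → 2 * ι (T? (K a)) + 2 * wt D a))
             (cong (#good 0 +_) (trans (∑-+ fin (λ a → 2 * ι (T? (K a))) (λ a → 2 * wt D a))
               (cong₂ _+_ (∑-*ˡ fin 2 (λ a → ι (T? (K a)))) (∑-*ˡ fin 2 (wt D))))) ⟩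
      #good 0 + (2 * countB K + 2 * M D) ∎
      where
      open ≤-Reasoning
      pointwise : ∀ a → 2 ≤ ∑ fin (λ c → ι (good? a c 0)) + (2 * ι (T? (K a)) + 2 * wt D a)
      pointwise a = by-cases (T? (K a)) (D a ℕ.≟ 2)
        where
        row = ∑ fin (λ c → ι (good? a c 0))
        by-cases : Dec (T (K a)) → Dec (D a ≡ 2) → 2 ≤ row + (2 * ι (T? (K a)) + 2 * wt D a)
        by-cases (yes ka) _ = ≤-trans (≤-trans (≤-reflexive (cong (2 *_) (sym (ι-yes (T? (K a)) ka))))
          (m≤m+n (2 * ι (T? (K a))) (2 * wt D a))) (m≤n+m _ row)
        by-cases (no _) (no ne) = ≤-trans (≤-trans (*-monoʳ-≤ 2 (≤-trans (positive a) (≤-reflexive (sym (wt-≢2 {D = D} ne)))))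
          (m≤n+m (2 * wt D a) (2 * ι (T? (K a))))) (m≤n+m _ row)
        by-cases (no ¬ka) (yes e) = ≤-trans (≤-trans (≤-reflexive (sym (trans (degree re a) e)))
          (∑-mono fin (λ c → ι-mono (T? (g a c)) (good? a c 0) (λ h → ¬ka , h , e)))) (m≤m+n row _)

    good-bound : ∀ k → 2 * n ≤ #good k + (k * M D + (2 * countB K + 2 * M D))
    good-bound zero = good-start
    good-bound (suc k) = begin
      2 * n ≤⟨ good-bound k ⟩
      #good k + (k * M D + rest) ≤⟨ +-monoˡ-≤ (k * M D + rest) (good-step k) ⟩
      #good (suc k) + M D + (k * M D + rest) ≡⟨ shuffle (#good (suc k)) (M D) (k * M D) rest ⟩
      #good (suc k) + (suc k * M D + rest) ∎
      where
      open ≤-Reasoning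
      rest = 2 * countB K + 2 * M D
      shuffle : ∀ a b c d → a + b + (c + d) ≡ a + (b + c + d)
      shuffle = solve-∀

    NoReturn : Fin n → Fin n → ℕ → Set
    NoReturn a c N = ∀ k → 1 ≤ k → k ≤ N → at g a c k ≢ a

    first-return : ∀ a c N → NoReturn a c N ⊎
      ∃[ k ] (suc k ≤ N × NoReturn a c k × at g a c (suc k) ≡ a)
    first-return a c zero = inj₁ λ { zero () z≤n }
    first-return a c (suc N) with first-return a c N
    ... | inj₂ (k , k≤ , nr , e) = inj₂ (k , m≤n⇒m≤1+n k≤ , nr , e)
    ... | inj₁ nr with at g a c (suc N) ≟ a
    ...   | yes e = inj₂ (N , ≤-refl , nr , e)
    ...   | no ne = inj₁ extend
      where
      extend : NoReturn a c (suc N)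
      extend k 1≤k k≤ with m≤n⇒m<n∨m≡n k≤
      ... | inj₁ (s≤s k≤N) = nr k 1≤k k≤N
      ... | inj₂ refl = ne

    Distinct : Fin n → Fin n → ℕ → Set
    Distinct a c N = ∀ {j k} → j < k → k ≤ N → at g a c j ≢ at g a c k

    -- If positions j + 1 and N + 1 coincide, then position N is a neighbour of position j + 1 and
    -- coincides with position j or j + 2. So there is an earlier repetition, or the walk stood
    -- still or turned back.
    distinct : ∀ {a c} N → Good a c N → NoReturn a c N → Distinct a c N
    distinct zero gd nr () z≤n
    distinct {a} {c} (suc N) gd nr {j} {k} j<k k≤ with m≤n⇒m<n∨m≡n k≤
    ... | inj₁ (s≤s k≤N) = distinct N (proj₁ gd) (λ i 1≤i i≤N → nr i 1≤i (m≤n⇒m≤1+n i≤N)) j<k k≤N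
    ... | inj₂ refl = fresh j j<k
      where
      rec : Distinct a c N
      rec = distinct N (proj₁ gd) (λ i 1≤i i≤N → nr i 1≤i (m≤n⇒m≤1+n i≤N))
      w = at g a c
      fresh : ∀ j → j < suc N → w j ≢ w (suc N)
      fresh zero _ e = nr (suc N) (s≤s z≤n) ≤-refl (sym e)
      fresh (suc j) (s≤s j<N) e with m≤n⇒m<n∨m≡n j<N
      ... | inj₂ refl = irrefl re (w (suc j)) (subst (λ z → T (g (w (suc j)) z)) (sym e) (good-edge (suc j) (proj₁ gd)))
      ... | inj₁ sj<N with good-nbr j (good-≤ (m≤n⇒m≤1+n j<N) gd) {w N}
              (subst (λ z → T (g z (w N))) (sym e) (symm re (w N) (w (suc N)) (good-edge N (proj₁ gd))))
      ...   | inj₁ same = rec j<N ≤-refl (sym same)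
      ...   | inj₂ ahead with m≤n⇒m<n∨m≡n sj<N
      ...     | inj₁ ssj<N = rec ssj<N ≤-refl (sym ahead)
      ...     | inj₂ refl = good-turn (suc j) (proj₁ gd) (sym e)

    -- The i vertices at the positions o to o + i - 1.
    segment : Fin n → Fin n → (o i : ℕ) → Fin n → Bool
    segment a c o zero z = false
    segment a c o (suc i) z = eqF (at g a c (i + o)) z ∨ segment a c o i z

    segment⁺ : ∀ {a c o} i k → k < i → T (segment a c o i (at g a c (k + o)))
    segment⁺ {a} {c} {o} (suc i) k (s≤s k≤i) with m≤n⇒m<n∨m≡n k≤i
    ... | inj₁ k<i = T-∨ʳ {eqF (at g a c (i + o)) (at g a c (k + o))} (segment⁺ i k k<i)
    ... | inj₂ refl = T-∨ˡ (eqF-refl (at g a c (k + o)))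

    segment⁻ : ∀ {a c o} i z → T (segment a c o i z) → ∃[ k ] (k < i × z ≡ at g a c (k + o))
    segment⁻ {a} {c} {o} (suc i) z t with T-∨⁻ {eqF (at g a c (i + o)) z} t
    ... | inj₁ e = i , ≤-refl , sym (eqF⁻ e)
    ... | inj₂ t' = let k , k<i , e = segment⁻ i z t' in k , m≤n⇒m≤1+n k<i , e

    segment-size : ∀ {a c o} i → countB (segment a c o i) ≤ i
    segment-size zero = ≤-reflexive (∑ᴸ-0 (allFin n))
    segment-size {a} {c} {o} (suc i) = begin
      countB (segment a c o (suc i))
        ≤⟨ ∑-mono fin (λ z → ι-≤-+ (T? (segment a c o (suc i) z)) (p ≟ z) (T? (segment a c o i z))
             (λ t → [ (λ e → inj₁ (eqF⁻ e)) , inj₂ ]′ (T-∨⁻ {eqF p z} t))) ⟩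
      ∑ fin (λ z → ι (p ≟ z) + ι (T? (segment a c o i z)))
        ≡⟨ ∑-+ fin (λ z → ι (p ≟ z)) (λ z → ι (T? (segment a c o i z))) ⟩
      ∑ fin (λ z → ι (p ≟ z)) + countB (segment a c o i)
        ≤⟨ +-mono-≤ (∑-unique fin (p ≟_) (λ x y ex ey → trans (sym ex) ey)) (segment-size i) ⟩
      suc i ∎
      where
      open ≤-Reasoning
      p = at g a c (i + o)

    -- The walk up to its first return is a closed set: the neighbours of a are positions 1 and k,
    -- which differ because the walk neither stands still nor turns back.
    return-Ring : ∀ {a c N h} → Good a c N → N ≤ h → ∀ {k} → suc k ≤ N → NoReturn a c k →
      at g a c (suc k) ≡ a → Ring h g a c
    return-Ring {a} {c} {N} {h} gd N≤h {k} sk≤N nr e = proj₁ (proj₂ start) , proj₁ start ,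
      (λ w cw → let i , i≤k , ew = segment⁻ (suc k) w (covered cw) in
        trans (cong D ew) (good-deg (i + 0) (good-≤ (subst (_≤ N) (sym (+-identityʳ i)) (≤-trans (<⇒≤ i≤k) sk≤N)) gd))) ,
      ≤-trans (countB-mono (λ w → covered {w})) (≤-trans (segment-size (suc k)) (≤-trans sk≤N N≤h))
      where
      start = good-≤ {j = 0} z≤n gd
      w = at g a c
      dis : Distinct a c k
      dis = distinct k (good-≤ (<⇒≤ sk≤N) gd) nr
      Z = segment a c 0 (suc k)
      in-Z : ∀ i → i < suc k → T (Z (w i))
      in-Z i i< = subst (λ m → T (Z (w m))) (+-identityʳ i) (segment⁺ (suc k) i i<)
      closed : Closed g Z
      closed z z' tz h with segment⁻ (suc k) z tz
      ... | i , i<sk , refl = nbr (i + 0) (subst (_< suc k) (sym (+-identityʳ i)) i<sk) h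
        where
        nbr : ∀ i → i < suc k → ∀ {z'} → T (g (w i) z') → T (Z z')
        nbr (suc i) si<sk h with good-nbr i (good-≤ (≤-trans (<⇒≤ si<sk) sk≤N) gd) h
        ... | inj₁ refl = in-Z i (<⇒≤ si<sk)
        ... | inj₂ refl with m≤n⇒m<n∨m≡n si<sk
        ...   | inj₁ more = in-Z (suc (suc i)) more
        ...   | inj₂ refl = subst (T ∘ Z) (sym e) (in-Z 0 (s≤s z≤n))
        nbr zero 0<sk h = first k dis sk≤N e (λ i → in-Z i) h
          where
          first : ∀ k → Distinct a c k → suc k ≤ N → w (suc k) ≡ a →
            (∀ i → i < suc k → T (Z (w i))) → ∀ {z'} → T (g a z') → T (Z z')
          first zero _ _ e _ h = ⊥-elim (irrefl re a (subst (λ z → T (g a z)) e (proj₁ (proj₂ start))))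
          first (suc zero) _ 2≤N e _ h = ⊥-elim (good-turn 0 (good-≤ (<⇒≤ 2≤N) gd) e)
          first (suc (suc k)) dis sk≤N e ins h with only-two re (proj₂ (proj₂ start)) (proj₁ (proj₂ start))
                (subst (λ z → T (g z (w (suc (suc k))))) e
                  (symm re _ _ (good-edge (suc (suc k)) (good-≤ (<⇒≤ sk≤N) gd))))
                (dis {1} {suc (suc k)} (s≤s (s≤s z≤n)) ≤-refl) h
          ... | inj₁ refl = ins 1 (s≤s (s≤s z≤n))
          ... | inj₂ refl = ins (suc (suc k)) ≤-refl
      covered : ∀ {w} → T (conn g a w) → T (Z w)
      covered = conn-least closed (in-Z 0 (s≤s z≤n))

module SparseBound {n : ℕ} (D : Fin n → ℕ) (positive : IsDegreeSequence D) (r : Fin n) (Q : ℕ) where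
  open Sparse D r Q
  open SparseCut D positive r Q

  -- The edges ac and bd give way to ab, which bridges the gap in the path, and cd, which closes the
  -- segment into a cycle. The degree of a keeps the choices for ab in the reversal below 2 n.
  Cut : (s h : ℕ) → Graph n → Quad → Set
  Cut s h G σ@(a , c , b , d) = IsReal D (adj G) × Switchable (adj G) σ × D a ≡ 2 ×
    Small D r Q s (adj (toggle σ G)) × Ring h (adj (toggle σ G)) c d

  cut? : ∀ s h G σ → Dec (Cut s h G σ)
  cut? s h G σ@(a , c , b , d) = isReal? (adj G) ×-dec switchable? (adj G) σ ×-dec (D a ℕ.≟ 2) ×-dec
    small? D r Q s (adj (toggle σ G)) ×-dec ring? h (adj (toggle σ G)) c d

  module _ {s h N : ℕ} (G : Graph n) (sm : Small D r Q s (adj G)) where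
    private
      g = adj G
      K = conn g r
      re = proj₁ sm
    open Walk g re

    -- The segment runs from position 1 to position i. The bound 3 ≤ i makes its ends non-adjacent;
    -- i + 2 ≤ N makes both neighbours of b known, so that b is not adjacent to a.
    make-cut : ∀ {a c} → Good a c N → NoReturn a c N → ∀ i → 3 ≤ i → suc (suc i) ≤ N → i ≤ h →
      Cut s h G (a , c , at g a c (suc i) , at g a c i)
    make-cut {a} {c} gd nr i 3≤i i+2≤N i≤h = re , swappable , good-deg 0 (good 0 z≤n) , small' , ring'
      where
      w = at g a c
      b = w (suc i)
      d = w i
      dis : Distinct a c N
      dis = distinct N gd nr
      good : ∀ k → k ≤ N → Good a c k
      good k k≤N = good-≤ k≤N gd
      i+1≤N = <⇒≤ i+2≤N
      i≤N = <⇒≤ i+1≤N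
      1≤N : 1 ≤ N
      1≤N = ≤-trans (s≤s z≤n) i+1≤N
      gac : T (g a c)
      gac = good-edge 0 (good 0 z≤n)
      a≢b : a ≢ b
      a≢b = dis {0} {suc i} (s≤s z≤n) i+1≤N
      c≢d : c ≢ d
      c≢d = dis {1} {i} (≤-trans (s≤s (s≤s z≤n)) 3≤i) i≤N
      ¬gab : ¬ T (g a b)
      ¬gab gab = [ (λ e → dis {0} {i} (≤-trans (s≤s z≤n) 3≤i) i≤N e) ,
                   (λ e → dis {0} {suc (suc i)} (s≤s z≤n) i+2≤N e) ]′
        (good-nbr i (good (suc i) i+1≤N) (symm re a b gab))
      ¬gcd : ¬ T (g c d)
      ¬gcd gcd = [ (λ e → dis {0} {i} (≤-trans (s≤s z≤n) 3≤i) i≤N (sym e)) ,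
                   (λ e → dis {2} {i} 3≤i i≤N (sym e)) ]′
        (good-nbr 0 (good 1 1≤N) gcd)
      swappable : Switchable g (a , c , b , d)
      swappable = gac , symm re d b (good-edge i (good i i≤N)) , ¬gab , ¬gcd , a≢b , c≢d
      g' = adj (toggle (a , c , b , d) G)
      sw : Switch g g' a c b d
      sw = toggle-Switch G re swappable
      out : ∀ k → k ≤ N → ¬ T (K (w k))
      out k k≤N = good-outside k (good k k≤N)
      ¬Ka = out 0 z≤n
      ¬Kc = out 1 1≤N
      ¬Kb = out (suc i) i+1≤N
      ¬Kd = out i i≤N

      K-closed' : Closed g' K
      K-closed' p q kp e with from sw e
      ... | inj₁ h = conn-closed g r p q kp h
      ... | inj₂ ab = ⊥-elim (¬Ka kp)
      ... | inj₂ ba = ⊥-elim (¬Kb kp)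
      ... | inj₂ cd = ⊥-elim (¬Kc kp)
      ... | inj₂ dc = ⊥-elim (¬Kd kp)
      shrinks : ∀ {w} → T (conn g' r w) → T (K w)
      shrinks = conn-least K-closed' (conn-refl g r)
      covers : ∀ {w} → T (K w) → T (conn g' r w)
      covers {w} kw = proj₁ (T-∧⁻ {conn g' r w} (conn-least closed (T-∧⁺ (conn-refl g' r) (conn-refl g r)) kw))
        where
        closed : Closed g (λ p → conn g' r p ∧ K p)
        closed p q t e with T-∧⁻ {conn g' r p} t
        ... | cp , kp with keep sw e
        ...   | inj₁ e' = T-∧⁺ (conn-closed g' r p q cp e') (conn-closed g r p q kp e)
        ...   | inj₂ ab = ⊥-elim (¬Ka kp)
        ...   | inj₂ ba = ⊥-elim (¬Kc kp)
        ...   | inj₂ cd = ⊥-elim (¬Kb kp)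
        ...   | inj₂ dc = ⊥-elim (¬Kd kp)
      small' : Small D r Q s g'
      small' = toggle-IsReal G re swappable ,
        ≤-trans (countB-mono (λ p → shrinks {p})) (proj₁ (proj₂ sm)) ,
        ≤-trans (proj₂ (proj₂ sm)) (*-monoʳ-≤ Q (W-mono D (λ p → covers {p})))

      Z = segment a c 1 i
      in-Z : ∀ k → 1 ≤ k → k ≤ i → T (Z (w k))
      in-Z (suc k) _ k<i = subst (λ m → T (Z (w m))) (+-comm k 1) (segment⁺ i k k<i)
      from-Z : ∀ {z} → T (Z z) → ∃[ k ] (k < i × z ≡ w (suc k))
      from-Z {z} tz = let k , k<i , e = segment⁻ i z tz in k , k<i , trans e (cong w (+-comm k 1))
      c∈Z : T (Z c)
      c∈Z = in-Z 1 ≤-refl (≤-trans (s≤s z≤n) 3≤i)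
      d∈Z : T (Z d)
      d∈Z = in-Z i (≤-trans (s≤s z≤n) 3≤i) ≤-refl
      a∉Z : ¬ T (Z a)
      a∉Z t = let k , k<i , e = from-Z t in dis {0} {suc k} (s≤s z≤n) (≤-trans k<i i≤N) e
      b∉Z : ¬ T (Z b)
      b∉Z t = let k , k<i , e = from-Z t in dis {suc k} {suc i} (s≤s k<i) i+1≤N (sym e)
      Z-closed : Closed g' Z
      Z-closed p q tp e with from sw e
      ... | inj₂ ab = ⊥-elim (a∉Z tp)
      ... | inj₂ ba = ⊥-elim (b∉Z tp)
      ... | inj₂ cd = d∈Z
      ... | inj₂ dc = c∈Z
      ... | inj₁ e₀ with from-Z tp
      ...   | k , k<i , refl with good-nbr k (good (suc k) (≤-trans k<i i≤N)) e₀
      Z-closed p q tp e | inj₁ e₀ | zero , k<i , refl | inj₁ refl = ⊥-elim (gone sw ba e)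
      Z-closed p q tp e | inj₁ e₀ | suc k , k<i , refl | inj₁ refl = in-Z (suc k) (s≤s z≤n) (<⇒≤ k<i)
      Z-closed p q tp e | inj₁ e₀ | k , k<i , refl | inj₂ refl with m≤n⇒m<n∨m≡n k<i
      ... | inj₁ more = in-Z (suc (suc k)) (s≤s z≤n) more
      ... | inj₂ refl = ⊥-elim (gone sw dc e)
      within : ∀ {p} → T (conn g' c p) → T (Z p)
      within = conn-least Z-closed c∈Z
      ring' : Ring h g' c d
      ring' = new sw cd , (λ t → ¬Kc (shrinks t)) ,
        (λ p cp → let k , k<i , e = from-Z (within cp) in trans (cong D e) (good-deg (suc k) (good (suc k) (≤-trans k<i i≤N)))) ,
        ≤-trans (countB-mono (λ p → within {p})) (≤-trans (segment-size i) i≤h)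

  #cuts-at : (s h : ℕ) → Graph n → Fin n → Fin n → ℕ
  #cuts-at s h G a c = ∑₂ (λ b d → ι (cut? s h G (a , c , b , d)))

  module _ {s m : ℕ} (G : Graph n) (sm : Small D r Q s (adj G)) where
    private
      g = adj G
      re = proj₁ sm
      N = m + 4
    open Walk g re

    -- With N = m + 4 the m values of i from 3 to m + 2 are allowed. A walk that returns starts on a
    -- ring already, which is then credited with m.
    many-cuts-at : ∀ a c → Good a c N → m ≤ #cuts-at s N G a c + m * ι (ring? N g a c)
    many-cuts-at a c gd with first-return a c N
    ... | inj₂ (k , sk≤N , nr , e) = ≤-trans (≤-reflexive (sym (trans (cong (m *_)
            (ι-yes (ring? N g a c) (return-Ring gd ≤-refl sk≤N nr e))) (*-identityʳ m)))) (m≤n+m _ _)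
    ... | inj₁ nr = ≤-trans cuts (m≤m+n _ _)
      where
      open ≤-Reasoning
      w = at g a c
      cut-end : Fin m → Fin n × Fin n
      cut-end i = w (suc (3 + toℕ i)) , w (3 + toℕ i)
      hit : ∀ i → Cut s N G (a , c , w (suc (3 + toℕ i)) , w (3 + toℕ i))
      hit i = make-cut G sm gd nr (3 + toℕ i) (s≤s (s≤s (s≤s z≤n)))
        (≤-trans (s≤s (s≤s (s≤s (s≤s (toℕ<n i))))) (≤-reflexive (+-comm 4 m)))
        (≤-trans (+-mono-≤ {3} {4} (n≤1+n 3) (<⇒≤ (toℕ<n i))) (≤-reflexive (+-comm 4 m)))
      in-range : ∀ (i : Fin m) → 3 + toℕ i ≤ N
      in-range i = ≤-trans (+-mono-≤ {3} {4} (n≤1+n 3) (<⇒≤ (toℕ<n i))) (≤-reflexive (+-comm 4 m))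
      inj : ∀ i j → w (3 + toℕ i) ≡ w (3 + toℕ j) → i ≡ j
      inj i j e with <-cmp (toℕ i) (toℕ j)
      ... | tri< lt _ _ = ⊥-elim (distinct N gd nr (+-monoʳ-< 3 lt) (in-range j) e)
      ... | tri≈ _ eq _ = toℕ-injective eq
      ... | tri> _ _ gt = ⊥-elim (distinct N gd nr (+-monoʳ-< 3 gt) (in-range i) (sym e))
      cuts : m ≤ #cuts-at s N G a c
      cuts = begin
        m ≡⟨ trans (∑fin-const m 1) (*-identityʳ m) ⟨
        ∑ fin (λ (i : Fin m) → ι (yes tt))
          ≤⟨ ∑-ι-injection fin (fin ⊗ fin) (×-≡-dec _≟_ _≟_) (λ _ → yes tt) (λ (b , d) → cut? s N G (a , c , b , d))
               cut-end (λ i _ → hit i) (λ i j _ _ e → inj i j (cong proj₂ e)) ⟩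
        ∑ (fin ⊗ fin) (λ (b , d) → ι (cut? s N G (a , c , b , d))) ≡⟨ ∑-⊗ fin fin (λ (b , d) → ι (cut? s N G (a , c , b , d))) ⟩
        #cuts-at s N G a c ∎

    many-cuts : ∀ {F} → F + (N * M D + (2 * s + 2 * M D)) ≤ 2 * n →
      m * F ≤ ∑ quads (λ σ → ι (cut? s N G σ)) + m * #rings N g
    many-cuts {F} room = begin
      m * F ≤⟨ *-monoʳ-≤ m F≤ ⟩
      m * #good N ≡⟨ trans (∑-cong fin (λ a → ∑-*ˡ fin m (λ c → ι (good? a c N)))) (∑-*ˡ fin m (λ a → ∑ fin (λ c → ι (good? a c N)))) ⟨
      ∑₂ (λ a c → m * ι (good? a c N)) ≤⟨ ∑₂-mono (λ a c → ≤-trans (≤-reflexive (*-comm m (ι (good? a c N))))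
          (ι*-≤ (good? a c N) (many-cuts-at a c))) ⟩
      ∑₂ (λ a c → #cuts-at s N G a c + m * ι (ring? N g a c))
        ≡⟨ ∑₂-+ (#cuts-at s N G) (λ a c → m * ι (ring? N g a c)) ⟩
      ∑₂ (#cuts-at s N G) + ∑₂ (λ a c → m * ι (ring? N g a c))
        ≡⟨ cong₂ _+_ (sym (∑-quads (λ σ → ι (cut? s N G σ))))
             (trans (∑-cong fin (λ a → ∑-*ˡ fin m (λ c → ι (ring? N g a c)))) (∑-*ˡ fin m (λ a → ∑ fin (λ c → ι (ring? N g a c))))) ⟩
      ∑ quads (λ σ → ι (cut? s N G σ)) + m * #rings N g ∎
      where
      open ≤-Reasoning
      F≤ : F ≤ #good N
      F≤ = +-cancelʳ-≤ (N * M D + (2 * s + 2 * M D)) F (#good N) (≤-trans room (≤-trans (good-bound N)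
        (+-monoʳ-≤ (#good N) (+-monoʳ-≤ (N * M D) (+-monoˡ-≤ (2 * M D) (*-monoʳ-≤ 2 (proj₁ (proj₂ sm))))))))

  -- A cut is undone by naming the edge cd of the new ring and the edge ab, oriented from a vertex
  -- of degree 2.
  cut-reversals : ∀ s h G → ∑ quads (λ σ → ι (cut? s h (toggle σ G) σ)) ≤
    ι (small? D r Q s (adj G)) * #rings h (adj G) * (2 * n)
  cut-reversals s h G = go (small? D r Q s g)
    where
    open ≤-Reasoning
    g = adj G
    two? : ∀ a b → Dec (D a ≡ 2 × T (g a b))
    two? a b = (D a ℕ.≟ 2) ×-dec T? (g a b)
    tw rg : Fin n → Fin n → ℕ
    tw a b = ι (two? a b)
    rg c d = ι (ring? h g c d)
    back : ∀ σ → let (a , c , b , d) = σ in Cut s h (toggle σ G) σ →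
      Small D r Q s g × (D a ≡ 2 × T (g a b)) × Ring h g c d
    back σ@(a , c , b , d) (re , swappable , Da , sm , rng) =
      subst (λ H → Small D r Q s (adj H)) (toggle-involutive σ G) sm ,
      (Da , subst (λ H → T (adj H a b)) (toggle-involutive σ G) (new (toggle-Switch (toggle σ G) re swappable) ab)) ,
      subst (λ H → Ring h (adj H) c d) (toggle-involutive σ G) rng
    go : (dec : Dec (Small D r Q s g)) → ∑ quads (λ σ → ι (cut? s h (toggle σ G) σ)) ≤ ι dec * #rings h g * (2 * n)
    go (no ¬sm) = ≤-trans (≤-reflexive (∑-cong (quads {n}) (λ σ →
      ι-no (cut? s h (toggle σ G) σ) (λ cu → ¬sm (proj₁ (back σ cu)))))) (≤-reflexive (∑ᴸ-0 (elems (quads {n}))))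
    go (yes (re , _)) = begin
      ∑ quads (λ σ → ι (cut? s h (toggle σ G) σ)) ≡⟨ ∑-quads (λ σ → ι (cut? s h (toggle σ G) σ)) ⟩
      ∑₂ (λ a c → ∑₂ (λ b d → ι (cut? s h (toggle (a , c , b , d) G) (a , c , b , d))))
        ≤⟨ ∑₂-mono (λ a c → ∑₂-mono (λ b d → pointwise a c b d)) ⟩
      ∑₂ (λ a c → ∑₂ (λ b d → tw a b * rg c d))
        ≡⟨ ∑-cong fin (λ a → ∑-cong fin (λ c → trans (∑-cong fin (λ b → ∑-*ˡ fin (tw a b) (rg c)))
             (∑-*ʳ fin (∑ fin (rg c)) (tw a)))) ⟩
      ∑₂ (λ a c → ∑ fin (tw a) * ∑ fin (rg c))
        ≡⟨ trans (∑-cong fin (λ a → ∑-*ˡ fin (∑ fin (tw a)) (λ c → ∑ fin (rg c))))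
             (∑-*ʳ fin (#rings h g) (λ a → ∑ fin (tw a))) ⟩
      ∑₂ tw * #rings h g ≤⟨ *-monoˡ-≤ (#rings h g) few ⟩
      2 * n * #rings h g ≡⟨ trans (*-comm (2 * n) (#rings h g)) (cong (_* (2 * n)) (sym (*-identityˡ (#rings h g)))) ⟩
      1 * #rings h g * (2 * n) ∎
      where
      pointwise : ∀ a c b d → ι (cut? s h (toggle (a , c , b , d) G) (a , c , b , d)) ≤ tw a b * rg c d
      pointwise a c b d = ≤-trans (ι-mono (cut? s h (toggle (a , c , b , d) G) (a , c , b , d))
          (two? a b ×-dec ring? h g c d) (λ cu → proj₂ (back (a , c , b , d) cu)))
        (≤-reflexive (ι-× (two? a b) (ring? h g c d)))
      few : ∑₂ tw ≤ 2 * n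
      few = ≤-trans (∑-mono fin row) (≤-reflexive (trans (∑fin-const n 2) (*-comm n 2)))
        where
        row : ∀ a → ∑ fin (tw a) ≤ 2
        row a with D a ℕ.≟ 2
        ... | yes e = ≤-trans (∑-mono fin (λ b → ι-mono (two? a b) (T? (g a b)) proj₂))
              (≤-reflexive (trans (degree re a) e))
        ... | no ne = ≤-trans (≤-reflexive (trans (∑-cong fin (λ b → ι-no (two? a b) (λ (e , _) → ne e))) (∑ᴸ-0 (allFin n)))) z≤n

  -- F bounds the good walks from below. An oriented ring edge is counted for at most 2 n cuts that
  -- could have produced it, and m times as a ring present from the start.
  cut-bound : ∀ s m {F} → F + ((m + 4) * M D + (2 * s + 2 * M D)) ≤ 2 * n →
    m * F * #small D r Q s ≤ (2 * n + m) * small-rings s (m + 4)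
  cut-bound s m {F} room = begin
    m * F * #small D r Q s ≡⟨ ∑-*ˡ graphs (m * F) (λ G → ι (small? D r Q s (adj G))) ⟨
    ∑ graphs (λ G → m * F * ι (small? D r Q s (adj G))) ≤⟨ ∑-mono graphs per-graph ⟩
    ∑ graphs (λ G → ∑ quads (λ σ → ι (cut? s (m + 4) G σ)) + m * (ι (small? D r Q s (adj G)) * #rings (m + 4) (adj G)))
      ≡⟨ trans (∑-+ graphs (λ G → ∑ quads (λ σ → ι (cut? s (m + 4) G σ)))
               (λ G → m * (ι (small? D r Q s (adj G)) * #rings (m + 4) (adj G))))
           (cong (∑ graphs (λ G → ∑ quads (λ σ → ι (cut? s (m + 4) G σ))) +_)
             (∑-*ˡ graphs m (λ G → ι (small? D r Q s (adj G)) * #rings (m + 4) (adj G)))) ⟩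
    ∑ graphs (λ G → ∑ quads (λ σ → ι (cut? s (m + 4) G σ))) + m * small-rings s (m + 4)
      ≤⟨ +-monoˡ-≤ (m * small-rings s (m + 4)) (switch-count
           (λ G → ι (small? D r Q s (adj G)) * #rings (m + 4) (adj G) * (2 * n)) (cut? s (m + 4)) (cut-reversals s (m + 4))) ⟩
    ∑ graphs (λ G → ι (small? D r Q s (adj G)) * #rings (m + 4) (adj G) * (2 * n)) + m * small-rings s (m + 4)
      ≡⟨ cong (_+ m * small-rings s (m + 4)) (trans (∑-*ʳ graphs (2 * n) (λ G → ι (small? D r Q s (adj G)) * #rings (m + 4) (adj G)))
           (*-comm (small-rings s (m + 4)) (2 * n))) ⟩
    2 * n * small-rings s (m + 4) + m * small-rings s (m + 4) ≡⟨ *-distribʳ-+ (small-rings s (m + 4)) (2 * n) m ⟨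
    (2 * n + m) * small-rings s (m + 4) ∎
    where
    open ≤-Reasoning
    per-graph : ∀ G → m * F * ι (small? D r Q s (adj G)) ≤
      ∑ quads (λ σ → ι (cut? s (m + 4) G σ)) + m * (ι (small? D r Q s (adj G)) * #rings (m + 4) (adj G))
    per-graph G = go (small? D r Q s (adj G))
      where
      cuts = ∑ quads (λ σ → ι (cut? s (m + 4) G σ))
      go : (d : Dec (Small D r Q s (adj G))) → m * F * ι d ≤ cuts + m * (ι d * #rings (m + 4) (adj G))
      go (no _) = ≤-trans (≤-reflexive (*-zeroʳ (m * F))) z≤n
      go (yes sm) = ≤-trans (≤-reflexive (*-identityʳ (m * F))) (≤-trans (many-cuts {s} {m} G sm {F} room)
        (≤-reflexive (cong (λ z → cuts + m * z) (sym (*-identityˡ (#rings (m + 4) (adj G)))))))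

  small-step : ∀ s m {F} → F + ((m + 4) * M D + (2 * s + 2 * M D)) ≤ 2 * n →
    M D * (m * F) * #small D r Q s ≤ (2 * n + m) * (Q * (2 * (s + (m + 4)))) * #small D r Q (s + (m + 4))
  small-step s m {F} room = begin
    M D * (m * F) * #small D r Q s ≡⟨ *-assoc (M D) (m * F) _ ⟩
    M D * (m * F * #small D r Q s) ≤⟨ *-monoʳ-≤ (M D) (cut-bound s m room) ⟩
    M D * ((2 * n + m) * small-rings s (m + 4)) ≡⟨ swap (M D) (2 * n + m) (small-rings s (m + 4)) ⟩
    (2 * n + m) * (M D * small-rings s (m + 4)) ≤⟨ *-monoʳ-≤ (2 * n + m) (merge-bound s (m + 4)) ⟩
    (2 * n + m) * (Q * (2 * (s + (m + 4))) * #small D r Q (s + (m + 4))) ≡⟨ *-assoc (2 * n + m) (Q * (2 * (s + (m + 4)))) _ ⟨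
    (2 * n + m) * (Q * (2 * (s + (m + 4)))) * #small D r Q (s + (m + 4)) ∎
    where
    open ≤-Reasoning
    swap : ∀ a b c → a * (b * c) ≡ b * (a * c)
    swap = solve-∀

-- Choice of parameters

-- The two leading terms of the binomial expansion.
x^1+q+[1+q]x^q≤[1+x]^1+q : ∀ x q → x ^ suc q + suc q * x ^ q ≤ suc x ^ suc q
x^1+q+[1+q]x^q≤[1+x]^1+q x zero = ≤-reflexive (simp x)
  where
  simp : ∀ x → x * 1 + 1 ≡ suc x * 1
  simp = solve-∀
x^1+q+[1+q]x^q≤[1+x]^1+q x (suc q) = begin
  x * (x * x ^ q) + suc (suc q) * (x * x ^ q)                ≤⟨ m≤m+n _ (suc q * x ^ q) ⟩
  x * (x * x ^ q) + suc (suc q) * (x * x ^ q) + suc q * x ^ q ≡⟨ expand x q (x ^ q) ⟩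
  suc x * (x ^ suc q + suc q * x ^ q)                        ≤⟨ *-monoʳ-≤ (suc x) (x^1+q+[1+q]x^q≤[1+x]^1+q x q) ⟩
  suc x * suc x ^ suc q ∎
  where
  open ≤-Reasoning
  expand : ∀ x q y → x * (x * y) + suc (suc q) * (x * y) + suc q * y ≡ suc x * (x * y + suc q * y)
  expand = solve-∀

^-distribʳ-* : ∀ t x y → (x * y) ^ t ≡ x ^ t * y ^ t
^-distribʳ-* zero x y = refl
^-distribʳ-* (suc t) x y = trans (cong (x * y *_) (^-distribʳ-* t x y)) (shuffle x y (x ^ t) (y ^ t))
  where
  shuffle : ∀ a b c d → a * b * (c * d) ≡ a * c * (b * d)
  shuffle = solve-∀

-- By Pascal's rule the left side is at most x^(q+1) + (q+1) x^q with x = p + q + 1, to which the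
-- preceding inequality applies.
pascal-! : ∀ p q → pascal p q * q ! ≤ (p + q) ^ q
pascal-! zero q = ≤-trans (≤-reflexive (*-identityˡ (q !))) (go q)
  where
  go : ∀ q → q ! ≤ q ^ q
  go zero = ≤-refl
  go (suc q) = *-monoʳ-≤ (suc q) (≤-trans (go q) (^-monoˡ-≤ q (n≤1+n q)))
pascal-! (suc p) zero = ≤-refl
pascal-! (suc p) (suc q) = begin
  (pascal p (suc q) + pascal (suc p) q) * (suc q * q !)
    ≡⟨ split (pascal p (suc q)) (pascal (suc p) q) (suc q) (q !) ⟩
  pascal p (suc q) * (suc q) ! + suc q * (pascal (suc p) q * q !)
    ≤⟨ +-mono-≤ (pascal-! p (suc q)) (*-monoʳ-≤ (suc q) (pascal-! (suc p) q)) ⟩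
  (p + suc q) ^ suc q + suc q * (suc p + q) ^ q
    ≡⟨ cong (λ z → (p + suc q) ^ suc q + suc q * z ^ q) (sym (+-suc p q)) ⟩
  (p + suc q) ^ suc q + suc q * (p + suc q) ^ q ≤⟨ x^1+q+[1+q]x^q≤[1+x]^1+q (p + suc q) q ⟩
  (suc p + suc q) ^ suc q ∎
  where
  open ≤-Reasoning
  split : ∀ a b c d → (a + b) * (c * d) ≡ a * (c * d) + c * (b * d)
  split = solve-∀

-- The new factor 2 (2t + 2)^2 is at most 4 (2t + 2)(2t + 1). The factorial is the one that
-- `pascal-!` attaches to the binomial coefficient, so both disappear together.
reversals-! : ∀ t → reversals t ≤ 4 ^ t * (2 * t) !
reversals-! zero = ≤-refl
reversals-! (suc t) = begin
  reversals t * (2 * ((2 * suc t) * (2 * suc t)))   ≤⟨ *-monoˡ-≤ _ (reversals-! t) ⟩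
  4 ^ t * (2 * t) ! * (2 * ((2 * suc t) * (2 * suc t)))
    ≡⟨ cong (λ z → 4 ^ t * (2 * t) ! * (2 * (z * z))) (double t) ⟩
  4 ^ t * (2 * t) ! * (2 * (suc (suc (2 * t)) * suc (suc (2 * t))))
    ≤⟨ *-monoʳ-≤ (4 ^ t * (2 * t) !) (*-monoʳ-≤ 2 (*-monoʳ-≤ (suc (suc (2 * t))) (≤-trans (m≤m+n _ (2 * t)) (≤-reflexive (twice t))))) ⟩
  4 ^ t * (2 * t) ! * (2 * (suc (suc (2 * t)) * (2 * suc (2 * t)))) ≡⟨ collect (4 ^ t) ((2 * t) !) (suc (suc (2 * t))) (suc (2 * t)) ⟩
  4 * 4 ^ t * (suc (suc (2 * t))) !                 ≡⟨ cong (λ z → 4 * 4 ^ t * z !) (double t) ⟨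
  4 ^ suc t * (2 * suc t) ! ∎
  where
  open ≤-Reasoning
  double : ∀ t → 2 * suc t ≡ suc (suc (2 * t))
  double = solve-∀
  twice : ∀ t → suc (suc (2 * t)) + 2 * t ≡ 2 * suc (2 * t)
  twice = solve-∀
  collect : ∀ a f x y → a * f * (2 * (x * (2 * y))) ≡ 4 * a * (x * (y * f))
  collect = solve-∀

reversals-pascal : ∀ s t → 2 * t ≤ s → reversals t * pascal s (2 * t) ≤ (16 * (s * s)) ^ t
reversals-pascal s t 2t≤s = begin
  reversals t * pascal s (2 * t)           ≤⟨ *-monoˡ-≤ (pascal s (2 * t)) (reversals-! t) ⟩
  4 ^ t * (2 * t) ! * pascal s (2 * t)     ≡⟨ shuffle (4 ^ t) ((2 * t) !) (pascal s (2 * t)) ⟩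
  4 ^ t * (pascal s (2 * t) * (2 * t) !)   ≤⟨ *-monoʳ-≤ (4 ^ t) (pascal-! s (2 * t)) ⟩
  4 ^ t * (s + 2 * t) ^ (2 * t)            ≤⟨ *-monoʳ-≤ (4 ^ t) (^-monoˡ-≤ (2 * t) (+-monoʳ-≤ s 2t≤s)) ⟩
  4 ^ t * (s + s) ^ (2 * t)                ≡⟨ cong (4 ^ t *_) (^-*-assoc (s + s) 2 t) ⟨
  4 ^ t * ((s + s) ^ 2) ^ t                ≡⟨ ^-distribʳ-* t 4 ((s + s) ^ 2) ⟨
  (4 * (s + s) ^ 2) ^ t                    ≡⟨ cong (_^ t) (square s) ⟩
  (16 * (s * s)) ^ t ∎
  where
  open ≤-Reasoning
  shuffle : ∀ a b c → a * b * c ≡ a * (c * b)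
  shuffle = solve-∀
  square : ∀ s → 4 * ((s + s) * ((s + s) * 1)) ≡ 16 * (s * s)
  square = solve-∀

module _ {n : ℕ} (D : Fin n → ℕ) (positive : IsDegreeSequence D) (r : Fin n) (Q-1 : ℕ) where
  private
    Q = suc Q-1
    Γ = 384 * Q
    #real : ℕ
    #real = ∑ graphs (λ G → ι (isReal? {D = D} (adj G)))

  -- The parameters are P = s and V = 382 s. The losses of candidates are at most 3 s, so a weight
  -- of 4 s suffices; those of free vertices are at most 2 s, out of 384 s.
  dense-small : ∀ t s → 1 ≤ s → 2 * t + (2 * t) * (2 * t) ≤ s → Γ * s ≤ n → n ≤ 48 * M D →
    2 ^ t * #small D r Q s ≤ #real
  dense-small t s 1≤s t≪s Γs≤n n≤48M = *-cancelˡ-≤ (c ^ t) {{>-nonZero (m^n>0 c {{>-nonZero c>0}} t)}} (begin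
    c ^ t * (2 ^ t * B)                      ≡⟨ *-assoc (c ^ t) (2 ^ t) B ⟨
    c ^ t * 2 ^ t * B                        ≡⟨ cong (_* B) (^-distribʳ-* t c 2) ⟨
    (c * 2) ^ t * B                          ≤⟨ *-monoˡ-≤ B (^-monoˡ-≤ t c2≤) ⟩
    (s * (382 * s)) ^ t * B                  ≤⟨ dense-bound D positive r Q-1 s {t} {s} {382 * s} enough room ⟩
    reversals t * (pascal s (2 * t) * #real) ≡⟨ *-assoc (reversals t) _ _ ⟨
    reversals t * pascal s (2 * t) * #real   ≤⟨ *-monoˡ-≤ #real (reversals-pascal s t 2t≤s) ⟩
    c ^ t * #real                            ∎)
    where
    open ≤-Reasoning
    B = #small D r Q s
    c = 16 * (s * s)
    c>0 : 0 < c
    c>0 = ≤-trans (*-mono-≤ 1≤s 1≤s) (m≤n*m (s * s) 16)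
    2t≤s : 2 * t ≤ s
    2t≤s = ≤-trans (m≤m+n (2 * t) _) t≪s
    -- The gain of 2 per step leaves ample room: 32 s² against 382 s².
    c2≤ : c * 2 ≤ s * (382 * s)
    c2≤ = ≤-trans (≤-reflexive (l s)) (≤-trans (*-monoˡ-≤ (s * s) {32} {382} (≤ᵇ⇒≤ 32 382 tt)) (≤-reflexive (l' s)))
      where
      l : ∀ s → 16 * (s * s) * 2 ≡ 32 * (s * s)
      l = solve-∀
      l' : ∀ s → 382 * (s * s) ≡ s * (382 * s)
      l' = solve-∀
    room : 382 * s + (s + 2 * t) ≤ n
    room = begin
      382 * s + (s + 2 * t) ≤⟨ +-monoʳ-≤ (382 * s) (+-monoʳ-≤ s 2t≤s) ⟩
      382 * s + (s + s) ≡⟨ collect s ⟩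
      384 * s ≤⟨ *-monoˡ-≤ s (m≤m*n 384 Q) ⟩
      Γ * s ≤⟨ Γs≤n ⟩
      n ∎
      where
      collect : ∀ s → 382 * s + (s + s) ≡ 384 * s
      collect = solve-∀
    enough : Q * (s + (2 * t + (s + (s + (2 * t) * (2 * t))))) ≤ M D
    enough = *-cancelˡ-≤ 48 (begin
      48 * (Q * (s + (2 * t + (s + (s + (2 * t) * (2 * t))))))
        ≡⟨ cong (λ z → 48 * (Q * z)) (gather s (2 * t) ((2 * t) * (2 * t))) ⟩
      48 * (Q * (3 * s + (2 * t + (2 * t) * (2 * t)))) ≤⟨ *-monoʳ-≤ 48 (*-monoʳ-≤ Q (+-monoʳ-≤ (3 * s) t≪s)) ⟩
      48 * (Q * (3 * s + s)) ≡⟨ expand Q s ⟩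
      192 * Q * s ≤⟨ *-monoˡ-≤ s (*-monoˡ-≤ Q {192} {384} (≤ᵇ⇒≤ 192 384 tt)) ⟩
      Γ * s ≤⟨ Γs≤n ⟩
      n ≤⟨ n≤48M ⟩
      48 * M D ∎)
      where
      gather : ∀ s a b → s + (a + (s + (s + b))) ≡ 3 * s + (a + b)
      gather = solve-∀
      expand : ∀ q s → 48 * (q * (3 * s + s)) ≡ 192 * q * s
      expand = solve-∀

  -- Each round doubles the count while the order bound grows by h. In the end s + t h is still at
  -- most M m / (12 Q), which is what the last round needs.
  sparse-small : ∀ t s → 1 ≤ M D → 72 * Q * t ≤ M D → Γ * s ≤ n → 48 * M D ≤ n →
    2 ^ t * #small D r Q s ≤ #real
  sparse-small t s 1≤M t≪M Γs≤n 48M≤n = ≤-trans (chain t ≤-refl) (∑-mono graphs (λ G →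
      ι-mono (small? D r Q (s + t * h) (adj G)) (isReal? {D = D} (adj G)) proj₁))
    where
    open ≤-Reasoning
    instance
      8M≢0 : NonZero (8 * M D)
      8M≢0 = >-nonZero (≤-trans 1≤M (m≤n*m (M D) 8))
    -- Each step of the walks loses at most M of them, so about m steps lose at most n/8. Rounding
    -- is harmless: m is at least 2, hence h is at most 3 m and n at most 16 M m.
    m = n / (8 * M D)
    h = m + 4
    n≥8Mm : 8 * M D * m ≤ n
    n≥8Mm = ≤-trans (≤-reflexive (*-comm (8 * M D) m)) (m/n*n≤m n (8 * M D))
    2≤m : 2 ≤ m
    2≤m = ≤-trans (≤-reflexive (sym (m*n/n≡m 2 (8 * M D)))) (/-monoˡ-≤ (8 * M D)
      (≤-trans (≤-reflexive (sixteen (M D))) (≤-trans (*-monoˡ-≤ (M D) {16} {48} (≤ᵇ⇒≤ 16 48 tt)) 48M≤n)))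
      where
      sixteen : ∀ x → 2 * (8 * x) ≡ 16 * x
      sixteen = solve-∀
    n≤16Mm : n ≤ 16 * (M D * m)
    n≤16Mm = begin
      n ≤⟨ <⇒≤ (below n) ⟩
      suc m * (8 * M D) ≤⟨ *-monoˡ-≤ (8 * M D) (≤-trans (+-monoˡ-≤ m (≤-trans (s≤s z≤n) 2≤m)) (≤-reflexive (cong (m +_) (sym (+-identityʳ m))))) ⟩
      2 * m * (8 * M D) ≡⟨ sixteen m (M D) ⟩
      16 * (M D * m) ∎
      where
      sixteen : ∀ m x → 2 * m * (8 * x) ≡ 16 * (x * m)
      sixteen = solve-∀
      below : ∀ n → n < suc (n / (8 * M D)) * (8 * M D)
      below n = ≤-trans (s≤s (≤-reflexive (m≡m%n+[m/n]*n n (8 * M D)))) (+-monoˡ-≤ _ (m%n<n n (8 * M D)))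
    m≤n : m ≤ n
    m≤n = ≤-trans (m≤n*m m (8 * M D)) n≥8Mm
    h≤3m : h ≤ 3 * m
    h≤3m = ≤-trans (+-monoʳ-≤ m (*-monoʳ-≤ 2 2≤m)) ≤-refl
    th≤ : 24 * Q * (t * h) ≤ M D * m
    th≤ = begin
      24 * Q * (t * h) ≤⟨ *-monoʳ-≤ (24 * Q) (*-monoʳ-≤ t h≤3m) ⟩
      24 * Q * (t * (3 * m)) ≡⟨ rearrange Q t m ⟩
      72 * Q * t * m ≤⟨ *-monoˡ-≤ m t≪M ⟩
      M D * m ∎
      where
      rearrange : ∀ q t m → 24 * q * (t * (3 * m)) ≡ 72 * q * t * m
      rearrange = solve-∀
    s≤ : 24 * Q * s ≤ M D * m
    s≤ = *-cancelˡ-≤ 16 (≤-trans (≤-reflexive (rearrange Q s)) (≤-trans Γs≤n n≤16Mm))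
      where
      rearrange : ∀ q s → 16 * (24 * q * s) ≡ 384 * q * s
      rearrange = solve-∀
    size≤ : ∀ j → j ≤ t → 12 * Q * (s + j * h) ≤ M D * m
    size≤ j j≤t = *-cancelˡ-≤ 2 (begin
      2 * (12 * Q * (s + j * h)) ≡⟨ rearrange Q s (j * h) ⟩
      24 * Q * s + 24 * Q * (j * h) ≤⟨ +-mono-≤ s≤ (≤-trans (*-monoʳ-≤ (24 * Q) (*-monoˡ-≤ h j≤t)) th≤) ⟩
      M D * m + M D * m ≡⟨ cong (M D * m +_) (+-identityʳ (M D * m)) ⟨
      2 * (M D * m) ∎)
      where
      rearrange : ∀ q a b → 2 * (12 * q * (a + b)) ≡ 24 * q * a + 24 * q * b
      rearrange = solve-∀
    -- At least F = n good walks remain. The threshold 48 arises here: after multiplication by 8,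
    -- the 4 M from h and the 2 M from `good-start` become 48 M.
    room : ∀ j → j ≤ t → n + (h * M D + (2 * (s + j * h) + 2 * M D)) ≤ 2 * n
    room j j≤t = ≤-trans (+-monoʳ-≤ n (*-cancelˡ-≤ 8 (begin
      8 * (h * M D + (2 * (s + j * h) + 2 * M D)) ≡⟨ rearrange m (M D) (s + j * h) ⟩
      8 * M D * m + (48 * M D + 16 * (s + j * h)) ≤⟨ +-mono-≤ n≥8Mm (+-mono-≤ 48M≤n small) ⟩
      n + (n + 2 * n) ≤⟨ ≤-trans (m≤m+n _ (4 * n)) (≤-reflexive (eight n)) ⟩
      8 * n ∎))) (≤-reflexive (cong (n +_) (sym (+-identityʳ n))))
      where
      rearrange : ∀ m x y → 8 * ((m + 4) * x + (2 * y + 2 * x)) ≡ 8 * x * m + (48 * x + 16 * y)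
      rearrange = solve-∀
      eight : ∀ n → n + (n + 2 * n) + 4 * n ≡ 8 * n
      eight = solve-∀
      small : 16 * (s + j * h) ≤ 2 * n
      small = begin
        16 * (s + j * h) ≤⟨ *-monoˡ-≤ (s + j * h) (≤-trans (≤ᵇ⇒≤ 16 24 tt) (≤-trans (m≤m*n 24 Q) (≤-reflexive (tw Q)))) ⟩
        2 * (12 * Q) * (s + j * h) ≡⟨ *-assoc 2 (12 * Q) (s + j * h) ⟩
        2 * (12 * Q * (s + j * h)) ≤⟨ *-monoʳ-≤ 2 (≤-trans (size≤ j j≤t) (≤-trans (m≤n*m (M D * m) 8) (≤-trans (≤-reflexive (sym (*-assoc 8 (M D) m))) n≥8Mm))) ⟩
        2 * n ∎
        where
        tw : ∀ q → 24 * q ≡ 2 * (12 * q)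
        tw = solve-∀
    B : ℕ → ℕ
    B j = #small D r Q (s + j * h)
    halve : ∀ j → suc j ≤ t → 2 * B j ≤ B (suc j)
    halve j j<t = *-cancelˡ-≤ A {{>-nonZero A>0}} (begin
      A * (2 * B j) ≡⟨ rearrange A (B j) ⟩
      2 * (A * B j) ≤⟨ *-monoʳ-≤ 2 (SparseBound.small-step D positive r Q (s + j * h) m {n} (room j (<⇒≤ j<t))) ⟩
      2 * ((2 * n + m) * (Q * (2 * s')) * #small D r Q s') ≡⟨ *-assoc 2 ((2 * n + m) * (Q * (2 * s'))) _ ⟨
      2 * ((2 * n + m) * (Q * (2 * s'))) * #small D r Q s' ≤⟨ *-monoˡ-≤ (#small D r Q s') factor ⟩
      A * #small D r Q s' ≡⟨ cong (λ z → A * #small D r Q z) s'≡ ⟩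
      A * B (suc j) ∎)
      where
      A = M D * (m * n)
      A>0 : 0 < A
      A>0 = *-mono-≤ 1≤M (*-mono-≤ (≤-trans (s≤s z≤n) 2≤m) (≤-trans 1≤M (≤-trans (m≤n*m (M D) 48) 48M≤n)))
      s' = s + j * h + h
      s'≡ : s' ≡ s + suc j * h
      s'≡ = trans (+-assoc s (j * h) h) (cong (s +_) (+-comm (j * h) h))
      rearrange : ∀ a b → a * (2 * b) ≡ 2 * (a * b)
      rearrange = solve-∀
      -- The 12 of `size≤` is the product of the gain 2, of 3 from 2 n + m ≤ 3 n, and of the 2 in
      -- the reversal of a join.
      factor : 2 * ((2 * n + m) * (Q * (2 * s'))) ≤ A
      factor = begin
        2 * ((2 * n + m) * (Q * (2 * s'))) ≤⟨ *-monoʳ-≤ 2 (*-monoˡ-≤ (Q * (2 * s')) (+-monoʳ-≤ (2 * n) m≤n)) ⟩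
        2 * ((2 * n + n) * (Q * (2 * s'))) ≡⟨ twelve n Q s' ⟩
        n * (12 * Q * s') ≡⟨ cong (λ z → n * (12 * Q * z)) s'≡ ⟩
        n * (12 * Q * (s + suc j * h)) ≤⟨ *-monoʳ-≤ n (size≤ (suc j) j<t) ⟩
        n * (M D * m) ≡⟨ last n (M D) m ⟩
        A ∎
        where
        twelve : ∀ n q s → 2 * ((2 * n + n) * (q * (2 * s))) ≡ n * (12 * q * s)
        twelve = solve-∀
        last : ∀ n x m → n * (x * m) ≡ x * (m * n)
        last = solve-∀
    chain : ∀ j → j ≤ t → 2 ^ j * #small D r Q s ≤ B j
    chain zero _ = ≤-reflexive (trans (*-identityˡ _) (cong (#small D r Q) (sym (+-identityʳ s))))
    chain (suc j) j<t = begin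
      2 * 2 ^ j * #small D r Q s ≡⟨ *-assoc 2 (2 ^ j) _ ⟩
      2 * (2 ^ j * #small D r Q s) ≤⟨ *-monoʳ-≤ 2 (chain j (<⇒≤ j<t)) ⟩
      2 * B j ≤⟨ halve j j<t ⟩
      B (suc j) ∎

  few-small : ∀ t s → 1 ≤ s → 2 * t + (2 * t) * (2 * t) ≤ s → Γ * s ≤ n → 1 + 72 * Q * t ≤ M D →
    2 ^ t * #small D r Q s ≤ #real
  few-small t s 1≤s t≪s Γs≤n t≪M with ≤-total n (48 * M D)
  ... | inj₁ n≤48M = dense-small t s 1≤s t≪s Γs≤n n≤48M
  ... | inj₂ 48M≤n = sparse-small t s (≤-trans (s≤s z≤n) t≪M) (≤-trans (n≤1+n _) t≪M) Γs≤n 48M≤n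

-- Back to the probability space

module _ {n : ℕ} where

  conn-≈ : {G H : Adj n} → G ≈ᴬ H → ∀ i j → conn G i j ≡ conn H i j
  conn-≈ {G} {H} e i j = T-ext (conn-least (transport H G (λ a b → sym (e a b))) (conn-refl H i))
    (conn-least (transport G H e) (conn-refl G i))
    where
    transport : ∀ G H → G ≈ᴬ H → Closed H (conn G i)
    transport G H e a b ca h = conn-closed G i a b ca (subst T (sym (e a b)) h)

scaled-≤⁺ : ∀ {a d-1 m c} .{cop : Coprime a (suc d-1)} → a * m ≤ suc d-1 * c →
  mkℚ (ℤ.+ a) d-1 cop *ℚ toℚ m ≤ℚ toℚ c
scaled-≤⁻ : ∀ {a d-1 m c} .{cop : Coprime a (suc d-1)} →
  mkℚ (ℤ.+ a) d-1 cop *ℚ toℚ m ≤ℚ toℚ c → a * m ≤ suc d-1 * c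

-- The product of normalised rationals involves a gcd; for unnormalised ones the order is plain
-- cross multiplication of integers.
scaled-unnormalised : ∀ a d-1 m .{cop : Coprime a (suc d-1)} →
  ℚ.toℚᵘ (mkℚ (ℤ.+ a) d-1 cop *ℚ toℚ m) ≃ᵘ mkℚᵘ (ℤ.+ a) d-1 *ᵘ mkℚᵘ (ℤ.+ m) 0
scaled-unnormalised a d-1 m {cop} = ℚᵘₚ.≃-trans (ℚₚ.toℚᵘ-homo-* (mkℚ (ℤ.+ a) d-1 cop) (toℚ m))
  (ℚᵘₚ.*-congˡ {mkℚᵘ (ℤ.+ a) d-1} (ℚₚ.toℚᵘ-fromℚᵘ (mkℚᵘ (ℤ.+ m) 0)))

scaled-≤⁺ {a} {d-1} {m} {c} h = ℚₚ.toℚᵘ-cancel-≤ (ℚᵘₚ.≤-respˡ-≃ (ℚᵘₚ.≃-sym (scaled-unnormalised a d-1 m))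
  (ℚᵘₚ.≤-respʳ-≃ (ℚᵘₚ.≃-sym (ℚₚ.toℚᵘ-fromℚᵘ (mkℚᵘ (ℤ.+ c) 0))) (ℚᵘ.*≤* cross)))
  where
  open ≤-Reasoning
  cross : ((ℤ.+ a) ℤ.* (ℤ.+ m)) ℤ.* (ℤ.+ 1) ℤ.≤ (ℤ.+ c) ℤ.* (ℤ.+ suc (d-1 * 1))
  cross rewrite sym (ℤₚ.pos-* a m) | ℤₚ.*-identityʳ (ℤ.+ (a * m)) | sym (ℤₚ.pos-* c (suc (d-1 * 1))) =
    ℤ.+≤+ (≤-trans h (≤-reflexive (trans (*-comm (suc d-1) c) (cong (λ z → c * suc z) (sym (*-identityʳ d-1))))))

scaled-≤⁻ {a} {d-1} {m} {c} h with ℚᵘₚ.≤-respˡ-≃ (scaled-unnormalised a d-1 m)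
  (ℚᵘₚ.≤-respʳ-≃ (ℚₚ.toℚᵘ-fromℚᵘ (mkℚᵘ (ℤ.+ c) 0)) (ℚₚ.toℚᵘ-mono-≤ h))
... | ℚᵘ.*≤* cross = uncross cross
  where
  uncross : ((ℤ.+ a) ℤ.* (ℤ.+ m)) ℤ.* (ℤ.+ 1) ℤ.≤ (ℤ.+ c) ℤ.* (ℤ.+ suc (d-1 * 1)) → a * m ≤ suc d-1 * c
  uncross cross rewrite sym (ℤₚ.pos-* a m) | ℤₚ.*-identityʳ (ℤ.+ (a * m)) | sym (ℤₚ.pos-* c (suc (d-1 * 1))) =
    ≤-trans (ℤₚ.drop‿+≤+ cross) (≤-reflexive (trans (cong (λ z → c * suc z) (*-identityʳ d-1)) (*-comm c (suc d-1))))

scaled-≰⁻ : ∀ {a d-1 m c} .{cop : Coprime a (suc d-1)} →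
  ¬ (mkℚ (ℤ.+ a) d-1 cop *ℚ toℚ m ≤ℚ toℚ c) → suc d-1 * c ≤ a * m
scaled-≰⁻ {a} {d-1} {m} {c} ¬le =
  [ id , (λ ge → ⊥-elim (¬le (scaled-≤⁺ {a} {d-1} {m} {c} ge))) ]′ (≤-total (suc d-1 * c) (a * m))

∑ᴸ-filterᵇ : {A : Set} (q : A → Bool) (xs : List A) (f : A → ℕ) →
  ∑ᴸ (filterᵇ q xs) f ≡ ∑ᴸ xs (λ x → ι (T? (q x)) * f x)
∑ᴸ-filterᵇ q [] f = refl
∑ᴸ-filterᵇ q (x ∷ xs) f with q x
... | true = cong₂ _+_ (sym (*-identityˡ (f x))) (∑ᴸ-filterᵇ q xs f)
... | false = ∑ᴸ-filterᵇ q xs f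

not-any-but-any : ∀ {n} (p a q : Fin n → Bool) → T (not (anyB p) ∧ anyB (λ v → a v ∧ q v)) →
  (∀ v → ¬ T (p v)) × ∃[ v ] T (q v)
not-any-but-any p a q t with T-∧⁻ {not (anyB p)} t
... | none , some with anyB⁻ {p = λ v → a v ∧ q v} some
...   | v , both = (λ w pw → T-not⁻ none (anyB⁺ {p = p} w pw)) , v , proj₂ (T-∧⁻ {a v} both)

badEvent⁻ : ∀ {n} (γ ρ : ℚ) (D : Fin n → ℕ) (G : Adj n) → T (badEvent γ ρ D G) →
  (∀ v → ¬ ((γ *ℚ toℚ n) ≤ℚ toℚ (compOrder G v))) ×
  ∃[ v ] ((ρ *ℚ toℚ (M D)) ≤ℚ toℚ (mCompSize (Hof G) v))
badEvent⁻ {n} γ ρ D G t =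
  (λ v le → proj₁ split v (ℚₚ.≤⇒≤ᵇ {γ *ℚ toℚ n} {toℚ (compOrder G v)} le)) ,
  proj₁ (proj₂ split) ,
  ℚₚ.≤ᵇ⇒≤ {ρ *ℚ toℚ (M D)} {toℚ (mCompSize (Hof G) (proj₁ (proj₂ split)))} (proj₂ (proj₂ split))
  where
  split : (∀ v → ¬ T ((γ *ℚ toℚ n) ≤ᵇℚ toℚ (compOrder G v))) ×
    ∃[ v ] T ((ρ *ℚ toℚ (M D)) ≤ᵇℚ toℚ (mCompSize (Hof G) v))
  split = not-any-but-any (λ v → (γ *ℚ toℚ n) ≤ᵇℚ toℚ (compOrder G v)) (alive (Hof G))
    (λ v → (ρ *ℚ toℚ (M D)) ≤ᵇℚ toℚ (mCompSize (Hof G) v)) t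

module _ {n : ℕ} (D : Fin n → ℕ) (Q g-1 : ℕ) (bad : Adj n → Bool)
  (bad⁻ : {G : Adj n} → IsReal D G → T (bad G) →
    (∀ v → suc g-1 * countB (conn G v) ≤ n) × ∃[ v ] (M D ≤ Q * W D (conn G v))) where
  private
    S = n / suc g-1

  -- In a bad graph every vertex of the heavy component, taken as root, sees the same small and
  -- heavy component. These roots have total weight at least M/Q.
  weigh-bad : M D * length (filterᵇ bad (graphsOf D)) ≤ Q * ∑ fin (λ r → wt D r * #small D r Q S)
  weigh-bad = begin
    M D * length (filterᵇ bad (graphsOf D))
      ≡⟨ cong (M D *_) (trans (length-filterᵇ bad (graphsOf D))
           (∑ᴸ-filterᵇ (realises D) adjs (λ G → ι (T? (bad G))))) ⟩
    M D * ∑ᴸ adjs (λ G → ι (T? (realises D G)) * ι (T? (bad G)))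
      ≡⟨ ∑ᴸ-*ˡ (M D) adjs (λ G → ι (T? (realises D G)) * ι (T? (bad G))) ⟨
    ∑ᴸ adjs (λ G → M D * (ι (T? (realises D G)) * ι (T? (bad G))))
      ≤⟨ ∑ᴸ-Pointwise-≤ (adjs-graphs n) per-graph ⟩
    ∑ graphs (λ H → Q * ∑ fin (λ r → wt D r * ι (small? D r Q S (adj H))))
      ≡⟨ ∑-*ˡ graphs Q (λ H → ∑ fin (λ r → wt D r * ι (small? D r Q S (adj H)))) ⟩
    Q * ∑ graphs (λ H → ∑ fin (λ r → wt D r * ι (small? D r Q S (adj H))))
      ≡⟨ cong (Q *_) (trans (∑-swap graphs fin (λ H r → wt D r * ι (small? D r Q S (adj H))))
           (∑-cong fin (λ r → ∑-*ˡ graphs (wt D r) (λ H → ι (small? D r Q S (adj H)))))) ⟩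
    Q * ∑ fin (λ r → wt D r * #small D r Q S) ∎
    where
    open ≤-Reasoning
    adjs = allFuns n (allFuns n (true ∷ false ∷ []))
    per-graph : ∀ G H → G ≈ᴬ adj H → M D * (ι (T? (realises D G)) * ι (T? (bad G))) ≤
      Q * ∑ fin (λ r → wt D r * ι (small? D r Q S (adj H)))
    per-graph G H e = ≤-trans (≤-reflexive (trans (*-comm (M D) _)
        (cong (_* M D) (sym (ι-× (T? (realises D G)) (T? (bad G)))))))
      (ι*-≤ (T? (realises D G) ×-dec T? (bad G)) (λ (re , b) → in-H (realises⁻ re) (bad⁻ (realises⁻ re) b)))
      where
      in-H : IsReal D G → (∀ v → suc g-1 * countB (conn G v) ≤ n) × ∃[ v ] (M D ≤ Q * W D (conn G v)) →
        M D ≤ Q * ∑ fin (λ r → wt D r * ι (small? D r Q S (adj H)))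
      in-H re (orders , v , M≤) = ≤-trans M≤ (*-monoʳ-≤ Q (∑-mono fin pointwise))
        where
        small-at : ∀ r → T (conn G v r) → Small D r Q S (adj H)
        small-at r cvr = IsReal-≈ e re ,
          ≤-trans (≤-reflexive (countB-cong (λ j → sym (conn-≈ e r j))))
            (≤-trans (≤-reflexive (sym (m*n/n≡m (countB (conn G r)) (suc g-1))))
              (/-monoˡ-≤ (suc g-1) (≤-trans (≤-reflexive (*-comm (countB (conn G r)) (suc g-1))) (orders r)))) ,
          ≤-trans M≤ (≤-reflexive (cong (Q *_) (W-cong D (λ j → trans (conn-same G (symm re) cvr j) (conn-≈ e r j)))))
        pointwise : ∀ r → (if conn G v r then wt D r else 0) ≤ wt D r * ι (small? D r Q S (adj H))
        pointwise r with T? (conn G v r)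
        ... | no ¬c rewrite T-false ¬c = z≤n
        ... | yes c rewrite T-true c = ≤-reflexive (sym (trans
              (cong (wt D r *_) (ι-yes (small? D r Q S (adj H)) (small-at r c))) (*-identityʳ (wt D r))))

#real≤graphsOf : ∀ {n} (D : Fin n → ℕ) → ∑ graphs (λ G → ι (isReal? {D = D} (adj G))) ≤ length (graphsOf D)
#real≤graphsOf {n} D = ≤-trans
  (∑ᴸ-Pointwise-≥ (adjs-graphs n) (λ G H e → ι-mono (isReal? (adj H)) (T? (realises D G))
    (λ re → realises⁺ (IsReal-≈ (λ i j → sym (e i j)) re))))
  (≤-reflexive (sym (length-filterᵇ (realises D) (allFuns n (allFuns n (true ∷ false ∷ []))))))


n≤2^n : ∀ n → n ≤ 2 ^ n
n≤2^n zero = z≤n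
n≤2^n (suc n) = ≤-trans (+-mono-≤ (m^n>0 2 n) (n≤2^n n)) (≤-reflexive (cong (2 ^ n +_) (sym (+-identityʳ (2 ^ n)))))

module _ (lam : ℕ → ℕ) (unbounded : ∀ K → ∃[ N ] (∀ n → N ≤ n → K ≤ lam n)) (ρ γ : ℚ) (d-1 : ℕ) where
  private
    Q = suc d-1
    Γ = 384 * Q
    g-1 = ℕ.pred Γ

  few-bad : (∀ {m c} → ¬ ((γ *ℚ toℚ m) ≤ℚ toℚ c) → Γ * c ≤ m) →
    (∀ {m c} → (ρ *ℚ toℚ m) ≤ℚ toℚ c → m ≤ Q * c) →
    ∀ k → ∃[ N ] (∀ n → N ≤ n → (D : Fin n → ℕ) →
      IsDegreeSequence D → Feasible D → WellBehaved lam D →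
      suc k * badCount γ ρ D ≤ length (graphsOf D))
  few-bad light heavy k = N₁ + Γ * s₀ , estimate
    where
    -- The factor Q pays for averaging over roots, the factor k + 1 for the error, since 2 ^ t is at
    -- least t.
    t = Q * suc k
    -- Apart from the 1, which keeps S positive, these are the boundary edges after t moves and the
    -- ordered pairs of border vertices.
    s₀ = 1 + (2 * t + (2 * t) * (2 * t))
    large = unbounded (1 + 72 * Q * t)
    N₁ = proj₁ large
    estimate : ∀ n → N₁ + Γ * s₀ ≤ n → (D : Fin n → ℕ) →
      IsDegreeSequence D → Feasible D → WellBehaved lam D →
      suc k * badCount γ ρ D ≤ length (graphsOf D)
    estimate n N≤n D positive _ well-behaved = *-cancelˡ-≤ Q (*-cancelˡ-≤ (M D) {{>-nonZero 1≤M}} (begin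
      M D * (Q * (suc k * bad))     ≡⟨ shuffle (M D) Q (suc k) bad ⟩
      t * (M D * bad)               ≤⟨ *-mono-≤ (n≤2^n t) bad-bound ⟩
      2 ^ t * (Q * ∑ fin (λ r → wt D r * #small D r Q S))
        ≡⟨ trans (swap (2 ^ t) Q (∑ fin (λ r → wt D r * #small D r Q S)))
             (cong (Q *_) (sym (∑-*ˡ fin (2 ^ t) (λ r → wt D r * #small D r Q S)))) ⟩
      Q * ∑ fin (λ r → 2 ^ t * (wt D r * #small D r Q S)) ≤⟨ *-monoʳ-≤ Q (∑-mono fin per-root) ⟩
      Q * ∑ fin (λ r → wt D r * length (graphsOf D)) ≡⟨ cong (Q *_) (∑-*ʳ fin (length (graphsOf D)) (wt D)) ⟩
      Q * (M D * length (graphsOf D)) ≡⟨ swap Q (M D) (length (graphsOf D)) ⟩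
      M D * (Q * length (graphsOf D)) ∎))
      where
      open ≤-Reasoning
      swap : ∀ a b c → a * (b * c) ≡ b * (a * c)
      swap = solve-∀
      shuffle : ∀ m q k b → m * (q * (k * b)) ≡ q * k * (m * b)
      shuffle = solve-∀
      bad = badCount γ ρ D
      S = n / Γ
      bad⁻ : {G : Adj n} → IsReal D G → T (badEvent γ ρ D G) →
        (∀ v → Γ * countB (conn G v) ≤ n) × ∃[ v ] (M D ≤ Q * W D (conn G v))
      bad⁻ {G} re b = (λ v → light (proj₁ event v)) , proj₁ (proj₂ event) ,
        ≤-trans (heavy (proj₂ (proj₂ event))) (*-monoʳ-≤ Q (mCompSize≤W D G re (proj₁ (proj₂ event))))
        where event = badEvent⁻ γ ρ D G b
      bad-bound : M D * bad ≤ Q * ∑ fin (λ r → wt D r * #small D r Q S)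
      bad-bound = weigh-bad D Q g-1 (badEvent γ ρ D) (λ {G} → bad⁻ {G})
      M-large : 1 + 72 * Q * t ≤ M D
      M-large = ≤-trans (proj₂ large n (≤-trans (m≤m+n N₁ _) N≤n)) well-behaved
      1≤M : 1 ≤ M D
      1≤M = ≤-trans (s≤s z≤n) M-large
      s₀≤S : s₀ ≤ S
      s₀≤S = ≤-trans (≤-reflexive (sym (m*n/n≡m s₀ Γ)))
        (/-monoˡ-≤ Γ (≤-trans (≤-reflexive (*-comm s₀ Γ)) (≤-trans (m≤n+m (Γ * s₀) N₁) N≤n)))
      ΓS≤n : Γ * S ≤ n
      ΓS≤n = ≤-trans (≤-reflexive (*-comm Γ S)) (m/n*n≤m n Γ)
      per-root : ∀ r → 2 ^ t * (wt D r * #small D r Q S) ≤ wt D r * length (graphsOf D)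
      per-root r = ≤-trans (≤-reflexive (swap (2 ^ t) (wt D r) (#small D r Q S)))
        (*-monoʳ-≤ (wt D r) (≤-trans
          (few-small D positive r d-1 t S (≤-trans (s≤s z≤n) s₀≤S) (≤-trans (n≤1+n _) s₀≤S) ΓS≤n M-large)
          (#real≤graphsOf D)))

-- The quantifier over k expresses o(1): the probability is at most 1/(k + 1) for large n. As N is
-- chosen before D, the bound is uniform in D.
theorem5 : (lam : ℕ → ℕ) → (∀ K → ∃[ N ] (∀ n → N ≤ n → K ≤ lam n)) →
    (ρ : ℚ) → 0ℚ <ℚ ρ →
    ∃[ γ ] (0ℚ <ℚ γ × (∀ k → ∃[ N ] (∀ n → N ≤ n → (D : Fin n → ℕ) →
    IsDegreeSequence D → Feasible D → WellBehaved lam D →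
    suc k * badCount γ ρ D ≤ length (graphsOf D))))
theorem5 lam unbounded (mkℚ (ℤ.+ zero) d-1 _) (ℚ.*<* (ℤ.+<+ ()))
theorem5 lam unbounded (mkℚ ℤ.-[1+ _ ] d-1 _) (ℚ.*<* ())
-- A positive rational is at least the reciprocal of its denominator, which therefore serves as Q.
theorem5 lam unbounded (mkℚ (ℤ.+ suc a-1) d-1 copρ) _ =
  γ , ℚ.*<* (ℤ.+<+ (s≤s z≤n)) ,
  few-bad lam unbounded (mkℚ (ℤ.+ suc a-1) d-1 copρ) γ d-1
    (λ {m} {c} ¬le → ≤-trans (scaled-≰⁻ {1} {g-1} {m} {c} ¬le) (≤-reflexive (*-identityˡ m)))
    (λ {m} {c} le → ≤-trans (m≤n*m m (suc a-1)) (scaled-≤⁻ {suc a-1} {d-1} {m} {c} le))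
  where
  g-1 = ℕ.pred (384 * suc d-1)
  γ : ℚ
  γ = mkℚ (ℤ.+ 1) g-1 (1-coprimeTo (suc g-1))
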